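{- Let $H$ be a $k$-hypertournament on $n$ vertices, where $2\le k\le n-1$. Then $H$ contains an antidirected hamiltonian path if and only if $H$ is not isomorphic to any of $H_4$, $T_3^c$, $T_5^c$, $T_7^c$.
   Context: A $k$-hypertournament $H$ on $n$ vertices is a pair $(V(H),A(H))$ where $V(H)$ is a set of $n$ vertices and $A(H)$ is a set of $k$-tuples of distinct vertices (arcs) such that for every $k$-subset $S\subseteq V(H)$, $A(H)$ contains exactly one of the $k!$ $k$-tuples whose entries are the elements of $S$. A $2$-hypertournament is a tournament (the arc $(x,y)$ being the directed edge $x\to y$). For an arc $a=(y_1,\dots,y_k)$ and $i<j$, we say $y_i$ precedes $y_j$ in $a$. Two hypertournaments are isomorphic if there is a bijection between their vertex sets mapping the arc set of one onto the arc set of the other. An antidirected path in $H$ is a sequence $x_1a_1x_2a_2\cdots x_{t-1}a_{t-1}x_t$ ($t\ge 2$) of distinct vertices $x_1,\dots,x_t$ and distinct arcs $a_1,\dots,a_{t-1}$, where each arc $a_i$ contains $x_i$ and $x_{i+1}$, such that for every $i\in\{2,\dots,t-1\}$ either ($x_{i-1}$ precedes $x_i$ in $a_{i-1}$ and $x_{i+1}$ precedes $x_i$ in $a_i$) or ($x_i$ precedes $x_{i-1}$ in $a_{i-1}$ and $x_i$ precedes $x_{i+1}$ in $a_i$). An antidirected hamiltonian path is an antidirected path containing every vertex of $H$. The exceptional hypertournaments: $H_4$ is the $3$-hypertournament with vertex set $\{1,2,3,4\}$ and arc set $\{(2,3,4),(4,1,2),(3,4,1),(1,2,3)\}$. $T_3^c$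 is the tournament on vertices $z_1,z_2,z_3$ that is a directed $3$-cycle. $T_5^c$ is the tournament on vertices $z_1,\dots,z_5$ (indices mod $5$) with $z_i\to z_{i+1}$ and $z_i\to z_{i+2}$ for all $i$. $T_7^c$ is the tournament on vertices $z_1,\dots,z_7$ (indices mod $7$) with $z_i\to z_{i+1}$, $z_i\to z_{i+2}$ and $z_i\to z_{i+4}$ for all $i$. -}

module Defs where

open import Data.Nat using (ℕ; zero; suc; _+_; _%_; _<_)
open import Data.Fin as F using (Fin; toℕ)
open import Data.Fin.Subset as Sub using (Subset; ∣_∣)
open import Data.Vec using (Vec; []; _∷_; lookup; map)
open import Data.Vec.Membership.Propositional using () renaming (_∈_ to _∈ᵥ_)
open import Data.List using (List; []; _∷_)
open import Data.List.Membership.Propositional using () renaming (_∈_ to _∈ₗ_)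
open import Data.Product using (Σ; ∃; ∃-syntax; Σ-syntax; _×_; _,_)
open import Data.Sum using (_⊎_)
open import Relation.Binary.PropositionalEquality using (_≡_; subst)
open import Function.Bundles using (_⇔_; _↔_; Inverse)

Distinct : ∀ {n k} → Vec (Fin n) k → Set
Distinct {k = k} t = ∀ (i j : Fin k) → lookup t i ≡ lookup t j → i ≡ j

Precedes : ∀ {n k} → Vec (Fin n) k → Fin n → Fin n → Set
Precedes {k = k} a u v =
  Σ[ i ∈ Fin k ] Σ[ j ∈ Fin k ] (i F.< j × lookup a i ≡ u × lookup a j ≡ v)

record Hypertournament (n k : ℕ) : Set₁ where
  field
    Arc          : Vec (Fin n) k → Set
    arc-distinct : ∀ t → Arc t → Distinct t
    arc-exists   : ∀ (S : Subset n) → ∣ S ∣ ≡ k →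
                   Σ[ t ∈ Vec (Fin n) k ]
                     (Arc t × Distinct t × (∀ v → (v ∈ᵥ t) ⇔ (v Sub.∈ S)))
    arc-unique   : ∀ (S : Subset n) → ∣ S ∣ ≡ k → ∀ t t' →
                   Arc t → (∀ v → (v ∈ᵥ t) ⇔ (v Sub.∈ S)) →
                   Arc t' → (∀ v → (v ∈ᵥ t') ⇔ (v Sub.∈ S)) →
                   t ≡ t'
open Hypertournament public

-- General arc systems (vertex set Fin size, arcs = arity-tuples),
-- used to express isomorphism between hypertournaments possibly of
-- different order/arity.

record ArcSystem : Set₁ where
  field
    size  : ℕ
    arity : ℕ
    Arcs  : Vec (Fin size) arity → Set
open ArcSystem public

toSystem : ∀ {n k} → Hypertournament n k → ArcSystem
toSystem {n} {k} H = record { size = n ; arity = k ; Arcs = Arc H }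

_≅_ : ArcSystem → ArcSystem → Set
S ≅ T = Σ[ p ∈ arity S ≡ arity T ] Σ[ f ∈ (Fin (size S) ↔ Fin (size T)) ]
          (∀ (t : Vec (Fin (size S)) (arity S)) →
             Arcs S t ⇔ Arcs T (subst (Vec (Fin (size T))) p (map (Inverse.to f) t)))

-- Exceptional hypertournaments (vertex i of the paper is Fin index i-1).

H4arcs : List (Vec (Fin 4) 3)
H4arcs = (F.# 1 ∷ F.# 2 ∷ F.# 3 ∷ [])
       ∷ (F.# 3 ∷ F.# 0 ∷ F.# 1 ∷ [])
       ∷ (F.# 2 ∷ F.# 3 ∷ F.# 0 ∷ [])
       ∷ (F.# 0 ∷ F.# 1 ∷ F.# 2 ∷ [])
       ∷ []

H4 : ArcSystem
H4 = record { size = 4 ; arity = 3 ; Arcs = λ t → t ∈ₗ H4arcs }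

Circulant : (m' : ℕ) → List ℕ → ArcSystem
Circulant m' D = record
  { size = suc m' ; arity = 2
  ; Arcs = λ { (u ∷ v ∷ []) → Σ[ d ∈ ℕ ] (d ∈ₗ D × toℕ v ≡ (toℕ u + d) % suc m') } }

T3c T5c T7c : ArcSystem
T3c = Circulant 2 (1 ∷ [])
T5c = Circulant 4 (1 ∷ 2 ∷ [])
T7c = Circulant 6 (1 ∷ 2 ∷ 4 ∷ [])

-- Antidirected paths x_0 a_0 x_1 ... a_{t-2} x_{t-1} (0-indexed).

record AntidirectedPath {n k} (H : Hypertournament n k) (t : ℕ) : Set where
  field
    two≤t    : 2 Data.Nat.≤ t
    x        : ℕ → Fin n          -- vertices x 0 .. x (t-1)
    a        : ℕ → Vec (Fin n) k  -- arcs a 0 .. a (t-2)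
    x-inj    : ∀ i j → i < t → j < t → x i ≡ x j → i ≡ j
    a-inj    : ∀ i j → suc i < t → suc j < t → a i ≡ a j → i ≡ j
    a-arc    : ∀ i → suc i < t → Arc H (a i)
    a-left   : ∀ i → suc i < t → x i ∈ᵥ a i
    a-right  : ∀ i → suc i < t → x (suc i) ∈ᵥ a i
    anti     : ∀ i → suc (suc i) < t →
                 (Precedes (a i) (x i) (x (suc i))
                    × Precedes (a (suc i)) (x (suc (suc i))) (x (suc i)))
               ⊎ (Precedes (a i) (x (suc i)) (x i)
                    × Precedes (a (suc i)) (x (suc i)) (x (suc (suc i))))
open AntidirectedPath public

HasAntidirectedHamiltonianPath : ∀ {n k} → Hypertournament n k → Set
HasAntidirectedHamiltonianPath {n} H =
  Σ[ t ∈ ℕ ] Σ[ P ∈ AntidirectedPath H t ]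
    (∀ (v : Fin n) → Σ[ i ∈ ℕ ] (i < t × x P i ≡ v))

{-# OPTIONS --safe #-}
module Submission where

-- Call two vertices x, y of a vertex set U good if x or y starts an antidirected
-- path through U in which the start precedes its successor.  If all pairs are
-- good for |U| - 1 and |U| - 2 vertices, in H and in its reversal, they are good
-- for |U| (step₁): let o precede z in some arc.  If z precedes two further
-- vertices, one of them starts a path of the reversed kind avoiding z, so z
-- starts a path; otherwise two vertices precede z, and o → z ← w can be
-- continued for one of them.  The induction starts at |U| = 10, 11 for
-- tournaments, at |U| = 5, 6 for k = 3 and at |U| = k + 1, k + 2 for k ≥ 4; when
-- |U| = k + 1 ≥ 5, every arc misses just one vertex, and a similar exchange
-- (step₂) works.  The small cases are settled by decision trees that ask for the
-- order of two vertices in an arc until a path, or an exceptional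
-- hypertournament, is forced; the trees are verified by evaluation.

open import Defs
open import Data.Bool using (Bool; true; false; T; _∧_; _∨_; not; if_then_else_)
open import Data.Bool.Properties using (∨-zeroʳ)
open import Data.Empty using (⊥; ⊥-elim)
open import Data.Fin as Fin using (Fin; zero; suc; toℕ; fromℕ<)
import Data.Fin.Properties as Finₚ
open import Data.Fin.Subset as Subset using (Subset; inside; outside; ∣_∣)
import Data.Fin.Subset.Properties as Subsetₚ
open import Data.List using (List; []; _∷_; _++_; map; length; upTo; take; allFin; applyUpTo; concatMap)
open import Data.List.Membership.Propositional using (_∈_)
open import Data.List.Membership.Propositional.Properties using (∈-map⁺; ∈-map⁻; ∈-∃++; ∈-++⁺ˡ; ∈-++⁺ʳ; ∈-allFin; ∈-upTo⁺; ∈-upTo⁻; ∈-applyUpTo⁺; ∈-applyUpTo⁻; ∈-concatMap⁺; ∈-concatMap⁻)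
open import Data.List.Membership.Propositional.Properties.WithK using (unique∧set⇒bag)
open import Data.List.Properties using (length-take; length-map; length-tabulate; length-applyUpTo; map-upTo; map-∘; map-injective; ++-identityʳ; ∷-injective)
open import Data.List.Relation.Binary.BagAndSetEquality using (∼bag⇒↭)
open import Data.List.Relation.Binary.Permutation.Propositional using (_↭_; prep; swap; ↭-refl; ↭-sym; ↭-trans; ↭-reflexive)
open import Data.List.Relation.Binary.Permutation.Propositional.Properties using (map⁺; ∈-resp-↭; ↭-length; drop-∷; shift; ++⁺ˡ; ++⁺ʳ)
open import Data.List.Relation.Binary.Pointwise as Pointwise using (Pointwise; []; _∷_)
open import Data.List.Relation.Unary.All as All using (All; []; _∷_)
import Data.List.Relation.Unary.All.Properties as Allₚ
open import Data.List.Relation.Unary.AllPairs as AllPairs using ([]; _∷_)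
open import Data.List.Relation.Unary.Any as Any using (Any; here; there)
open import Data.List.Relation.Unary.Linked using (Linked; []; [-]; _∷_)
open import Data.List.Relation.Unary.Unique.Propositional using (Unique)
import Data.List.Relation.Unary.Unique.Propositional.Properties as Uniqueₚ
open import Data.Nat using (ℕ; zero; suc; _+_; _∸_; _/_; _%_; _≤_; _<_; z≤n; s≤s; _≡ᵇ_; _<ᵇ_)
open import Data.Nat.Properties using (≡ᵇ⇒≡; <ᵇ⇒<; <⇒≢; <-trans; ≤-trans; ≤-pred; ≤-reflexive; n≤1+n; m≤m+n; m≤n+m; m∸n+n≡m; m≤n⇒m⊓n≡m; m≤n⇒m<n∨m≡n; suc-injective)
open import Data.Product using (Σ; Σ-syntax; _×_; _,_; proj₁; proj₂)
open import Data.Sum as Sum using (_⊎_; inj₁; inj₂; [_,_])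
open import Data.Unit using (⊤; tt)
open import Data.Vec as Vec using (Vec; []; _∷_; lookup; toList; replicate; _[_]≔_)
open import Data.Vec.Membership.Propositional using () renaming (_∈_ to _∈ᵥ_)
open import Data.Vec.Membership.Propositional.Properties using (∈-lookup)
import Data.Vec.Properties as Vecₚ
import Data.Vec.Relation.Unary.Any as VAny
import Data.Vec.Relation.Unary.Any.Properties as VAnyₚ
open import Function using (_∘_; id)
open import Function.Bundles using (_⇔_; _↔_; Equivalence; Inverse; mk⇔; mk↔ₛ′)
open import Relation.Binary.Definitions using (tri<; tri≈; tri>)
open import Relation.Binary.PropositionalEquality using (_≡_; _≢_; refl; sym; trans; cong; cong₂; subst; subst₂)
open import Relation.Nullary using (¬_; yes; no)

-- A path can only be prolonged at the front if its start is prescribed, but no single vertex can be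
-- prescribed: it may come last in every arc that contains it. One of two vertices can, and this is
-- why the induction speaks of pairs. Alternation turns the relation around after each step, so the
-- claims are proved for an arbitrary relation `R` and then used for its reversal. Arcs have to be
-- distinct as well. In the main step every arc spent on the prefix contains z, so confining the
-- rest of the path to arcs without z keeps it clear of all of them at once. The claim on pairs
-- fails wherever a path is missing: for H₄ and for some tournaments of orders 3, 5 and 7. As the
-- step goes back by two, two consecutive sizes are needed to start. At |U| = k + 1 arcs are scarce,
-- since there are only as many as vertices. The way out is that the arc missing x misses nothing
-- once x is removed, and can then stand in for the arc of another vertex.

module _ {A : Set} where

  bubble : A → List A → List A
  bubble x []       = x ∷ []
  bubble x (y ∷ ys) = y ∷ x ∷ ys

  toFront : ℕ → List A → List A
  toFront zero    xs       = xs
  toFront (suc i) []       = []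
  toFront (suc i) (x ∷ xs) = bubble x (toFront i xs)

  onTail : (List A → List A) → List A → List A
  onTail f []       = []
  onTail f (x ∷ xs) = x ∷ f xs

  reorder : List ℕ → List A → List A
  reorder []       xs = xs
  reorder (i ∷ is) xs = onTail (reorder is) (toFront i xs)

  bubble-↭ : ∀ x ys → x ∷ ys ↭ bubble x ys
  bubble-↭ x []       = ↭-refl
  bubble-↭ x (y ∷ ys) = swap x y ↭-refl

  toFront-↭ : ∀ i xs → xs ↭ toFront i xs
  toFront-↭ zero    xs       = ↭-refl
  toFront-↭ (suc i) []       = ↭-refl
  toFront-↭ (suc i) (x ∷ xs) = ↭-trans (prep x (toFront-↭ i xs)) (bubble-↭ x (toFront i xs))

  onTail-↭ : ∀ {f} → (∀ xs → xs ↭ f xs) → ∀ xs → xs ↭ onTail f xs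
  onTail-↭ p []       = ↭-refl
  onTail-↭ p (x ∷ xs) = prep x (p xs)

  -- With explicit list heads both sides are computed, so that index lists
  -- stand for proofs that two lists are permutations of each other.
  reorder-↭ : ∀ is xs → xs ↭ reorder is xs
  reorder-↭ []       xs = ↭-refl
  reorder-↭ (i ∷ is) xs = ↭-trans (toFront-↭ i xs) (onTail-↭ (reorder-↭ is) (toFront i xs))

  -- Indexing is total, with a default, so that certificates can name vertices and arcs by plain
  -- numbers. Bounds are supplied where membership or distinctness of the values is concluded.
  at : A → List A → ℕ → A
  at d []       i       = d
  at d (x ∷ xs) zero    = x
  at d (x ∷ xs) (suc i) = at d xs i

  at-∈ : ∀ d xs i → i < length xs → at d xs i ∈ xs
  at-∈ d (x ∷ xs) zero    _         = here refl
  at-∈ d (x ∷ xs) (suc i) (s≤s i<n) = there (at-∈ d xs i i<n)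

  at-injective : ∀ d {xs} → Unique xs → ∀ i j → i < length xs → j < length xs →
                 at d xs i ≡ at d xs j → i ≡ j
  at-injective d (_ ∷ _) zero zero _ _ _ = refl
  at-injective d {x ∷ xs} (x∉ ∷ _) zero (suc j) _ (s≤s j<n) eq =
    ⊥-elim (All.lookup x∉ (at-∈ d xs j j<n) eq)
  at-injective d {x ∷ xs} (x∉ ∷ _) (suc i) zero (s≤s i<n) _ eq =
    ⊥-elim (All.lookup x∉ (at-∈ d xs i i<n) (sym eq))
  at-injective d (_ ∷ u) (suc i) (suc j) (s≤s i<n) (s≤s j<n) eq =
    cong suc (at-injective d u i j i<n j<n eq)

  Unique-resp-↭ : ∀ {xs ys : List A} → xs ↭ ys → Unique xs → Unique ys
  Unique-resp-↭ _↭_.refl        u = u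
  Unique-resp-↭ (prep x p)      (x∉ ∷ u) = All.tabulate (λ y∈ → All.lookup x∉ (∈-resp-↭ (↭-sym p) y∈)) ∷ Unique-resp-↭ p u
  Unique-resp-↭ (swap x y p)    ((x≢y ∷ x∉) ∷ y∉ ∷ u) =
    ((x≢y ∘ sym) ∷ All.tabulate (λ z∈ → All.lookup y∉ (∈-resp-↭ (↭-sym p) z∈)))
    ∷ All.tabulate (λ z∈ → All.lookup x∉ (∈-resp-↭ (↭-sym p) z∈)) ∷ Unique-resp-↭ p u
  Unique-resp-↭ (_↭_.trans p q) u = Unique-resp-↭ q (Unique-resp-↭ p u)

-- Decision trees

-- (a , u , v) stands for "u precedes v in arc a".
Lit : Set
Lit = ℕ × ℕ × ℕ

neg : Lit → Lit
neg (a , u , v) = a , v , u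

-- A node holds the code of a path; its i-th subtree treats the case in which
-- the i-th literal of the path that is not yet known to hold is false.  A leaf
-- exc holds the code of a labelling that shows an exceptional hypertournament.
data Tree : Set where
  _▷_ : ℕ → List Tree → Tree
  exc : ℕ → Tree

∧-split : ∀ a {b} → a ∧ b ≡ true → a ≡ true × b ≡ true
∧-split true eq = refl , eq

≡ᵇ-sound : ∀ m n → (m ≡ᵇ n) ≡ true → m ≡ n
≡ᵇ-sound m n eq = ≡ᵇ⇒≡ m n (subst T (sym eq) tt)

≡ᵇ-refl : ∀ n → (n ≡ᵇ n) ≡ true
≡ᵇ-refl zero    = refl
≡ᵇ-refl (suc n) = ≡ᵇ-refl n

memᵇ : ℕ → List ℕ → Bool
memᵇ x []       = false
memᵇ x (y ∷ ys) = if x ≡ᵇ y then true else memᵇ x ys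

memᵇ-sound : ∀ x ys → memᵇ x ys ≡ true → x ∈ ys
memᵇ-sound x (y ∷ ys) eq with x ≡ᵇ y in e
... | true  = here (≡ᵇ-sound x y e)
... | false = there (memᵇ-sound x ys eq)

litᵇ : Lit → Lit → Bool
litᵇ (a , u , v) (b , x , y) = if v ≡ᵇ y then (if u ≡ᵇ x then a ≡ᵇ b else false) else false

litᵇ-sound : ∀ e f → litᵇ e f ≡ true → e ≡ f
litᵇ-sound (a , u , v) (b , x , y) eq with v ≡ᵇ y in p | u ≡ᵇ x in q
... | true | true with refl ← ≡ᵇ-sound v y p | refl ← ≡ᵇ-sound u x q | refl ← ≡ᵇ-sound a b eq = refl

holdsᵇ : List Lit → Lit → Bool
holdsᵇ []       e = false
holdsᵇ (f ∷ fs) e = if litᵇ e f then true else holdsᵇ fs e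

-- Literals that follow from the known ones by transitivity through at most d
-- of the vertices in zs.
knownᵇ : (d : ℕ) (zs : List ℕ) → List Lit → Lit → Bool
viaᵇ   : (d : ℕ) (zs ws : List ℕ) → List Lit → Lit → Bool
knownᵇ zero    zs K e = holdsᵇ K e
knownᵇ (suc d) zs K e = holdsᵇ K e ∨ viaᵇ d zs zs K e
viaᵇ d zs []       K e           = false
viaᵇ d zs (w ∷ ws) K (a , u , v) =
  if holdsᵇ K (a , u , w) ∧ knownᵇ d zs K (a , w , v) then true else viaᵇ d zs ws K (a , u , v)

allᵇ : {A : Set} → (A → Bool) → List A → Bool
allᵇ p []       = true
allᵇ p (x ∷ xs) = p x ∧ allᵇ p xs

module Checker
  (depth : ℕ) (zs : List ℕ)
  (lits : ℕ → List Lit) (valid : ℕ → Bool) (wellFormed : Lit → Bool)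
  (excLits : ℕ → List Lit) (excValid : ℕ → Bool)
  where

  check : Tree → List Lit → Bool
  split : List Lit → List Tree → List Lit → Bool
  check (p ▷ ts) K = valid p ∧ split (lits p) ts K
  check (exc c)  K = excValid c ∧ allᵇ (knownᵇ depth zs K) (excLits c)
  split []       ts       K = true
  split (e ∷ es) ts       K with knownᵇ depth zs K e
  split (e ∷ es) ts       K | true = split es ts K
  split (e ∷ es) []       K | false = false
  -- The guard makes the distinction between `e` and `neg e` exhaustive: two vertices are comparable
  -- only if they are distinct and lie in the same arc.
  split (e ∷ es) (t ∷ ts) K | false = wellFormed e ∧ (check t (neg e ∷ K) ∧ split es ts (e ∷ K))

  -- At depth 0 the checker forms no chains, so transitivity may be replaced by `depth ≡ 0`. This
  -- admits tournaments, where all edges share one dummy arc and `β` is not transitive.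
  module Soundness
    (β : Lit → Set)
    (β-total : ∀ e → wellFormed e ≡ true → β e ⊎ β (neg e))
    (β-trans : depth ≡ 0 ⊎ (∀ a {u v w} → β (a , u , v) → β (a , v , w) → β (a , u , w)))
    where

    Outcome : Set
    Outcome = (Σ[ p ∈ ℕ ] (valid p ≡ true × All β (lits p)))
            ⊎ (Σ[ c ∈ ℕ ] (excValid c ≡ true × All β (excLits c)))

    holds-sound : ∀ K e → All β K → holdsᵇ K e ≡ true → β e
    holds-sound (f ∷ K) e (b ∷ bs) eq with litᵇ e f in p
    ... | true  = subst β (sym (litᵇ-sound e f p)) b
    ... | false = holds-sound K e bs eq

    module _ (β-tr : ∀ a {u v w} → β (a , u , v) → β (a , v , w) → β (a , u , w)) where

      closure-sound : ∀ d K e → All β K → knownᵇ d zs K e ≡ true → β e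
      via-sound     : ∀ d ws K e → All β K → viaᵇ d zs ws K e ≡ true → β e
      closure-sound zero    K e bs eq = holds-sound K e bs eq
      closure-sound (suc d) K e bs eq with holdsᵇ K e in p
      ... | true  = holds-sound K e bs p
      ... | false = via-sound d zs K e bs eq
      via-sound d (w ∷ ws) K (a , u , v) bs eq
        with holdsᵇ K (a , u , w) in p | knownᵇ d zs K (a , w , v) in q
      ... | true  | true  = β-tr a (holds-sound K _ bs p) (closure-sound d K _ bs q)
      ... | true  | false = via-sound d ws K _ bs eq
      ... | false | _     = via-sound d ws K _ bs eq

    known-sound : ∀ K e → All β K → knownᵇ depth zs K e ≡ true → β e
    known-sound K e bs eq = [ (λ d≡0 → holds-sound K e bs (subst (λ d → knownᵇ d zs K e ≡ true) d≡0 eq))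
                            , (λ tr → closure-sound tr depth K e bs eq) ] β-trans

    allKnown-sound : ∀ K es → All β K → allᵇ (knownᵇ depth zs K) es ≡ true → All β es
    allKnown-sound K []       bs eq = []
    allKnown-sound K (e ∷ es) bs eq with p , q ← ∧-split (knownᵇ depth zs K e) eq =
      known-sound K e bs p ∷ allKnown-sound K es bs q

    sound : ∀ t K → check t K ≡ true → All β K → Outcome
    split-sound : ∀ es ts K → split es ts K ≡ true → All β K → Outcome ⊎ All β es
    sound (p ▷ ts) K eq bs with v , q ← ∧-split (valid p) eq | split-sound (lits p) ts K q bs
    ... | inj₁ o = o
    ... | inj₂ b = inj₁ (p , v , b)
    sound (exc c) K eq bs with v , q ← ∧-split (excValid c) eq = inj₂ (c , v , allKnown-sound K _ bs q)
    split-sound []       ts       K eq bs = inj₂ []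
    split-sound (e ∷ es) ts       K eq bs with knownᵇ depth zs K e in k
    split-sound (e ∷ es) ts       K eq bs | true with split-sound es ts K eq bs
    ... | inj₁ o = inj₁ o
    ... | inj₂ b = inj₂ (known-sound K e bs k ∷ b)
    split-sound (e ∷ es) (t ∷ ts) K eq bs | false
      with wf , q ← ∧-split (wellFormed e) eq
      with q₁ , q₂ ← ∧-split (check t (neg e ∷ K)) q
      with β-total e wf
    ... | inj₂ b = inj₁ (sound t (neg e ∷ K) q₁ (b ∷ bs))
    ... | inj₁ b with split-sound es ts (e ∷ K) q₂ (b ∷ bs)
    ...   | inj₁ o  = inj₁ o
    ...   | inj₂ bs′ = inj₂ (b ∷ bs′)

-- Alternating paths with distinct arcs

module _ {A V : Set} where

  flip₃ : (A → V → V → Set) → A → V → V → Set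
  flip₃ R a u v = R a v u

  orient : Bool → (A → V → V → Set) → A → V → V → Set
  orient true  R = R
  orient false R = flip₃ R

  -- The alternating condition for x followed by the (arc , vertex) steps, where
  -- x precedes its successor in the first arc.
  Alternates : (A → V → V → Set) → V → List (A × V) → Set
  Alternates R x []             = ⊤
  Alternates R x ((a , w) ∷ ps) = R a x w × Alternates (flip₃ R) w ps

  -- `U` lists what is still to be visited after `x`. The predicate `Q` bounds the supply of arcs,
  -- so that a path can be asked to avoid those already spent on a prefix.
  record Reach (R : A → V → V → Set) (Q : A → Set) (x : V) (U : List V) : Set where
    constructor reach
    field
      steps      : List (A × V)
      visits     : map proj₂ steps ↭ U
      allowed    : All Q (map proj₁ steps)
      distinct   : Unique (map proj₁ steps)
      alternates : Alternates R x steps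

-- Coded paths

-- The hexadecimal digits of a code are 0 or 1 (the start of the path precedes or
-- follows its successor), then the start, then an arc and a vertex in turn.
digits : ℕ → ℕ → List ℕ → List ℕ
digits zero    c ds = ds
digits (suc n) c ds = digits n (c / 16) (c % 16 ∷ ds)

pairUp : List ℕ → List (ℕ × ℕ)
pairUp (a ∷ w ∷ ps) = (a , w) ∷ pairUp ps
pairUp _            = []

removeᵇ : ℕ → List ℕ → List ℕ
removeᵇ x []       = []
removeᵇ x (y ∷ ys) = if x ≡ᵇ y then ys else y ∷ removeᵇ x ys

permᵇ : List ℕ → List ℕ → Bool
permᵇ []       []      = true
permᵇ []       (_ ∷ _) = false
permᵇ (x ∷ xs) ys      = memᵇ x ys ∧ permᵇ xs (removeᵇ x ys)

remove-↭ : ∀ x ys → memᵇ x ys ≡ true → x ∷ removeᵇ x ys ↭ ys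
remove-↭ x (y ∷ ys) eq with x ≡ᵇ y in e
... | true  = ↭-reflexive (cong (_∷ ys) (≡ᵇ-sound x y e))
... | false = ↭-trans (swap x y ↭-refl) (prep y (remove-↭ x ys eq))

perm-sound : ∀ xs ys → permᵇ xs ys ≡ true → xs ↭ ys
perm-sound []       []  eq = ↭-refl
perm-sound (x ∷ xs) ys  eq with p , q ← ∧-split (memᵇ x ys) eq =
  ↭-trans (prep x (perm-sound xs _ q)) (remove-↭ x ys p)

uniqueᵇ : List ℕ → Bool
uniqueᵇ []       = true
uniqueᵇ (x ∷ xs) = not (memᵇ x xs) ∧ uniqueᵇ xs

memᵇ-complete : ∀ {x ys} → x ∈ ys → memᵇ x ys ≡ true
memᵇ-complete {x} {y ∷ ys} x∈ with x ≡ᵇ y in e | x∈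
... | true  | _         = refl
... | false | there p   = memᵇ-complete p
... | false | here refl with () ← trans (sym e) (≡ᵇ-refl x)

unique-sound : ∀ xs → uniqueᵇ xs ≡ true → Unique xs
unique-sound []       eq = []
unique-sound (x ∷ xs) eq with p , q ← ∧-split (not (memᵇ x xs)) eq =
  All.tabulate (λ { y∈ refl → false≢true (trans (sym p) (cong not (memᵇ-complete y∈))) })
  ∷ unique-sound xs q
  where
  false≢true : true ≢ false
  false≢true ()

<ᵇ-sound : ∀ m n → (m <ᵇ n) ≡ true → m < n
<ᵇ-sound m n eq = <ᵇ⇒< m n (subst T (sym eq) tt)

all-sound : ∀ {A : Set} (p : A → Bool) xs → allᵇ p xs ≡ true → All (λ x → p x ≡ true) xs
all-sound p []       eq = []
all-sound p (x ∷ xs) eq with q , r ← ∧-split (p x) eq = q ∷ all-sound p xs r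

map-at-upTo : ∀ {A : Set} d (xs : List A) → map (at d xs) (upTo (length xs)) ≡ xs
map-at-upTo d xs = trans (map-upTo (at d xs) (length xs)) (go xs)
  where
  go : ∀ ys → applyUpTo (at d ys) (length ys) ≡ ys
  go []       = refl
  go (y ∷ ys) = cong (y ∷_) (go ys)

record Problem : Set where
  field
    -- For a tournament the arcs are left out of the codes and all literals refer
    -- to the dummy arc 0.
    tournament : Bool
    order      : ℕ
    members    : List (List ℕ)
    start      : Bool → ℕ → Bool
    depth      : ℕ
    exceptions : Bool
    excLits    : List ℕ → List Lit

  parse : List ℕ → Bool × ℕ × List (ℕ × ℕ)
  parse (t ∷ x ∷ ws) = (t ≡ᵇ 0) , x , (if tournament then map (0 ,_) ws else pairUp ws)
  parse _            = true , 0 , []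

  decode : ℕ → Bool × ℕ × List (ℕ × ℕ)
  decode c = parse (digits (if tournament then suc order else order + order) c [])

  literals : Bool → ℕ → List (ℕ × ℕ) → List Lit
  literals t x []             = []
  literals t x ((a , w) ∷ ps) = (if t then (a , x , w) else (a , w , x)) ∷ literals (not t) w ps

  validPath : Bool × ℕ × List (ℕ × ℕ) → Bool
  validPath (t , x , ps) = start t x ∧ (permᵇ (x ∷ map proj₂ ps) (upTo order) ∧
    (tournament ∨ (uniqueᵇ (map proj₁ ps) ∧ allᵇ (_<ᵇ length members) (map proj₁ ps))))

  pathLits : Bool × ℕ × List (ℕ × ℕ) → List Lit
  pathLits (t , x , ps) = literals t x ps

  -- An arc index beyond `members` yields the default `[]`, which has no elements, so the test also
  -- rejects unknown arcs.
  wellFormed : Lit → Bool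
  wellFormed (a , u , v) = memᵇ u (at [] members a) ∧ (memᵇ v (at [] members a) ∧
    ((u <ᵇ order) ∧ ((v <ᵇ order) ∧ not (u ≡ᵇ v))))

  relabelling : ℕ → List ℕ
  relabelling c = digits order c []

  open Checker depth (upTo order) (λ c → pathLits (decode c)) (λ c → validPath (decode c)) wellFormed
    (λ c → excLits (relabelling c)) (λ c → exceptions ∧ permᵇ (relabelling c) (upTo order)) public

  record Model {A V : Set} (Mem : A → V → Set) (R : A → V → V → Set) : Set where
    field
      total     : ∀ {a u v} → Mem a u → Mem a v → u ≢ v → R a u v ⊎ R a v u
      transits  : depth ≡ 0 ⊎ (∀ a {u v w} → R a u v → R a v w → R a u w)

    module Run
      (v₀ : V) (vs : List V) (a₀ : A) (as : List A)
      (size : length vs ≡ order) (distinctV : Unique vs)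
      (sizeA : length as ≡ length members)
      (incidence : Pointwise (λ js a → All (λ j → Mem a (at v₀ vs j)) js) members as)
      where

      β : Lit → Set
      β (a , u , v) = R (at a₀ as a) (at v₀ vs u) (at v₀ vs v)

      vertex : ℕ → V
      vertex = at v₀ vs

      place : ℕ × ℕ → A × V
      place (a , w) = at a₀ as a , vertex w

      member : ∀ {jss bs} → Pointwise (λ js a → All (λ j → Mem a (vertex j)) js) jss bs →
               ∀ a u → u ∈ at [] jss a → Mem (at a₀ bs a) (vertex u)
      member (js ∷ _)  zero    u u∈ = All.lookup js u∈
      member (_ ∷ jss) (suc a) u u∈ = member jss a u u∈

      β-total : ∀ e → wellFormed e ≡ true → β e ⊎ β (neg e)
      β-total (a , u , v) eq
        with p , eq₁ ← ∧-split (memᵇ u (at [] members a)) eq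
        with q , eq₂ ← ∧-split (memᵇ v (at [] members a)) eq₁
        with r , eq₃ ← ∧-split (u <ᵇ order) eq₂
        with s , eq₄ ← ∧-split (v <ᵇ order) eq₃ =
        total (member incidence a u (memᵇ-sound u _ p)) (member incidence a v (memᵇ-sound v _ q))
          λ vu≡vv → distinctᵇ eq₄ (at-injective v₀ distinctV u v (below u r) (below v s) vu≡vv)
        where
        below : ∀ w → (w <ᵇ order) ≡ true → w < length vs
        below w e = subst (w <_) (sym size) (<ᵇ-sound w order e)
        distinctᵇ : not (u ≡ᵇ v) ≡ true → u ≢ v
        distinctᵇ e refl with () ← trans (sym (cong not (≡ᵇ-refl u))) e

      open Soundness β β-total (Sum.map₂ (λ tr a → tr (at a₀ as a)) transits)

      alternating : ∀ t x ps → All β (literals t x ps) → Alternates (orient t R) (vertex x) (map place ps)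
      alternating t     x []             bs       = tt
      alternating true  x ((a , w) ∷ ps) (b ∷ bs) = b , alternating false w ps bs
      alternating false x ((a , w) ∷ ps) (b ∷ bs) = b , alternating true w ps bs

      record Found : Set where
        field
          source   : Bool
          first    : ℕ
          starts   : start source first ≡ true
          steps    : List (ℕ × ℕ)
          visits   : vertex first ∷ map proj₂ (map place steps) ↭ vs
          arcs     : tournament ∨ (uniqueᵇ (map proj₁ steps) ∧ allᵇ (_<ᵇ length members) (map proj₁ steps)) ≡ true
          alternates : Alternates (orient source R) (vertex first) (map place steps)

      Exceptional : Set
      Exceptional = Σ[ π ∈ List ℕ ] (exceptions ≡ true × π ↭ upTo order × All β (excLits π))

      map-vertex : ∀ {is} → is ↭ upTo order → map vertex is ↭ vs
      map-vertex p = ↭-trans (map⁺ vertex p)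
        (↭-reflexive (subst (λ m → map vertex (upTo m) ≡ vs) size (map-at-upTo v₀ vs)))

      found : (t : Tree) (K : List Lit) → check t K ≡ true → All β K → Found ⊎ Exceptional
      found t K eq bs with sound t K eq bs
      ... | inj₂ (c , v , b) with e , q ← ∧-split exceptions v = inj₂ (relabelling c , e , perm-sound _ _ q , b)
      ... | inj₁ (c , v , b) with decode c
      ...   | s , x , ps
        with p , v₁ ← ∧-split (start s x) v
        with q , r ← ∧-split (permᵇ (x ∷ map proj₂ ps) (upTo order)) v₁ = inj₁ record
        { source = s ; first = x ; starts = p ; steps = ps
        ; visits = subst (λ ws → vertex x ∷ ws ↭ vs) (trans (sym (map-∘ ps)) (map-∘ ps)) (map-vertex (perm-sound _ _ q))
        ; arcs = r ; alternates = alternating s x ps b }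

-- The literals of `K` are hypotheses available at the root of the tree. They carry normalisations
-- obtained by renaming, and paths found earlier on fewer vertices.
record Certificate (P : Problem) (K : List Lit) : Set where
  constructor certify
  field
    tree    : Tree
    checked : Problem.check P tree K ≡ true

-- Exchange arguments for pairs of possible starts

module _ {A V : Set} where

  -- The direction changes at w, hence the tail is a path for the reversed relation; its arcs
  -- satisfy `Q′`, which excludes the new arc.
  extend : ∀ {R : A → V → V → Set} {Q Q′ : A → Set} {a x w U U′} →
           Q a → R a x w → (∀ {b} → Q′ b → Q b × b ≢ a) → w ∷ U′ ↭ U →
           Reach (flip₃ R) Q′ w U′ → Reach R Q x U
  extend {a = a} {w = w} qa r sub perm (reach ps vis al dis alt) =
    reach ((a , w) ∷ ps) (↭-trans (prep w vis) perm)
      (qa ∷ All.map (proj₁ ∘ sub) al)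
      (All.map (λ q a≡b → proj₂ (sub q) (sym a≡b)) al ∷ dis)
      (r , alt)

  weaken : ∀ {R : A → V → V → Set} {Q Q′ : A → Set} {x U U′} →
           (∀ {b} → Q b → Q′ b) → U ↭ U′ → Reach R Q x U → Reach R Q′ x U′
  weaken sub perm (reach ps vis al dis alt) = reach ps (↭-trans vis perm) (All.map sub al) dis alt

  Good : (A → V → V → Set) → (A → Set) → V → V → List V → Set
  Good R Q x y L = Reach R Q x (y ∷ L) ⊎ Reach R Q y (x ∷ L)

  weakenGood : ∀ {R : A → V → V → Set} {Q Q′ : A → Set} {x y L L′} →
               (∀ {b} → Q b → Q′ b) → L ↭ L′ → Good R Q x y L → Good R Q′ x y L′
  weakenGood sub perm = Sum.map (weaken sub (prep _ perm)) (weaken sub (prep _ perm))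

  swapGood : ∀ {R : A → V → V → Set} {Q x y L} → Good R Q x y L → Good R Q y x L
  swapGood = Sum.swap

  record Ordering (Mem : A → V → Set) (R : A → V → V → Set) : Set where
    field
      total      : ∀ {a u v} → Mem a u → Mem a v → u ≢ v → R a u v ⊎ R a v u
      transitive : ∀ a {u v w} → R a u v → R a v w → R a u w

  flipOrdering : ∀ {Mem R} → Ordering Mem R → Ordering Mem (flip₃ R)
  flipOrdering o = record
    { total = λ mu mv u≢v → Sum.swap (total mu mv u≢v)
    ; transitive = λ a p q → transitive a q p }
    where open Ordering o

  module _ {R : A → V → V → Set} {Q : A → Set} where

    -- Whichever of w and w′ turns out to start the reversed path, z can be put in front of it. Only
    -- one of `e` and `e′` ends up on the path, so they may be the same arc.
    forks : ∀ {Q′ e e′ z w w′ N U} → Q e → Q e′ → R e z w → R e′ z w′ →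
            (∀ {b} → Q′ b → Q b × b ≢ e × b ≢ e′) → w ∷ w′ ∷ N ↭ U →
            Good (flip₃ R) Q′ w w′ N → Reach R Q z U
    forks qe qe′ r r′ sub perm (inj₁ g) = extend qe r (λ q → proj₁ (sub q) , proj₁ (proj₂ (sub q))) perm g
    forks {w = w} {w′} qe qe′ r r′ sub perm (inj₂ g) =
      extend qe′ r′ (λ q → proj₁ (sub q) , proj₂ (proj₂ (sub q))) (↭-trans (swap w′ w ↭-refl) perm) g

    -- Two prefix steps, from o to z and back to w or w′, reverse the relation twice, so the pair
    -- has to be good for `R` itself. Here `a` is on the path together with `e` or `e′`, which is
    -- why these must differ from it.
    joins : ∀ {Q′ a e e′ o z w w′ N U} → Q a → Q e → Q e′ → e ≢ a → e′ ≢ a →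
            R a o z → R e w z → R e′ w′ z →
            (∀ {b} → Q′ b → Q b × b ≢ a × b ≢ e × b ≢ e′) → w ∷ w′ ∷ N ↭ U →
            Good R Q′ w w′ N → Reach R Q o (z ∷ U)
    joins {a = a} qa qe qe′ e≢a e′≢a ra r r′ sub perm g =
      extend {Q′ = λ b → Q b × b ≢ a} qa ra id ↭-refl (fork g)
      where
      fork : Good R _ _ _ _ → Reach (flip₃ R) (λ b → Q b × b ≢ a) _ _
      fork (inj₁ h) = extend (qe , e≢a) r (λ q → let (i , j , k , _) = sub q in (i , j) , k) perm h
      fork (inj₂ h) = extend (qe′ , e′≢a) r′ (λ q → let (i , j , _ , l) = sub q in (i , j) , l)
                        (↭-trans (swap _ _ ↭-refl) perm) h

    -- The field `other` matters when the path reaches z through `a` and leaves it along the spoke,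
    -- that is, when two vertices precede z.
    record Spoke (a : A) (Has : A → Set) (z w : V) : Set where
      field
        arc     : A
        has     : Has arc
        usable  : Q arc
        other   : arc ≢ a
        compare : R arc z w ⊎ R arc w z

    -- `Has` will be "contains z". The arc `a` and all spokes have this property and the arcs of the
    -- continuation do not, so one condition rules out every repetition.
    step₁ : ∀ {Q₁ Q₂ : A → Set} (Has : A → Set) {a o z s t r M} → Q a → Has a → R a o z →
            Spoke a Has z s → Spoke a Has z t → Spoke a Has z r →
            (∀ {b} → Q₁ b → Q b × ¬ Has b) →
            (∀ {w w′ N} → w ∷ w′ ∷ N ↭ o ∷ s ∷ t ∷ r ∷ M → Good (flip₃ R) Q₁ w w′ N) →
            (∀ {b} → Q₂ b → Q b × ¬ Has b) →
            (∀ {w w′ N} → w ∷ w′ ∷ N ↭ s ∷ t ∷ r ∷ M → Good R Q₂ w w′ N) →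
            Good R Q o z (s ∷ t ∷ r ∷ M)
    step₁ {Q₁} {Q₂} Has {a} {o} {z} {s} {t} {r} {M} qa ha ra S T U sub₁ good₁ sub₂ good₂ =
      go (compare S) (compare T) (compare U)
      where
      open Spoke
      out : ∀ {w w′ N} (E : Spoke a Has z w) (E′ : Spoke a Has z w′) →
            R (arc E) z w → R (arc E′) z w′ → w ∷ w′ ∷ N ↭ o ∷ s ∷ t ∷ r ∷ M →
            Good R Q o z (s ∷ t ∷ r ∷ M)
      out E E′ p p′ perm = inj₂ (forks (usable E) (usable E′) p p′
        (λ q → proj₁ (sub₁ q) , (λ { refl → proj₂ (sub₁ q) (has E) }) , (λ { refl → proj₂ (sub₁ q) (has E′) }))
        perm (good₁ perm))
      into : ∀ {w w′ N} (E : Spoke a Has z w) (E′ : Spoke a Has z w′) →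
             R (arc E) w z → R (arc E′) w′ z → w ∷ w′ ∷ N ↭ s ∷ t ∷ r ∷ M →
             Good R Q o z (s ∷ t ∷ r ∷ M)
      into E E′ p p′ perm = inj₁ (joins qa (usable E) (usable E′) (other E) (other E′) ra p p′
        (λ q → proj₁ (sub₂ q) , (λ { refl → proj₂ (sub₂ q) ha })
             , (λ { refl → proj₂ (sub₂ q) (has E) }) , (λ { refl → proj₂ (sub₂ q) (has E′) }))
        perm (good₂ perm))
      -- Of three comparisons with z, two go the same way: two outgoing ones give a path from z, two
      -- incoming ones a path from o.
      go : R (arc S) z s ⊎ R (arc S) s z → R (arc T) z t ⊎ R (arc T) t z →
           R (arc U) z r ⊎ R (arc U) r z → Good R Q o z (s ∷ t ∷ r ∷ M)
      go (inj₁ p) (inj₁ q) _        = out S T p q (↭-sym (reorder-↭ (1 ∷ 1 ∷ []) _))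
      go (inj₂ p) (inj₂ q) _        = into S T p q ↭-refl
      go (inj₁ p) (inj₂ q) (inj₁ u) = out S U p u (↭-sym (reorder-↭ (1 ∷ 2 ∷ []) _))
      go (inj₁ p) (inj₂ q) (inj₂ u) = into T U q u (↭-sym (reorder-↭ (1 ∷ 1 ∷ []) _))
      go (inj₂ p) (inj₁ q) (inj₁ u) = out T U q u (↭-sym (reorder-↭ (2 ∷ 2 ∷ []) _))
      go (inj₂ p) (inj₁ q) (inj₂ u) = into S U p u (↭-sym (reorder-↭ (0 ∷ 1 ∷ []) _))

    -- If x precedes s in a′ then either x precedes both s and y, or y precedes
    -- both x and s; so unless x or y starts a path, s and t precede x and y.
    step₂ : ∀ {Mem} → Ordering Mem R → ∀ {Q₁ Q₂ : A → Set} {a a′ x y s t K} →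
            Q a → Q a′ → a′ ≢ a → Unique (x ∷ y ∷ s ∷ t ∷ K) →
            Mem a x → Mem a y → Mem a′ x → Mem a′ y → Mem a′ s → Mem a′ t →
            (∀ {b} → Q₁ b → Q b × b ≢ a′) →
            Good (flip₃ R) Q₁ s y (t ∷ K) → Good (flip₃ R) Q₁ t y (s ∷ K) →
            Good (flip₃ R) Q₁ s x (t ∷ K) → Good (flip₃ R) Q₁ t x (s ∷ K) →
            (∀ {b} → Q₂ b → Q b × b ≢ a × b ≢ a′) → Good R Q₂ s t K →
            Good R Q x y (s ∷ t ∷ K)
    step₂ {Mem} ord {Q₁} {Q₂} {a} {a′} {x} {y} {s} {t} {K} qa qa′ a′≢a
      ((x≢y ∷ x≢s ∷ x≢t ∷ _) ∷ (y≢s ∷ y≢t ∷ _) ∷ _) ax ay a′x a′y a′s a′t sub₁ sy ty sx tx sub₂ st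
      with total ax ay x≢y
         | below x≢y x≢s a′x a′y a′s sy sx ↭-refl
         | below x≢y x≢t a′x a′y a′t ty tx (swap t s ↭-refl)
         | below (x≢y ∘ sym) y≢s a′y a′x a′s sx sy ↭-refl
         | below (x≢y ∘ sym) y≢t a′y a′x a′t tx ty (swap t s ↭-refl)
      where
      open Ordering ord
      below : ∀ {z o w N} → z ≢ o → z ≢ w → Mem a′ z → Mem a′ o → Mem a′ w →
              Good (flip₃ R) Q₁ w o N → Good (flip₃ R) Q₁ w z N → w ∷ N ↭ s ∷ t ∷ K →
              R a′ w z ⊎ Good R Q z o (s ∷ t ∷ K)
      below {z} {o} {w} z≢o z≢w mz mo mw gz go perm with total mz mw z≢w | total mz mo z≢o
      ... | inj₂ w<z | _        = inj₁ w<z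
      ... | inj₁ z<w | inj₁ z<o = inj₂ (inj₁ (forks qa′ qa′ z<w z<o
        (λ q → proj₁ (sub₁ q) , proj₂ (sub₁ q) , proj₂ (sub₁ q)) (↭-trans (swap w o ↭-refl) (prep o perm)) gz))
      ... | inj₁ z<w | inj₂ o<z = inj₂ (inj₂ (forks qa′ qa′ (transitive a′ o<z z<w) o<z
        (λ q → proj₁ (sub₁ q) , proj₂ (sub₁ q) , proj₂ (sub₁ q)) (↭-trans (swap w z ↭-refl) (prep z perm)) go))
    ... | _ | inj₂ g | _ | _ | _ = g
    ... | _ | _ | inj₂ g | _ | _ = g
    ... | _ | _ | _ | inj₂ g | _ = swapGood {R = R} {Q} g
    ... | _ | _ | _ | _ | inj₂ g = swapGood {R = R} {Q} g
    ... | inj₁ x<y | _ | _ | inj₁ s<y | inj₁ t<y = inj₁ (joins qa qa′ qa′ a′≢a a′≢a x<y s<y t<y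
      (λ q → let (i , j , k) = sub₂ q in i , j , k , k) ↭-refl st)
    ... | inj₂ y<x | inj₁ s<x | inj₁ t<x | _ | _ = inj₂ (joins qa qa′ qa′ a′≢a a′≢a y<x s<x t<x
      (λ q → let (i , j , k) = sub₂ q in i , j , k , k) ↭-refl st)

-- Certificates for small families of arcs

fromPair : Bool → ℕ → Bool
fromPair t x = t ∧ (x <ᵇ 2)

-- No arc in these certificates lists more than four vertices, so chains through two intermediate
-- vertices already give the whole transitive closure.
hyperProblem : ℕ → List (List ℕ) → (Bool → ℕ → Bool) → Bool → (List ℕ → List Lit) → Problem
hyperProblem m js st ex lits = record
  { tournament = false ; order = m ; members = js ; start = st ; depth = 2 ; exceptions = ex ; excLits = lits }

family : ℕ → List (List ℕ) → Problem
family m js = hyperProblem m js fromPair false (λ _ → [])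

at-unique : ∀ {A : Set} a₀ {as : List A} → Unique as → ∀ is → uniqueᵇ is ≡ true →
              All (λ i → (i <ᵇ length as) ≡ true) is → Unique (map (at a₀ as) is)
at-unique a₀ {as} u is q below = go (unique-sound is q) below
  where
  go : ∀ {is} → Unique is → All (λ i → (i <ᵇ length as) ≡ true) is → Unique (map (at a₀ as) is)
  go []       []       = []
  go {i ∷ is} (i∉ ∷ v) (b ∷ bs) = fresh i∉ bs ∷ go v bs
    where
    fresh : ∀ {js} → All (i ≢_) js → All (λ i → (i <ᵇ length as) ≡ true) js →
            All (at a₀ as i ≢_) (map (at a₀ as) js)
    fresh []         []       = []
    fresh {j ∷ _} (i≢j ∷ ns) (c ∷ cs) =
      (λ eq → i≢j (at-injective a₀ u i j (<ᵇ-sound i _ b) (<ᵇ-sound j _ c) eq)) ∷ fresh ns cs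

LitHolds : {A V : Set} → (A → V → V → Set) → V → List V → A → List A → Lit → Set
LitHolds R v₀ vs a₀ as (a , u , v) = R (at a₀ as a) (at v₀ vs u) (at v₀ vs v)

module _ {A V : Set} {Mem : A → V → Set} {R : A → V → V → Set} where

  solveFamily : Ordering Mem R → ∀ m js {st ex excLits x vs a as} →
    length (x ∷ vs) ≡ m → Unique (x ∷ vs) → length (a ∷ as) ≡ length js → Unique (a ∷ as) →
    Pointwise (λ is b → All (λ i → Mem b (at x (x ∷ vs) i)) is) js (a ∷ as) →
    ∀ {K} → Certificate (hyperProblem m js st ex excLits) K → All (LitHolds R x (x ∷ vs) a (a ∷ as)) K →
    (Σ[ t ∈ Bool ] Σ[ i ∈ ℕ ] Σ[ W ∈ List V ] (st t i ≡ true × at x (x ∷ vs) i ∷ W ↭ x ∷ vs ×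
       Reach (orient t R) (_∈ a ∷ as) (at x (x ∷ vs) i) W))
    ⊎ (Σ[ π ∈ List ℕ ] (ex ≡ true × π ↭ upTo m × All (LitHolds R x (x ∷ vs) a (a ∷ as)) (excLits π)))
  solveFamily ord m js {st} {ex} {excLits} {x} {vs} {a} {as} lenV uV lenA uA inc (certify tree ok) known =
    Sum.map₁ convert (found tree _ ok known)
    where
    open Problem (hyperProblem m js st ex excLits) using (Model)
    model : Model Mem R
    model = record { total = Ordering.total ord ; transits = inj₂ (Ordering.transitive ord) }
    open Model model
    open Run x (x ∷ vs) a (a ∷ as) lenV uV lenA inc
    convert : Found → Σ[ t ∈ Bool ] Σ[ i ∈ ℕ ] Σ[ W ∈ List V ] (st t i ≡ true × vertex i ∷ W ↭ x ∷ vs ×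
                Reach (orient t R) (_∈ a ∷ as) (vertex i) W)
    convert record { source = s ; first = i ; starts = eq ; steps = is ; visits = vis ; arcs = arcs ; alternates = alt }
      with p , q ← ∧-split (uniqueᵇ (map proj₁ is)) arcs =
      s , i , _ , eq , vis , reach (map place is) ↭-refl
        (subst (All (_∈ a ∷ as)) arcs≡ (go (map proj₁ is) (below q)))
        (subst Unique arcs≡ (at-unique a uA (map proj₁ is) p (below q))) alt
      where
      below : allᵇ (_<ᵇ length js) (map proj₁ is) ≡ true → All (λ i → (i <ᵇ length (a ∷ as)) ≡ true) (map proj₁ is)
      below q = subst (λ n → All (λ i → (i <ᵇ n) ≡ true) (map proj₁ is)) (sym lenA) (all-sound _ _ q)
      go : ∀ is → All (λ i → (i <ᵇ length (a ∷ as)) ≡ true) is → All (_∈ a ∷ as) (map (at a (a ∷ as)) is)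
      go []       []       = []
      go (i ∷ is) (b ∷ bs) = at-∈ a (a ∷ as) i (<ᵇ-sound i _ b) ∷ go is bs
      arcs≡ : map (at a (a ∷ as)) (map proj₁ is) ≡ map proj₁ (map place is)
      arcs≡ = trans (sym (map-∘ is)) (map-∘ is)

  goodFamily : Ordering Mem R → ∀ m js {x y L a as} →
    length (x ∷ y ∷ L) ≡ m → Unique (x ∷ y ∷ L) → length (a ∷ as) ≡ length js → Unique (a ∷ as) →
    Pointwise (λ is b → All (λ i → Mem b (at x (x ∷ y ∷ L) i)) is) js (a ∷ as) →
    ∀ {K} → Certificate (family m js) K →
    All (LitHolds R x (x ∷ y ∷ L) a (a ∷ as)) K → Good R (_∈ a ∷ as) x y L
  goodFamily ord m js {x} {y} lenV uV lenA uA inc cert known with solveFamily ord m js lenV uV lenA uA inc cert known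
  ... | inj₁ (true , zero     , W , _ , vis , r) = inj₁ (weaken id (drop-∷ vis) r)
  ... | inj₁ (true , suc zero , W , _ , vis , r) = inj₂ (weaken id (drop-∷ (↭-trans vis (swap x y ↭-refl))) r)
  ... | inj₂ (_ , () , _)

-- Arc i misses vertex i for i < 3, but the last arc contains all four vertices. If it missed vertex
-- 3 as well, the arcs could form H₄, where no pair is good.
fourCert : Certificate (family 4 ((1 ∷ 2 ∷ 3 ∷ []) ∷ (0 ∷ 2 ∷ 3 ∷ []) ∷ (0 ∷ 1 ∷ 3 ∷ []) ∷ (0 ∷ 1 ∷ 2 ∷ 3 ∷ []) ∷ [])) []
fourCert = certify
  (0x00210312 ▷ ((0x01203302 ▷ ((0x01201233 ▷ ((0x01021033 ▷ ((0x00331201 ▷ ((0x01233012 ▷ ((0x00120321 ▷ ((0x00312312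
  ▷ ((0x01302312 ▷ []) ∷ [])) ∷ [])) ∷ [])) ∷ [])) ∷ [])) ∷ (0x01201203 ▷ ((0x01201302 ▷ ((0x00320321 ▷ ((0x01231032
  ▷ []) ∷ [])) ∷ [])) ∷ [])) ∷ [])) ∷ (0x01203203 ▷ ((0x01201203 ▷ ((0x01203312 ▷ ((0x01031032 ▷ ((0x00123301 ▷ []) ∷
  [])) ∷ [])) ∷ [])) ∷ [])) ∷ [])) ∷ (0x01031230 ▷ ((0x00213312 ▷ ((0x01021320 ▷ ((0x01330210 ▷ ((0x00210233 ▷
  ((0x00123103 ▷ []) ∷ [])) ∷ [])) ∷ (0x00233102 ▷ []) ∷ [])) ∷ [])) ∷ (0x01031032 ▷ ((0x01033210 ▷ ((0x01023310 ▷
  ((0x00210213 ▷ []) ∷ [])) ∷ [])) ∷ [])) ∷ [])) ∷ (0x00210332 ▷ ((0x00210213 ▷ ((0x00213302 ▷ ((0x00213213 ▷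
  ((0x01320320 ▷ ((0x00233102 ▷ []) ∷ [])) ∷ [])) ∷ [])) ∷ [])) ∷ [])) ∷ []))
  refl

-- This is what remains of five vertices and five arcs when two vertices are removed and two arcs
-- are spent: two arcs contain everything left, and the third misses vertex 1.
threeCert : Certificate (family 3 ((0 ∷ 1 ∷ 2 ∷ []) ∷ (0 ∷ 1 ∷ 2 ∷ []) ∷ (0 ∷ 2 ∷ []) ∷ [])) []
threeCert = certify
  (0x000211 ▷ ((0x011002 ▷ ((0x001102 ▷ ((0x010210 ▷ ((0x010012 ▷ []) ∷ [])) ∷ [])) ∷ [])) ∷ (0x000112 ▷ ((0x010022 ▷
  ((0x002201 ▷ []) ∷ [])) ∷ [])) ∷ []))
  refl

triples₉ triples : List (List ℕ)
triples₉ = (0 ∷ 1 ∷ 2 ∷ []) ∷ (0 ∷ 1 ∷ 3 ∷ []) ∷ (0 ∷ 1 ∷ 4 ∷ []) ∷ (0 ∷ 2 ∷ 3 ∷ []) ∷ (0 ∷ 2 ∷ 4 ∷ [])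
         ∷ (0 ∷ 3 ∷ 4 ∷ []) ∷ (1 ∷ 2 ∷ 3 ∷ []) ∷ (1 ∷ 2 ∷ 4 ∷ []) ∷ (1 ∷ 3 ∷ 4 ∷ []) ∷ []
triples  = (2 ∷ 3 ∷ 4 ∷ []) ∷ triples₉

below4 : List ℕ → List ℕ
below4 []       = []
below4 (i ∷ is) = if i <ᵇ 4 then i ∷ below4 is else below4 is

-- Vertex 4 is the one that arcs may contain but the path skips, so the ten triples on five vertices
-- appear through their traces on 0, 1, 2, 3.
linkCert : Certificate (family 4 (map below4 triples)) []
linkCert = certify
  (0x01304203 ▷ ((0x00318243 ▷ ((0x01827360 ▷ ((0x00311273 ▷ ((0x00319342 ▷ ((0x00521193 ▷ ((0x01937250 ▷ []) ∷ [])) ∷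
  (0x00317243 ▷ ((0x00528173 ▷ ((0x01734250 ▷ []) ∷ [])) ∷ [])) ∷ [])) ∷ [])) ∷ (0x01821063 ▷ ((0x00632182 ▷
  ((0x00312372 ▷ []) ∷ [])) ∷ [])) ∷ [])) ∷ (0x00318273 ▷ ((0x00317342 ▷ ((0x00319372 ▷ ((0x01724320 ▷ ((0x00239172 ▷
  []) ∷ [])) ∷ [])) ∷ [])) ∷ [])) ∷ [])) ∷ (0x01732042 ▷ ((0x00420371 ▷ ((0x01301203 ▷ ((0x00124371 ▷ ((0x00430281 ▷
  ((0x01821043 ▷ []) ∷ [])) ∷ [])) ∷ [])) ∷ [])) ∷ (0x01302302 ▷ ((0x01302342 ▷ ((0x00437182 ▷ ((0x00430281 ▷ []) ∷
  [])) ∷ [])) ∷ [])) ∷ [])) ∷ (0x01304273 ▷ ((0x01304302 ▷ ((0x01301243 ▷ ((0x00127321 ▷ ((0x01234012 ▷ []) ∷ [])) ∷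
  [])) ∷ [])) ∷ [])) ∷ []))
  refl

-- The hypotheses say that the arc on 2, 3, 4 lists them in this order. The vertices outside the
-- pair 0, 1 may be renamed freely, and their triple comes first in `triples` for this purpose.
fiveCert : Certificate (family 5 triples) ((0 , 2 , 3) ∷ (0 , 3 , 4) ∷ [])
fiveCert = certify
  (0x0064037182 ▷ ((0x0130649302 ▷ ((0x0031725403 ▷ ((0x0172430430 ▷ ((0x0172503403 ▷ ((0x0173425064 ▷ ((0x0031736402
  ▷ ((0x0123025064 ▷ ((0x0120520364 ▷ ((0x0021730482 ▷ ((0x0031237284 ▷ []) ∷ [])) ∷ [])) ∷ [])) ∷ [])) ∷ [])) ∷
  (0x0052719403 ▷ ((0x0052718403 ▷ ((0x0031946302 ▷ ((0x0031736402 ▷ ((0x0054024371 ▷ ((0x0172543063 ▷ []) ∷ [])) ∷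
  [])) ∷ [])) ∷ [])) ∷ [])) ∷ [])) ∷ (0x0054034271 ▷ ((0x0172436054 ▷ ((0x0120346302 ▷ ((0x0021346302 ▷ []) ∷ [])) ∷
  [])) ∷ [])) ∷ [])) ∷ (0x0031720364 ▷ ((0x0031720463 ▷ []) ∷ [])) ∷ [])) ∷ (0x0130639402 ▷ ((0x0130546302 ▷
  ((0x0130120364 ▷ ((0x0173605402 ▷ ((0x0182105403 ▷ ((0x0054037182 ▷ []) ∷ [])) ∷ [])) ∷ [])) ∷ [])) ∷ [])) ∷ [])) ∷
  (0x0064820371 ▷ ((0x0064024371 ▷ ((0x0172430460 ▷ ((0x0123720460 ▷ ((0x0064032172 ▷ []) ∷ [])) ∷ [])) ∷ [])) ∷ []))
  ∷ (0x0182730460 ▷ ((0x0064027193 ▷ ((0x0064027391 ▷ []) ∷ [])) ∷ [])) ∷ []))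
  refl

-- Certificates for tournaments on at most eleven vertices

tourney : ℕ → (Bool → ℕ → Bool) → Bool → List (ℕ × ℕ) → Problem
tourney m st ex L = record
  -- The dummy arc contains every vertex, so any two distinct vertices are comparable; the
  -- comparison is not transitive, hence depth 0.
  { tournament = true ; order = m ; members = upTo m ∷ [] ; start = st ; depth = 0
  ; exceptions = ex ; excLits = λ π → map (λ e → 0 , at 0 π (proj₁ e) , at 0 π (proj₂ e)) L }

-- On an even number of vertices an alternating path has an odd number of edges, so exactly one of
-- its ends precedes its neighbour and `fromSource` costs nothing. On an odd number both ends behave
-- alike and either orientation may be the only one available.
anywhere fromSource : Bool → ℕ → Bool
anywhere   _ _ = true
fromSource t _ = t

asLists : List (ℕ × ℕ) → List (List ℕ)
asLists = map (λ e → proj₁ e ∷ proj₂ e ∷ [])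

circulant : ℕ → List ℕ → List (ℕ × ℕ)
circulant m D = concatMap (λ i → map (λ d → i , (i + d) % suc m) D) (upTo (suc m))

-- These are the literals of an alternating path already known on i, ..., i + n. Starting a tree
-- from them lets each order build on a smaller one and keeps the trees small.
zigzag : Bool → ℕ → ℕ → List Lit
zigzag t i zero    = []
zigzag t i (suc n) = (if t then (0 , i , suc i) else (0 , suc i , i)) ∷ zigzag (not t) (suc i) n

T3 T5 T7 : List (ℕ × ℕ)
T3 = circulant 2 (1 ∷ [])
T5 = circulant 4 (1 ∷ 2 ∷ [])
T7 = circulant 6 (1 ∷ 2 ∷ 4 ∷ [])

cert₃ : Certificate (tourney 3 anywhere true T3) []
cert₃ = certify
  (0x1201 ▷ ((0x0102 ▷ ((0x0012 ▷ ((exc 0x0012) ∷ [])) ∷ [])) ∷ (0x0021 ▷ ((exc 0x0021) ∷ [])) ∷ []))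
  refl

cert₄ : Certificate (tourney 4 fromSource false []) []
cert₄ = certify
  (0x03012 ▷ ((0x01203 ▷ ((0x00321 ▷ ((0x02103 ▷ ((0x03120 ▷ ((0x02013 ▷ ((0x01302 ▷ []) ∷ [])) ∷ (0x00231 ▷ []) ∷
  [])) ∷ [])) ∷ [])) ∷ (0x00312 ▷ ((0x03210 ▷ ((0x01023 ▷ ((0x02301 ▷ []) ∷ [])) ∷ (0x00132 ▷ []) ∷ [])) ∷ [])) ∷
  [])) ∷ (0x02031 ▷ ((0x03102 ▷ ((0x00213 ▷ ((0x03201 ▷ ((0x00123 ▷ []) ∷ [])) ∷ [])) ∷ [])) ∷ (0x01320 ▷ ((0x03021 ▷
  ((0x01230 ▷ []) ∷ [])) ∷ [])) ∷ [])) ∷ (0x02130 ▷ ((0x02310 ▷ ((0x01032 ▷ []) ∷ [])) ∷ [])) ∷ []))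
  refl

cert₅ : Certificate (tourney 5 anywhere true T5) (zigzag true 0 3)
cert₅ = certify
  (0x001234 ▷ ((0x140123 ▷ ((0x104123 ▷ ((0x034210 ▷ ((0x031024 ▷ ((0x013204 ▷ ((0x013024 ▷ ((exc 0x002134) ∷ [])) ∷
  [])) ∷ (0x031204 ▷ []) ∷ [])) ∷ [])) ∷ [])) ∷ [])) ∷ []))
  refl

-- Two vertices are added to a path on four: order 5 may be exceptional, and so offers no path to
-- start from. `cert₈` passes over order 7 in the same way.
cert₆ : Certificate (tourney 6 fromSource false []) (zigzag true 0 3)
cert₆ = certify
  (0x0450123 ▷ ((0x0540123 ▷ ((0x0012354 ▷ ((0x0432105 ▷ ((0x0012534 ▷ ((0x0345201 ▷ ((0x0210534 ▷ ((0x0345021 ▷ []) ∷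
  [])) ∷ [])) ∷ [])) ∷ (0x0504321 ▷ []) ∷ [])) ∷ [])) ∷ [])) ∷ (0x0012345 ▷ ((0x0532104 ▷ ((0x0012534 ▷ ((0x0012435 ▷
  ((0x0210435 ▷ ((0x0405123 ▷ ((0x0231540 ▷ ((0x0013542 ▷ []) ∷ [])) ∷ [])) ∷ [])) ∷ [])) ∷ [])) ∷ (0x0405321 ▷ []) ∷
  [])) ∷ [])) ∷ []))
  refl

cert₇ : Certificate (tourney 7 anywhere true T7) (zigzag true 0 5)
cert₇ = certify
  (0x15432106 ▷ ((0x06543210 ▷ ((0x00123465 ▷ ((0x10612345 ▷ ((0x02340561 ▷ ((0x05321046 ▷ ((0x03521046 ▷ ((0x10642135
  ▷ ((0x16524301 ▷ ((0x06035412 ▷ ((0x16154320 ▷ ((0x12510463 ▷ ((0x11024536 ▷ ((0x15302614 ▷ ((0x13426051 ▷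
  ((0x15426031 ▷ ((exc 0x00143562) ∷ [])) ∷ [])) ∷ [])) ∷ [])) ∷ [])) ∷ (0x13420516 ▷ ((0x03514620 ▷ ((0x10524316 ▷
  ((0x10361542 ▷ ((exc 0x00145263) ∷ [])) ∷ [])) ∷ [])) ∷ [])) ∷ [])) ∷ [])) ∷ [])) ∷ (0x00423165 ▷ []) ∷ [])) ∷ []))
  ∷ [])) ∷ (0x01623450 ▷ ((0x12634501 ▷ ((0x16512340 ▷ ((0x06045132 ▷ ((0x01523406 ▷ ((0x11365240 ▷ ((0x15312460 ▷
  ((0x13526041 ▷ ((0x11035264 ▷ ((0x04516302 ▷ ((exc 0x00156243) ∷ [])) ∷ [])) ∷ [])) ∷ [])) ∷ [])) ∷ [])) ∷ [])) ∷
  [])) ∷ [])) ∷ [])) ∷ [])) ∷ [])) ∷ [])) ∷ [])) ∷ []))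
  refl

cert₈ : Certificate (tourney 8 fromSource false []) (zigzag true 0 5)
cert₈ = certify
  (0x001234576 ▷ ((0x076012345 ▷ ((0x067012345 ▷ ((0x001234567 ▷ ((0x001234756 ▷ ((0x043210657 ▷ ((0x001234657 ▷
  ((0x057640123 ▷ ((0x057604321 ▷ []) ∷ [])) ∷ [])) ∷ [])) ∷ [])) ∷ [])) ∷ [])) ∷ (0x043210756 ▷ ((0x070654321 ▷
  ((0x056704321 ▷ ((0x001234756 ▷ ((0x056740123 ▷ []) ∷ [])) ∷ [])) ∷ [])) ∷ (0x065432107 ▷ []) ∷ [])) ∷ [])) ∷
  (0x067012345 ▷ ((0x060754321 ▷ ((0x075432106 ▷ []) ∷ [])) ∷ [])) ∷ []))
  refl

cert₉ : Certificate (tourney 9 anywhere false []) (zigzag true 0 7)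
cert₉ = certify
  (0x1765432108 ▷ ((0x1765432180 ▷ ((0x1123456780 ▷ ((0x0012345687 ▷ ((0x0712345608 ▷ ((0x1817654320 ▷ ((0x1203456718
  ▷ ((0x1127654380 ▷ ((0x0654318720 ▷ ((0x0654872013 ▷ ((0x1872016543 ▷ ((0x1765213084 ▷ ((0x1618720543 ▷
  ((0x0168472503 ▷ ((0x0234716805 ▷ []) ∷ [])) ∷ [])) ∷ [])) ∷ [])) ∷ [])) ∷ [])) ∷ (0x0271830456 ▷ ((0x0381765420 ▷
  ((0x0803127654 ▷ ((0x0384567210 ▷ ((0x1084231765 ▷ []) ∷ [])) ∷ [])) ∷ [])) ∷ [])) ∷ [])) ∷ [])) ∷ [])) ∷
  (0x1680712345 ▷ ((0x1706854321 ▷ ((0x0860123457 ▷ ((0x0834567012 ▷ ((0x0860543217 ▷ ((0x0805761234 ▷ ((0x0864321075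
  ▷ ((0x1845670123 ▷ ((0x1601782345 ▷ ((0x1321046758 ▷ ((0x0185706234 ▷ ((0x0387120456 ▷ ((0x1871026543 ▷ []) ∷ []))
  ∷ [])) ∷ [])) ∷ [])) ∷ [])) ∷ [])) ∷ [])) ∷ [])) ∷ [])) ∷ [])) ∷ [])) ∷ [])) ∷ [])) ∷ [])) ∷ [])) ∷ [])) ∷ []))
  refl

-- The pair is 0 → 1, and 2, ..., 9 carry a path on eight vertices, which can always be read from an
-- end that precedes its neighbour.
pairCert₁₀ : Certificate (tourney 10 fromPair false []) ((0 , 0 , 1) ∷ zigzag true 2 7)
pairCert₁₀ = certify
  (0x00123456789 ▷ ((0x00187654329 ▷ ((0x01209876543 ▷ ((0x01987654320 ▷ ((0x01789654320 ▷ ((0x01345678920 ▷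
  ((0x00139876542 ▷ ((0x00193456782 ▷ ((0x01820934567 ▷ ((0x01823456709 ▷ ((0x00197654328 ▷ ((0x01823456970 ▷
  ((0x00193456728 ▷ ((0x01865432079 ▷ ((0x01543207986 ▷ ((0x01820754396 ▷ ((0x00971654328 ▷ ((0x01689702345 ▷ []) ∷
  [])) ∷ [])) ∷ [])) ∷ [])) ∷ [])) ∷ [])) ∷ [])) ∷ [])) ∷ [])) ∷ [])) ∷ (0x00139876524 ▷ ((0x01420398765 ▷
  ((0x00145678923 ▷ ((0x00192876543 ▷ ((0x00197654328 ▷ ((0x00179654328 ▷ ((0x00691754328 ▷ ((0x01820654379 ▷
  ((0x01823456079 ▷ ((0x01820673945 ▷ ((0x00194283765 ▷ ((0x00194238765 ▷ []) ∷ [])) ∷ [])) ∷ [])) ∷ [])) ∷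
  (0x00143875296 ▷ ((0x00179382465 ▷ ((0x00641398752 ▷ []) ∷ [])) ∷ [])) ∷ [])) ∷ [])) ∷ [])) ∷ [])) ∷ [])) ∷
  (0x00324156789 ▷ ((0x01423056789 ▷ ((0x01423098765 ▷ ((0x01467895023 ▷ ((0x01865432097 ▷ ((0x01250978643 ▷
  ((0x00346897152 ▷ []) ∷ [])) ∷ (0x00179234568 ▷ ((0x01865432079 ▷ ((0x00768129543 ▷ ((0x01259870346 ▷ []) ∷ [])) ∷
  [])) ∷ [])) ∷ [])) ∷ (0x01423876590 ▷ ((0x01835902467 ▷ ((0x00352146789 ▷ []) ∷ [])) ∷ [])) ∷ [])) ∷ [])) ∷ [])) ∷
  [])) ∷ [])) ∷ [])) ∷ [])) ∷ (0x00192876543 ▷ ((0x00197654328 ▷ ((0x00987654312 ▷ ((0x01820934567 ▷ ((0x00179654328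
  ▷ ((0x01345678092 ▷ ((0x00823457196 ▷ ((0x00823456179 ▷ ((0x01690234587 ▷ ((0x00196432857 ▷ ((0x01857649023 ▷
  ((0x01690285743 ▷ ((0x01349876520 ▷ ((0x01320678945 ▷ ((0x00613498752 ▷ []) ∷ [])) ∷ [])) ∷ [])) ∷ [])) ∷ [])) ∷
  [])) ∷ [])) ∷ [])) ∷ [])) ∷ [])) ∷ [])) ∷ [])) ∷ [])) ∷ [])) ∷ [])) ∷ (0x01765432089 ▷ ((0x00817654329 ▷
  ((0x00192876543 ▷ ((0x00197654328 ▷ ((0x00812934567 ▷ ((0x01765432809 ▷ ((0x01785432096 ▷ ((0x01786902345 ▷
  ((0x01768209543 ▷ ((0x01768594320 ▷ ((0x01865432079 ▷ ((0x01768532094 ▷ ((0x01735682094 ▷ ((0x01765382094 ▷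
  ((0x01783209645 ▷ ((0x01783209465 ▷ []) ∷ [])) ∷ [])) ∷ [])) ∷ [])) ∷ [])) ∷ [])) ∷ [])) ∷ [])) ∷ [])) ∷ [])) ∷
  [])) ∷ [])) ∷ [])) ∷ [])) ∷ [])) ∷ [])) ∷ [])) ∷ (0x01203456789 ▷ ((0x00219876543 ▷ ((0x00213456789 ▷
  ((0x01245678930 ▷ ((0x00215678943 ▷ ((0x01290876543 ▷ ((0x00135678924 ▷ ((0x00153678924 ▷ ((0x00165432987 ▷
  ((0x00143298765 ▷ ((0x00153298764 ▷ ((0x00157892346 ▷ ((0x00153462987 ▷ ((0x00267894351 ▷ ((0x00267835194 ▷
  ((0x01265749038 ▷ ((0x00153298746 ▷ []) ∷ [])) ∷ [])) ∷ [])) ∷ [])) ∷ [])) ∷ [])) ∷ [])) ∷ [])) ∷ [])) ∷ [])) ∷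
  (0x00812976543 ▷ ((0x00192876543 ▷ ((0x00812934567 ▷ ((0x00139876524 ▷ ((0x00251398764 ▷ ((0x00251398746 ▷
  ((0x01824793065 ▷ ((0x00824793165 ▷ ((0x00216453987 ▷ ((0x01602534987 ▷ ((0x00643521789 ▷ ((0x00694715328 ▷
  ((0x00179654328 ▷ []) ∷ [])) ∷ [])) ∷ [])) ∷ [])) ∷ [])) ∷ [])) ∷ [])) ∷ [])) ∷ [])) ∷ [])) ∷ [])) ∷ [])) ∷ [])) ∷
  (0x00215436789 ▷ ((0x01567809423 ▷ ((0x00815679423 ▷ ((0x00194238765 ▷ ((0x00831942567 ▷ ((0x00831942765 ▷
  ((0x01802796543 ▷ ((0x00836451279 ▷ ((0x00839721564 ▷ ((0x01275649038 ▷ ((0x00831946752 ▷ []) ∷ [])) ∷ [])) ∷ []))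
  ∷ [])) ∷ [])) ∷ [])) ∷ [])) ∷ [])) ∷ [])) ∷ [])) ∷ [])) ∷ (0x01243908765 ▷ ((0x01287654390 ▷ ((0x00197654328 ▷
  ((0x00193876542 ▷ ((0x00831924567 ▷ ((0x01807654329 ▷ ((0x01245697038 ▷ ((0x01802439567 ▷ ((0x00823914567 ▷
  ((0x01245683079 ▷ ((0x00827654391 ▷ ((0x00136897245 ▷ ((0x00817654329 ▷ ((0x00245876391 ▷ ((0x00218594367 ▷
  ((0x01208576394 ▷ ((0x01802754396 ▷ []) ∷ [])) ∷ [])) ∷ [])) ∷ [])) ∷ [])) ∷ [])) ∷ [])) ∷ [])) ∷ [])) ∷ [])) ∷
  [])) ∷ [])) ∷ [])) ∷ [])) ∷ [])) ∷ [])) ∷ [])) ∷ [])) ∷ [])) ∷ [])) ∷ [])) ∷ (0x00187654392 ▷ ((0x00345678912 ▷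
  ((0x01245678930 ▷ ((0x01567893024 ▷ ((0x00291876543 ▷ ((0x01420398765 ▷ ((0x00143256789 ▷ ((0x01987654320 ▷
  ((0x00192876543 ▷ ((0x00197654328 ▷ ((0x00981432765 ▷ ((0x01290876543 ▷ ((0x00823419567 ▷ ((0x00159876324 ▷
  ((0x00823415967 ▷ ((0x00159876423 ▷ ((0x01290364587 ▷ ((0x00823795146 ▷ ((0x00852914637 ▷ []) ∷ [])) ∷ [])) ∷ []))
  ∷ [])) ∷ [])) ∷ [])) ∷ [])) ∷ (0x00189726543 ▷ ((0x00189754326 ▷ ((0x00987514326 ▷ []) ∷ [])) ∷ [])) ∷ [])) ∷ []))
  ∷ [])) ∷ [])) ∷ [])) ∷ [])) ∷ (0x00219876543 ▷ []) ∷ [])) ∷ (0x01209876543 ▷ ((0x01290876543 ▷ ((0x00291876543 ▷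
  ((0x00219876543 ▷ []) ∷ [])) ∷ [])) ∷ [])) ∷ [])) ∷ [])) ∷ (0x00345678192 ▷ []) ∷ [])) ∷ [])) ∷ [])) ∷ []))
  refl

-- A path on nine vertices has both ends preceding or both following their neighbours, and there is
-- no choice between the two; `pairCert₁₁⁻` treats the second possibility.
pairCert₁₁⁺ : Certificate (tourney 11 fromPair false []) ((0 , 0 , 1) ∷ zigzag true 2 8)
pairCert₁₁⁺ = certify
  (0x001a98765432 ▷ ((0x00123456789a ▷ ((0x012a98765430 ▷ ((0x01a234567890 ▷ ((0x01a234567809 ▷ ((0x01203456789a ▷
  ((0x01a876543209 ▷ ((0x01a209345678 ▷ ((0x01a204567893 ▷ ((0x01a203987654 ▷ ((0x01a298765430 ▷ ((0x0032a1987654 ▷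
  ((0x01297654308a ▷ ((0x01279a803456 ▷ ((0x01a278965430 ▷ ((0x00165432789a ▷ ((0x012654308a97 ▷ ((0x0162789a5430 ▷
  ((0x016234508a97 ▷ ((0x01a509687234 ▷ ((0x01a502349876 ▷ ((0x004961a53278 ▷ ((0x0129408a7653 ▷ ((0x008162a79354 ▷
  ((0x001897a23456 ▷ []) ∷ [])) ∷ [])) ∷ [])) ∷ [])) ∷ [])) ∷ [])) ∷ [])) ∷ [])) ∷ [])) ∷ [])) ∷ [])) ∷ [])) ∷ [])) ∷
  [])) ∷ [])) ∷ [])) ∷ [])) ∷ [])) ∷ (0x00213456789a ▷ ((0x0013a2987654 ▷ ((0x0120789a3456 ▷ ((0x001456789a32 ▷
  ((0x00219876543a ▷ ((0x012056789a34 ▷ ((0x0021789a3456 ▷ ((0x002156789a34 ▷ ((0x00a234567819 ▷ ((0x01290a345678 ▷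
  ((0x001876543a92 ▷ ((0x0081a2345679 ▷ ((0x008126543a97 ▷ ((0x014678923a05 ▷ ((0x00179a326458 ▷ ((0x0085179a3462 ▷
  []) ∷ [])) ∷ [])) ∷ [])) ∷ [])) ∷ [])) ∷ [])) ∷ (0x0081a2345679 ▷ ((0x012086543a97 ▷ ((0x001798a23456 ▷
  ((0x00218a973456 ▷ ((0x018a97065432 ▷ ((0x01a234689705 ▷ ((0x00179a823456 ▷ ((0x01289a467305 ▷ ((0x0013987654a2 ▷
  ((0x01a028765439 ▷ []) ∷ [])) ∷ [])) ∷ [])) ∷ [])) ∷ [])) ∷ [])) ∷ [])) ∷ [])) ∷ [])) ∷ [])) ∷ [])) ∷ [])) ∷ [])) ∷
  [])) ∷ [])) ∷ [])) ∷ (0x012903a45678 ▷ ((0x0021a3987654 ▷ ((0x01a309287654 ▷ ((0x012903a87654 ▷ ((0x0082a1765439 ▷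
  ((0x00179a823456 ▷ ((0x0021a6543978 ▷ ((0x01a380297654 ▷ ((0x01a082397654 ▷ ((0x0084567921a3 ▷ ((0x00215679384a ▷
  ((0x0029784a6315 ▷ ((0x00197654328a ▷ ((0x008a54367921 ▷ ((0x0029763841a5 ▷ ((0x0082a5143976 ▷ []) ∷ [])) ∷ [])) ∷
  [])) ∷ [])) ∷ [])) ∷ [])) ∷ [])) ∷ [])) ∷ [])) ∷ [])) ∷ [])) ∷ [])) ∷ [])) ∷ [])) ∷ [])) ∷ [])) ∷ [])) ∷ [])) ∷
  [])) ∷ [])) ∷ (0x012a98765403 ▷ ((0x013456789a20 ▷ ((0x012456789a03 ▷ ((0x012a03987654 ▷ ((0x00a198765432 ▷
  ((0x01a098765432 ▷ ((0x01a042987653 ▷ ((0x00a129345678 ▷ ((0x00192a345678 ▷ ((0x0042567893a1 ▷ ((0x01a309287654 ▷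
  ((0x00467893a125 ▷ ((0x0021a3987654 ▷ ((0x01567893a042 ▷ ((0x012903a87654 ▷ ((0x004a25139876 ▷ ((0x012903a45678 ▷
  []) ∷ [])) ∷ [])) ∷ [])) ∷ [])) ∷ [])) ∷ [])) ∷ [])) ∷ [])) ∷ [])) ∷ (0x00a178923456 ▷ ((0x01a054329876 ▷
  ((0x01a046789235 ▷ ((0x012a98760534 ▷ ((0x01a076543298 ▷ ((0x00187654329a ▷ ((0x012a98753460 ▷ ((0x00a156789234 ▷
  ((0x006435172a98 ▷ ((0x01a068923457 ▷ ((0x01a042359876 ▷ ((0x00a186723459 ▷ []) ∷ [])) ∷ [])) ∷ [])) ∷ [])) ∷ []))
  ∷ [])) ∷ [])) ∷ [])) ∷ [])) ∷ [])) ∷ [])) ∷ [])) ∷ [])) ∷ [])) ∷ (0x012a08765439 ▷ ((0x012a09345678 ▷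
  ((0x012a34567890 ▷ ((0x01a356789042 ▷ ((0x01a678904235 ▷ ((0x01a532409876 ▷ ((0x012a54367890 ▷ ((0x0016789a5432 ▷
  ((0x009872345a61 ▷ ((0x0098345a6127 ▷ ((0x012790836a54 ▷ ((0x012a90837654 ▷ ((0x012a54397680 ▷ ((0x0127345a6890 ▷
  []) ∷ [])) ∷ [])) ∷ [])) ∷ [])) ∷ [])) ∷ [])) ∷ [])) ∷ [])) ∷ [])) ∷ [])) ∷ [])) ∷ [])) ∷ [])) ∷ [])) ∷
  (0x001356789a24 ▷ ((0x00a198765432 ▷ ((0x00a124567893 ▷ ((0x00193a245678 ▷ ((0x0015342a9876 ▷ ((0x01a098765432 ▷
  ((0x01a309245678 ▷ ((0x00a156789234 ▷ []) ∷ [])) ∷ [])) ∷ [])) ∷ [])) ∷ [])) ∷ [])) ∷ [])) ∷ [])) ∷ (0x01320a987654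
  ▷ ((0x01a098765432 ▷ ((0x00789a213456 ▷ ((0x01a876543209 ▷ ((0x0056789a2134 ▷ ((0x00a134567892 ▷ ((0x00a134567829 ▷
  ((0x0134568a2907 ▷ ((0x00a129345678 ▷ ((0x01a456789302 ▷ ((0x00a124567893 ▷ ((0x01a042567893 ▷ ((0x012a46789305 ▷
  ((0x0134689a2507 ▷ []) ∷ [])) ∷ [])) ∷ [])) ∷ [])) ∷ [])) ∷ [])) ∷ [])) ∷ [])) ∷ [])) ∷ [])) ∷ [])) ∷ [])) ∷ [])) ∷
  [])) ∷ [])) ∷ [])) ∷ [])) ∷ []))
  refl

pairCert₁₁⁻ : Certificate (tourney 11 fromPair false []) ((0 , 0 , 1) ∷ zigzag false 2 8)
pairCert₁₁⁻ = certify
  (0x01a987654320 ▷ ((0x001a23456789 ▷ ((0x0012a9876543 ▷ ((0x00a987654321 ▷ ((0x0013456789a2 ▷ ((0x01234567890a ▷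
  ((0x01298765430a ▷ ((0x01234987650a ▷ ((0x00912345678a ▷ ((0x00234567891a ▷ ((0x0019a2876543 ▷ ((0x0019a7654328 ▷
  ((0x0019a8234567 ▷ ((0x001a87654392 ▷ ((0x0019876543a2 ▷ ((0x012345670a89 ▷ ((0x014567893a02 ▷ ((0x00193a876542 ▷
  ((0x0094213a8765 ▷ []) ∷ [])) ∷ [])) ∷ [])) ∷ [])) ∷ [])) ∷ [])) ∷ [])) ∷ [])) ∷ [])) ∷ (0x0091234567a8 ▷
  ((0x0137654092a8 ▷ ((0x00876543a291 ▷ ((0x0192a8076543 ▷ ((0x0190734562a8 ▷ ((0x00734568a291 ▷ ((0x00912685437a ▷
  ((0x012689a54370 ▷ ((0x0165437092a8 ▷ ((0x001689a27345 ▷ ((0x009473261a58 ▷ ((0x009347261a58 ▷ ((0x0139a8062745 ▷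
  ((0x0065472139a8 ▷ []) ∷ [])) ∷ [])) ∷ [])) ∷ [])) ∷ [])) ∷ [])) ∷ [])) ∷ [])) ∷ [])) ∷ [])) ∷ (0x013a45678092 ▷
  ((0x0135678092a4 ▷ ((0x00876542913a ▷ ((0x008765a49123 ▷ ((0x003124a98765 ▷ ((0x00156789a423 ▷ ((0x001a53246789 ▷
  ((0x00915324a867 ▷ ((0x0086437a5192 ▷ []) ∷ [])) ∷ [])) ∷ [])) ∷ [])) ∷ [])) ∷ [])) ∷ [])) ∷ [])) ∷ [])) ∷
  (0x0091376548a2 ▷ ((0x0091376542a8 ▷ ((0x0094213765a8 ▷ ((0x0137650492a8 ▷ ((0x005a67849123 ▷ ((0x0137849052a6 ▷
  ((0x0057312489a6 ▷ ((0x001a43256789 ▷ ((0x0091376524a8 ▷ []) ∷ [])) ∷ [])) ∷ [])) ∷ [])) ∷ [])) ∷ [])) ∷ [])) ∷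
  [])) ∷ [])) ∷ [])) ∷ [])) ∷ (0x005a67894321 ▷ ((0x012349a56780 ▷ ((0x006789a54321 ▷ ((0x012349a56708 ▷
  ((0x0043218765a9 ▷ ((0x01260345a987 ▷ ((0x0015a2678943 ▷ ((0x001789a26543 ▷ ((0x007189a26543 ▷ ((0x00182349a567 ▷
  ((0x00198762a543 ▷ ((0x007165a28943 ▷ ((0x00912345678a ▷ ((0x0018a5439267 ▷ ((0x0071394562a8 ▷ []) ∷ [])) ∷ [])) ∷
  [])) ∷ [])) ∷ [])) ∷ [])) ∷ [])) ∷ [])) ∷ (0x00162345a987 ▷ ((0x0031678945a2 ▷ []) ∷ [])) ∷ [])) ∷ (0x00498765a321
  ▷ ((0x00432165a987 ▷ ((0x0045a9876321 ▷ ((0x01238765a940 ▷ ((0x0138a2904567 ▷ ((0x013a87654092 ▷ []) ∷ [])) ∷ []))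
  ∷ [])) ∷ [])) ∷ [])) ∷ [])) ∷ [])) ∷ [])) ∷ [])) ∷ (0x01234987605a ▷ ((0x012349875a06 ▷ ((0x0031876549a2 ▷
  ((0x012789a60345 ▷ ((0x012306a78945 ▷ ((0x012349860a75 ▷ ((0x00186572a943 ▷ ((0x0189a2754306 ▷ []) ∷ [])) ∷ [])) ∷
  [])) ∷ [])) ∷ (0x0031456789a2 ▷ ((0x0130876549a2 ▷ ((0x01237549a608 ▷ ((0x0130456789a2 ▷ ((0x0018376549a2 ▷
  ((0x0015678349a2 ▷ ((0x0017654389a2 ▷ ((0x015092a64387 ▷ ((0x015a06234987 ▷ ((0x00513789a264 ▷ []) ∷ [])) ∷ [])) ∷
  [])) ∷ [])) ∷ [])) ∷ [])) ∷ [])) ∷ [])) ∷ [])) ∷ [])) ∷ [])) ∷ [])) ∷ [])) ∷ [])) ∷ (0x0130456789a2 ▷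
  ((0x001a45678923 ▷ ((0x001a65432987 ▷ ((0x001a87654329 ▷ ((0x0017654329a8 ▷ ((0x003129a84567 ▷ ((0x003129a48765 ▷
  []) ∷ [])) ∷ [])) ∷ [])) ∷ [])) ∷ [])) ∷ [])) ∷ [])) ∷ [])) ∷ [])) ∷ [])) ∷ [])) ∷ [])) ∷ (0x01a987654302 ▷
  ((0x01a209876543 ▷ ((0x00198765432a ▷ ((0x00156789432a ▷ ((0x0065432789a1 ▷ ((0x00a987654321 ▷ ((0x001765432a89 ▷
  ((0x0165432a0987 ▷ ((0x01a345678902 ▷ ((0x00162345a987 ▷ ((0x01a987620543 ▷ ((0x0051a9876243 ▷ ((0x01a987026543 ▷
  ((0x01503a246789 ▷ ((0x0071a9826543 ▷ ((0x0071a9834562 ▷ ((0x0071a9654328 ▷ ((0x01964570382a ▷ ((0x00719645382a ▷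
  ((0x01a987534602 ▷ []) ∷ [])) ∷ [])) ∷ [])) ∷ [])) ∷ [])) ∷ [])) ∷ [])) ∷ [])) ∷ [])) ∷ (0x015a06234789 ▷
  ((0x01a987062345 ▷ ((0x0071a9862345 ▷ ((0x015a06234987 ▷ ((0x0071a9234568 ▷ ((0x01920a876543 ▷ ((0x01a865307492 ▷
  ((0x0074962351a8 ▷ ((0x0174920a5368 ▷ ((0x0174920a3865 ▷ ((0x00162a538974 ▷ ((0x015a06238794 ▷ []) ∷ [])) ∷ [])) ∷
  [])) ∷ [])) ∷ [])) ∷ [])) ∷ [])) ∷ [])) ∷ [])) ∷ [])) ∷ [])) ∷ [])) ∷ (0x01908765432a ▷ ((0x0091a3456782 ▷
  ((0x0091a7654328 ▷ ((0x00917a654328 ▷ ((0x0016a9872345 ▷ ((0x017a08234569 ▷ ((0x0096a1754328 ▷ ((0x00917a234568 ▷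
  ((0x01720689a345 ▷ []) ∷ [])) ∷ [])) ∷ [])) ∷ [])) ∷ [])) ∷ [])) ∷ [])) ∷ [])) ∷ [])) ∷ (0x0165432a0789 ▷
  ((0x01908765432a ▷ ((0x019765432a08 ▷ ((0x017985432a06 ▷ ((0x0179860a2345 ▷ ((0x01680a234579 ▷ ((0x01a972086543 ▷
  ((0x01a973456802 ▷ ((0x01a943275806 ▷ ((0x01586a273094 ▷ ((0x00798165432a ▷ ((0x01a987234506 ▷ ((0x0094a1586723 ▷
  ((0x019058672a43 ▷ []) ∷ [])) ∷ [])) ∷ [])) ∷ [])) ∷ [])) ∷ [])) ∷ [])) ∷ [])) ∷ [])) ∷ [])) ∷ [])) ∷ [])) ∷ [])) ∷
  [])) ∷ (0x00178965432a ▷ ((0x01960a234587 ▷ ((0x0017654328a9 ▷ ((0x0017654329a8 ▷ ((0x01a982076543 ▷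
  ((0x00176543a982 ▷ ((0x003a45678291 ▷ ((0x0035678291a4 ▷ ((0x01928765403a ▷ ((0x01934567820a ▷ ((0x0139a4028765 ▷
  ((0x019604a85327 ▷ ((0x014567820a39 ▷ ((0x01532604a987 ▷ ((0x0039a4178265 ▷ []) ∷ [])) ∷ [])) ∷ [])) ∷ [])) ∷ []))
  ∷ [])) ∷ [])) ∷ [])) ∷ [])) ∷ [])) ∷ [])) ∷ [])) ∷ [])) ∷ [])) ∷ [])) ∷ (0x00a987654312 ▷ ((0x0031a9876542 ▷
  ((0x0031a9876524 ▷ ((0x01908765432a ▷ ((0x01a902876543 ▷ ((0x01a345678902 ▷ ((0x013a45678902 ▷ ((0x01a907654328 ▷
  ((0x00a197654328 ▷ ((0x0079a1654328 ▷ ((0x0031a4298765 ▷ ((0x01a079654328 ▷ ((0x01a908234567 ▷ ((0x01a087654392 ▷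
  ((0x00142a398765 ▷ ((0x0079a1456823 ▷ ((0x013a24098765 ▷ ((0x01956780432a ▷ ((0x0016897a2345 ▷ ((0x00a786925143 ▷
  []) ∷ [])) ∷ [])) ∷ [])) ∷ [])) ∷ [])) ∷ [])) ∷ [])) ∷ [])) ∷ [])) ∷ [])) ∷ [])) ∷ [])) ∷ [])) ∷ [])) ∷ [])) ∷
  (0x00918765432a ▷ ((0x01a045678923 ▷ ((0x01a987650423 ▷ ((0x0051a9876324 ▷ ((0x0051a9876423 ▷ ((0x00a987463152 ▷
  ((0x01a987520643 ▷ ((0x0150a9872346 ▷ ((0x01a985720643 ▷ ((0x01a982754630 ▷ ((0x0091a7654328 ▷ ((0x019036457a28 ▷
  []) ∷ [])) ∷ [])) ∷ [])) ∷ [])) ∷ [])) ∷ [])) ∷ [])) ∷ [])) ∷ [])) ∷ (0x00436789a152 ▷ ((0x01526789a043 ▷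
  ((0x01a987263045 ▷ ((0x01a092876543 ▷ ((0x00a987513624 ▷ ((0x00a197654328 ▷ ((0x004579a13628 ▷ []) ∷ [])) ∷ [])) ∷
  [])) ∷ [])) ∷ [])) ∷ [])) ∷ [])) ∷ [])) ∷ [])) ∷ [])) ∷ [])) ∷ [])) ∷ [])) ∷ (0x006789a12345 ▷ ((0x0195432a8760 ▷
  ((0x00678951432a ▷ ((0x01598760432a ▷ ((0x01a543298760 ▷ ((0x015a23498760 ▷ ((0x0067832a5194 ▷ ((0x006784915a23 ▷
  ((0x0067915a2348 ▷ ((0x0067895a2314 ▷ ((0x00654831a972 ▷ []) ∷ [])) ∷ [])) ∷ [])) ∷ [])) ∷ [])) ∷ (0x00126789a543 ▷
  ((0x00162345a987 ▷ ((0x006789a54312 ▷ ((0x001789a54326 ▷ ((0x01306789a542 ▷ ((0x00654389a172 ▷ ((0x001423a98765 ▷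
  ((0x015987603a24 ▷ []) ∷ [])) ∷ [])) ∷ [])) ∷ [])) ∷ [])) ∷ [])) ∷ [])) ∷ [])) ∷ [])) ∷ [])) ∷ (0x00678195432a ▷
  ((0x0018a9234567 ▷ ((0x0067a8129543 ▷ ((0x0065437218a9 ▷ ((0x0037654291a8 ▷ ((0x0037659218a4 ▷ ((0x01a987306524 ▷
  ((0x01956037842a ▷ ((0x00376592184a ▷ []) ∷ [])) ∷ [])) ∷ [])) ∷ [])) ∷ [])) ∷ [])) ∷ [])) ∷ [])) ∷ [])) ∷ [])) ∷
  [])) ∷ (0x0015432a6789 ▷ ((0x0015432789a6 ▷ ((0x00154326a987 ▷ ((0x001543a98762 ▷ ((0x01a987620543 ▷
  ((0x01a987026543 ▷ ((0x01a980726543 ▷ ((0x0072654389a1 ▷ ((0x019765432a08 ▷ ((0x0038456279a1 ▷ ((0x003a21948765 ▷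
  ((0x00a987621543 ▷ ((0x00126789a543 ▷ ((0x00156784932a ▷ ((0x0015627a3984 ▷ ((0x005a23678491 ▷ ((0x005a36127984 ▷
  ((0x0162705a3984 ▷ []) ∷ [])) ∷ [])) ∷ [])) ∷ [])) ∷ [])) ∷ [])) ∷ [])) ∷ [])) ∷ (0x001567942a38 ▷ ((0x01976542083a
  ▷ []) ∷ [])) ∷ [])) ∷ [])) ∷ [])) ∷ [])) ∷ [])) ∷ [])) ∷ [])) ∷ [])) ∷ [])) ∷ [])) ∷ [])) ∷ (0x0013456789a2 ▷
  ((0x0130456789a2 ▷ ((0x0012a9876543 ▷ ((0x0031456789a2 ▷ ((0x0123456789a0 ▷ ((0x01356789a204 ▷ ((0x00654321a987 ▷
  ((0x0089a1234567 ▷ ((0x0031a9876542 ▷ ((0x001423a98765 ▷ ((0x013a04298765 ▷ ((0x01240a398765 ▷ ((0x01876543920a ▷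
  ((0x01a765439208 ▷ ((0x013a04256789 ▷ ((0x0018a2934567 ▷ ((0x01a987532406 ▷ ((0x01a987640253 ▷ ((0x01920a876543 ▷
  ((0x0094213a8765 ▷ ((0x0095678a3124 ▷ ((0x012359460a87 ▷ []) ∷ [])) ∷ [])) ∷ [])) ∷ [])) ∷ [])) ∷ [])) ∷ [])) ∷
  [])) ∷ [])) ∷ [])) ∷ [])) ∷ [])) ∷ [])) ∷ [])) ∷ [])) ∷ [])) ∷ [])) ∷ [])) ∷ [])) ∷ [])) ∷ [])) ∷ [])) ∷ [])) ∷ []))
  refl


at-map : ∀ {A B : Set} (f : A → B) d xs i → at (f d) (map f xs) i ≡ f (at d xs i)
at-map f d []       i       = refl
at-map f d (x ∷ xs) zero    = refl
at-map f d (x ∷ xs) (suc i) = at-map f d xs i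

Follows : {A : Set} → (ℕ → A) → ℕ → List A → Set
Follows f i []       = ⊤
Follows f i (x ∷ xs) = f i ≡ x × Follows f (suc i) xs

follows-shift : ∀ {A : Set} (f : ℕ → A) i xs → Follows (f ∘ suc) i xs → Follows f (suc i) xs
follows-shift f i []       _        = tt
follows-shift f i (x ∷ xs) (eq , p) = eq , follows-shift f (suc i) xs p

follows-at : ∀ {A : Set} d (pre xs post : List A) → Follows (at d (pre ++ xs ++ post)) (length pre) xs
follows-at d []        []       post = tt
follows-at d []        (x ∷ xs) post = refl , follows-shift (at d (x ∷ xs ++ post)) 0 xs (follows-at d [] xs post)
follows-at d (p ∷ pre) xs       post = follows-shift (at d (p ∷ pre ++ xs ++ post)) (length pre) xs (follows-at d pre xs post)

-- Rows (m , i , j , l) for the arcs (i , j , l) of H₄, which miss m.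
H4rows : List (ℕ × ℕ × ℕ × ℕ)
H4rows = (0 , 1 , 2 , 3) ∷ (2 , 3 , 0 , 1) ∷ (1 , 2 , 3 , 0) ∷ (3 , 0 , 1 , 2) ∷ []

-- Arcs are named by the vertex they miss, as in `quads`, so a relabelling acts on arc names as it
-- does on vertices. Two literals determine the order of an arc on three vertices.
H4lits : List ℕ → List Lit
H4lits π = concatMap (λ (m , i , j , l) → (at 0 π m , at 0 π i , at 0 π j) ∷ (at 0 π m , at 0 π j , at 0 π l) ∷ []) H4rows

H4list : List (List ℕ)
H4list = map (λ (m , i , j , l) → i ∷ j ∷ l ∷ []) H4rows

quads : List (List ℕ)
quads = (1 ∷ 2 ∷ 3 ∷ []) ∷ (0 ∷ 2 ∷ 3 ∷ []) ∷ (0 ∷ 1 ∷ 3 ∷ []) ∷ (0 ∷ 1 ∷ 2 ∷ []) ∷ []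

-- The hypotheses sort the arc that misses vertex 0, which can be arranged by renaming the other
-- three vertices.
quadCert : Certificate (hyperProblem 4 quads fromSource true H4lits) ((0 , 1 , 2) ∷ (0 , 2 , 3) ∷ [])
quadCert = certify
  (0x03203102 ▷ ((0x00230231 ▷ ((0x00230132 ▷ []) ∷ [])) ∷ (0x02031031 ▷ ((0x03102102 ▷ ((0x00312312 ▷ ((0x00213203 ▷
  ((exc 0x0123) ∷ [])) ∷ [])) ∷ [])) ∷ [])) ∷ []))
  refl

distinct₄ : ∀ {V : Set} {u p q r : V} → Unique (u ∷ p ∷ q ∷ r ∷ []) →
            u ≢ p × u ≢ q × u ≢ r × p ≢ q × p ≢ r × q ≢ r
distinct₄ ((a ∷ b ∷ c ∷ []) ∷ (d ∷ e ∷ []) ∷ (f ∷ []) ∷ _) = a , b , c , d , e , f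

-- Families in which each arc misses at most one vertex

module _ {A V : Set} (Mem : A → V → Set) where

  -- As many arcs as vertices, the arc paired with z missing at most z.
  record Family (ps : List (V × A)) : Set where
    field
      uniqueV : Unique (map proj₁ ps)
      uniqueA : Unique (map proj₂ ps)
      near    : ∀ {z a u} → (z , a) ∈ ps → u ∈ map proj₁ ps → u ≢ z → Mem a u

  open Family

  permute : ∀ {ps qs} → ps ↭ qs → Family ps → Family qs
  permute p F = record
    { uniqueV = Unique-resp-↭ (map⁺ proj₁ p) (uniqueV F)
    ; uniqueA = Unique-resp-↭ (map⁺ proj₂ p) (uniqueA F)
    ; near    = λ za∈ u∈ → near F (∈-resp-↭ (↭-sym p) za∈) (∈-resp-↭ (map⁺ proj₁ (↭-sym p)) u∈) }

  -- The only vertex that `a` could miss is x, so after the removal of x it misses nothing and may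
  -- be paired with any q. This frees the arc `b` of q for use on the prefix of the path.
  delete : ∀ {x a q b ps} → Family ((x , a) ∷ (q , b) ∷ ps) → Family ((q , a) ∷ ps)
  delete {x} {a} {q} {b} {ps} F with uniqueV F | uniqueA F
  ... | x∉ ∷ uV | (_ ∷ a∉) ∷ _ ∷ uA = record
    { uniqueV = uV ; uniqueA = a∉ ∷ uA
    ; near = λ where
        (here refl) u∈ u≢z → near F (here refl) (there u∈) (λ u≡x → All.lookup x∉ u∈ (sym u≡x))
        (there za∈) u∈ u≢z → near F (there (there za∈)) (there u∈) u≢z }

  delete-arcs : ∀ {x a q b ps c} → Family ((x , a) ∷ (q , b) ∷ ps) → c ∈ map proj₂ ((q , a) ∷ ps) →
                c ∈ map proj₂ ((x , a) ∷ (q , b) ∷ ps) × c ≢ b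
  delete-arcs F c∈ with uniqueA F | c∈
  ... | (a≢b ∷ _) ∷ _ | here refl = here refl , a≢b
  ... | _ ∷ b∉ ∷ _    | there c∈′ = there (there c∈′) , λ c≡b → All.lookup b∉ c∈′ (sym c≡b)

  module _ {R : A → V → V → Set} (ord : Ordering Mem R) where

    -- The hypothesis on `f` makes it contain all four vertices. A `delete` supplies such an arc,
    -- and this is how the obstruction H₄ is avoided.
    four : ∀ {x y p q ax ay ap f} → Family ((x , ax) ∷ (y , ay) ∷ (p , ap) ∷ (q , f) ∷ []) → Mem f q →
           Good R (_∈ ax ∷ ay ∷ ap ∷ f ∷ []) x y (p ∷ q ∷ [])
    four {x} {y} {p} {q} {ax} {ay} {ap} {f} F fq =
      goodFamily ord 4 ((1 ∷ 2 ∷ 3 ∷ []) ∷ (0 ∷ 2 ∷ 3 ∷ []) ∷ (0 ∷ 1 ∷ 3 ∷ []) ∷ (0 ∷ 1 ∷ 2 ∷ 3 ∷ []) ∷ [])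
        refl (uniqueV F) refl (uniqueA F)
        ( (m 0ᶠ 1ᶠ y≢x ∷ m 0ᶠ 2ᶠ p≢x ∷ m 0ᶠ 3ᶠ q≢x ∷ [])
        ∷ (m 1ᶠ 0ᶠ (≢-sym y≢x) ∷ m 1ᶠ 2ᶠ p≢y ∷ m 1ᶠ 3ᶠ q≢y ∷ [])
        ∷ (m 2ᶠ 0ᶠ (≢-sym p≢x) ∷ m 2ᶠ 1ᶠ (≢-sym p≢y) ∷ m 2ᶠ 3ᶠ q≢p ∷ [])
        ∷ (m 3ᶠ 0ᶠ (≢-sym q≢x) ∷ m 3ᶠ 1ᶠ (≢-sym q≢y) ∷ m 3ᶠ 2ᶠ (≢-sym q≢p) ∷ fq ∷ [])
        ∷ [])
        fourCert []
      where
      m : ∀ {z a u} → (z , a) ∈ (x , ax) ∷ (y , ay) ∷ (p , ap) ∷ (q , f) ∷ [] → u ∈ x ∷ y ∷ p ∷ q ∷ [] → u ≢ z → Mem a u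
      m = near F
      ≢-sym : ∀ {u v : V} → u ≢ v → v ≢ u
      ≢-sym n e = n (sym e)
      0ᶠ : ∀ {B : Set} {z : B} {zs} → z ∈ z ∷ zs
      0ᶠ = here refl
      1ᶠ : ∀ {B : Set} {a z : B} {zs} → z ∈ a ∷ z ∷ zs
      1ᶠ = there 0ᶠ
      2ᶠ : ∀ {B : Set} {a b z : B} {zs} → z ∈ a ∷ b ∷ z ∷ zs
      2ᶠ = there 1ᶠ
      3ᶠ : ∀ {B : Set} {a b c z : B} {zs} → z ∈ a ∷ b ∷ c ∷ z ∷ zs
      3ᶠ = there 2ᶠ
      dist = distinct₄ (uniqueV F)
      y≢x = ≢-sym (proj₁ dist)
      p≢x = ≢-sym (proj₁ (proj₂ dist))
      q≢x = ≢-sym (proj₁ (proj₂ (proj₂ dist)))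
      p≢y = ≢-sym (proj₁ (proj₂ (proj₂ (proj₂ dist))))
      q≢y = ≢-sym (proj₁ (proj₂ (proj₂ (proj₂ (proj₂ dist)))))
      q≢p = ≢-sym (proj₂ (proj₂ (proj₂ (proj₂ (proj₂ dist)))))

    three : ∀ {s t q g h f} → Family ((s , g) ∷ (t , h) ∷ (q , f) ∷ []) → Mem g s → Mem f q →
            Good R (_∈ g ∷ h ∷ f ∷ []) s t (q ∷ [])
    three {s} {t} {q} {g} {h} {f} F gs fq with uniqueV F | uniqueA F
    ... | (s≢t ∷ s≢q ∷ []) ∷ (t≢q ∷ []) ∷ _ | (g≢h ∷ g≢f ∷ []) ∷ (h≢f ∷ []) ∷ _ =
      weakenGood (∈-resp-↭ (prep g (swap f h ↭-refl))) ↭-refl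
        (goodFamily ord 3 ((0 ∷ 1 ∷ 2 ∷ []) ∷ (0 ∷ 1 ∷ 2 ∷ []) ∷ (0 ∷ 2 ∷ []) ∷ [])
          refl (uniqueV F) refl ((g≢f ∷ g≢h ∷ []) ∷ ((h≢f ∘ sym) ∷ []) ∷ [] ∷ [])
          ( (gs ∷ near F (here refl) (there (here refl)) (s≢t ∘ sym)
                ∷ near F (here refl) (there (there (here refl))) (s≢q ∘ sym) ∷ [])
          ∷ (near F (there (there (here refl))) (here refl) s≢q
                ∷ near F (there (there (here refl))) (there (here refl)) t≢q ∷ fq ∷ [])
          ∷ (near F (there (here refl)) (here refl) s≢t
                ∷ near F (there (here refl)) (there (there (here refl))) (t≢q ∘ sym) ∷ [])
          ∷ [])
          threeCert [])

  -- The count `3 + m` means at least five vertices in all; for four the claim fails, H₄ being such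
  -- a family.
  Spread : ℕ → Set₁
  Spread m = ∀ {R} → Ordering Mem R → ∀ {x a y b ps} → length ps ≡ 3 + m → Family ((x , a) ∷ (y , b) ∷ ps) →
             Good R (_∈ map proj₂ ((x , a) ∷ (y , b) ∷ ps)) x y (map proj₁ ps)

  spreadOn : ∀ {m R} → Spread m → Ordering Mem R → ∀ {ps x a y b qs} → ps ↭ (x , a) ∷ (y , b) ∷ qs →
             length ps ≡ 5 + m → Family ps → Good R (_∈ map proj₂ ps) x y (map proj₁ qs)
  spreadOn S ord p len F =
    weakenGood (∈-resp-↭ (map⁺ proj₂ (↭-sym p))) ↭-refl
      (S ord (suc-injective (suc-injective (trans (sym (↭-length p)) len))) (permute p F))

  near-first : ∀ {x a ps} → Family ((x , a) ∷ ps) → ∀ {u} → u ∈ map proj₁ ps → Mem a u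
  near-first F u∈ with x∉ ∷ _ ← uniqueV F = near F (here refl) (there u∈) (λ u≡x → All.lookup x∉ u∈ (sym u≡x))

  spread : ∀ m → Spread m
  -- The arc `as`, which misses at most s, compares x with y, and `aq` plays the part of a′.
  -- Removing x or y hands its arc to q, so that `four` applies to the remaining four vertices.
  spread zero {R} ord {x} {ax} {y} {ay} {(s , as) ∷ (t , at) ∷ (q , aq) ∷ []} refl F =
    step₂ ord {Q₁ = λ b → b ∈ full × b ≢ aq} {Q₂ = λ b → b ∈ full × b ≢ as × b ≢ aq}
      (there (there (here refl))) (there (there (there (there (here refl))))) aq≢as
      (uniqueV F) (inS (here refl)) (inS (there (here refl)))
      (inQ (here refl)) (inQ (there (here refl))) (inQ (there (there (here refl))))
      (inQ (there (there (there (here refl))))) id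
      (fourX (reorder-↭ (2 ∷ 1 ∷ 1 ∷ []) _)) (fourX (reorder-↭ (3 ∷ 1 ∷ 1 ∷ []) _))
      (fourY (reorder-↭ (2 ∷ 1 ∷ 1 ∷ []) _)) (fourY (reorder-↭ (3 ∷ 1 ∷ 1 ∷ []) _))
      id (weakenGood subC ↭-refl (three ord (delete FC) (near-first FC (here refl)) xq))
    where
    full = ax ∷ ay ∷ as ∷ at ∷ aq ∷ []
    inS : ∀ {u} → u ∈ x ∷ y ∷ t ∷ q ∷ [] → Mem as u
    inS = near-first (permute (reorder-↭ (2 ∷ []) _) F)
    inQ : ∀ {u} → u ∈ x ∷ y ∷ s ∷ t ∷ [] → Mem aq u
    inQ = near-first (permute (reorder-↭ (4 ∷ []) _) F)
    aq≢as : aq ≢ as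
    aq≢as with _ ∷ _ ∷ (_ ∷ as≢aq ∷ []) ∷ _ ← uniqueA F = as≢aq ∘ sym
    FX : Family ((x , ax) ∷ (q , aq) ∷ (y , ay) ∷ (s , as) ∷ (t , at) ∷ [])
    FX = permute (reorder-↭ (0 ∷ 4 ∷ []) _) F
    FY : Family ((y , ay) ∷ (q , aq) ∷ (x , ax) ∷ (s , as) ∷ (t , at) ∷ [])
    FY = permute (reorder-↭ (1 ∷ 4 ∷ []) _) F
    -- A further `delete`, of y, passes `ay` to s. Then both `as` and `aq` are free to be spent, and
    -- `ay` and `ax` contain all of s, t, q, as `three` requires.
    FC : Family ((y , ay) ∷ (s , as) ∷ (t , at) ∷ (q , ax) ∷ [])
    FC = permute (reorder-↭ (1 ∷ 1 ∷ 1 ∷ []) _) (delete FX)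
    xq : Mem ax q
    xq = near-first FX (here refl)
    yq : Mem ay q
    yq = near-first FY (here refl)
    subX : ∀ {b} → b ∈ ax ∷ ay ∷ as ∷ at ∷ [] → b ∈ full × b ≢ aq
    subX b∈ with p , n ← delete-arcs FX b∈ = ∈-resp-↭ (↭-sym (reorder-↭ (0 ∷ 4 ∷ []) full)) p , n
    subY : ∀ {b} → b ∈ ay ∷ ax ∷ as ∷ at ∷ [] → b ∈ full × b ≢ aq
    subY b∈ with p , n ← delete-arcs FY b∈ = ∈-resp-↭ (↭-sym (reorder-↭ (1 ∷ 4 ∷ []) full)) p , n
    subC : ∀ {b} → b ∈ ay ∷ at ∷ ax ∷ [] → b ∈ full × b ≢ as × b ≢ aq
    subC b∈ with p , n ← delete-arcs FC b∈
      with p′ , n′ ← subX (∈-resp-↭ (↭-sym (reorder-↭ (1 ∷ 1 ∷ 1 ∷ []) _)) p) = p′ , n , n′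
    fourX : ∀ {w w′ v aw aw′ av} → (q , ax) ∷ (y , ay) ∷ (s , as) ∷ (t , at) ∷ [] ↭ (w , aw) ∷ (w′ , aw′) ∷ (v , av) ∷ (q , ax) ∷ [] →
            Good (flip₃ R) (λ b → b ∈ full × b ≢ aq) w w′ (v ∷ q ∷ [])
    fourX perm = weakenGood (subX ∘ ∈-resp-↭ (map⁺ proj₂ (↭-sym perm))) ↭-refl
      (four (flipOrdering ord) (permute perm (delete FX)) xq)
    fourY : ∀ {w w′ v aw aw′ av} → (q , ay) ∷ (x , ax) ∷ (s , as) ∷ (t , at) ∷ [] ↭ (w , aw) ∷ (w′ , aw′) ∷ (v , av) ∷ (q , ay) ∷ [] →
            Good (flip₃ R) (λ b → b ∈ full × b ≢ aq) w w′ (v ∷ q ∷ [])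
    fourY perm = weakenGood (subY ∘ ∈-resp-↭ (map⁺ proj₂ (↭-sym perm))) ↭-refl
      (four (flipOrdering ord) (permute perm (delete FY)) yq)
  -- A sixth vertex p lends its arc for the comparison of x with y, so s and t both keep theirs; p
  -- and q are compensated by the arcs of the removed vertices y and x.
  spread (suc m) {R} ord {x} {ax} {y} {ay} {(s , as) ∷ (t , at) ∷ (p , ap) ∷ (q , aq) ∷ rest} len F =
    step₂ ord {Q₁ = λ b → b ∈ full × b ≢ aq} {Q₂ = λ b → b ∈ full × b ≢ ap × b ≢ aq}
      (there (there (there (there (here refl))))) (there (there (there (there (there (here refl)))))) aq≢ap
      (uniqueV F) (inP (here refl)) (inP (there (here refl)))
      (inQ (here refl)) (inQ (there (here refl))) (inQ (there (there (here refl))))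
      (inQ (there (there (there (here refl))))) id
      (onX (reorder-↭ (2 ∷ 1 ∷ 1 ∷ 1 ∷ []) _)) (onX (reorder-↭ (3 ∷ 1 ∷ 1 ∷ 1 ∷ []) _))
      (onY (reorder-↭ (2 ∷ 1 ∷ 1 ∷ 1 ∷ []) _)) (onY (reorder-↭ (3 ∷ 1 ∷ 1 ∷ 1 ∷ []) _))
      id (weakenGood subC ↭-refl (smaller m rest len (permute (reorder-↭ (2 ∷ 2 ∷ []) _) (delete FC))))
    where
    full = ax ∷ ay ∷ as ∷ at ∷ ap ∷ aq ∷ map proj₂ rest
    inP : ∀ {u} → u ∈ x ∷ y ∷ s ∷ t ∷ q ∷ map proj₁ rest → Mem ap u
    inP = near-first (permute (reorder-↭ (4 ∷ []) _) F)
    inQ : ∀ {u} → u ∈ x ∷ y ∷ s ∷ t ∷ p ∷ map proj₁ rest → Mem aq u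
    inQ = near-first (permute (reorder-↭ (5 ∷ []) _) F)
    aq≢ap : aq ≢ ap
    aq≢ap with _ ∷ _ ∷ _ ∷ _ ∷ (ap≢aq ∷ _) ∷ _ ← uniqueA F = ap≢aq ∘ sym
    FX : Family ((x , ax) ∷ (q , aq) ∷ (y , ay) ∷ (s , as) ∷ (t , at) ∷ (p , ap) ∷ rest)
    FX = permute (reorder-↭ (0 ∷ 4 ∷ []) _) F
    FY : Family ((y , ay) ∷ (q , aq) ∷ (x , ax) ∷ (s , as) ∷ (t , at) ∷ (p , ap) ∷ rest)
    FY = permute (reorder-↭ (1 ∷ 4 ∷ []) _) F
    FC : Family ((y , ay) ∷ (p , ap) ∷ (q , ax) ∷ (s , as) ∷ (t , at) ∷ rest)
    FC = permute (reorder-↭ (1 ∷ 3 ∷ []) _) (delete FX)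
    xq : Mem ax q
    xq = near-first FX (here refl)
    subX : ∀ {b} → b ∈ ax ∷ ay ∷ as ∷ at ∷ ap ∷ map proj₂ rest → b ∈ full × b ≢ aq
    subX b∈ with i , n ← delete-arcs FX b∈ = ∈-resp-↭ (↭-sym (reorder-↭ (0 ∷ 4 ∷ []) full)) i , n
    subY : ∀ {b} → b ∈ ay ∷ ax ∷ as ∷ at ∷ ap ∷ map proj₂ rest → b ∈ full × b ≢ aq
    subY b∈ with i , n ← delete-arcs FY b∈ = ∈-resp-↭ (↭-sym (reorder-↭ (1 ∷ 4 ∷ []) full)) i , n
    subC : ∀ {b} → b ∈ as ∷ at ∷ ay ∷ ax ∷ map proj₂ rest → b ∈ full × b ≢ ap × b ≢ aq
    subC b∈ with i , n ← delete-arcs FC (∈-resp-↭ (↭-sym (reorder-↭ (2 ∷ 2 ∷ []) _)) b∈)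
      with i′ , n′ ← subX (∈-resp-↭ (↭-sym (reorder-↭ (1 ∷ 3 ∷ []) _)) i) = i′ , n , n′
    onX : ∀ {w w′ aw aw′ ps} → (q , ax) ∷ (y , ay) ∷ (s , as) ∷ (t , at) ∷ (p , ap) ∷ rest ↭ (w , aw) ∷ (w′ , aw′) ∷ ps →
          Good (flip₃ R) (λ b → b ∈ full × b ≢ aq) w w′ (map proj₁ ps)
    onX perm = weakenGood subX ↭-refl (spreadOn (spread m) (flipOrdering ord) perm (cong suc len) (delete FX))
    onY : ∀ {w w′ aw aw′ ps} → (q , ay) ∷ (x , ax) ∷ (s , as) ∷ (t , at) ∷ (p , ap) ∷ rest ↭ (w , aw) ∷ (w′ , aw′) ∷ ps →
          Good (flip₃ R) (λ b → b ∈ full × b ≢ aq) w w′ (map proj₁ ps)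
    onY perm = weakenGood subY ↭-refl (spreadOn (spread m) (flipOrdering ord) perm (cong suc len) (delete FY))
    -- Six vertices less two leave four, out of the range of `Spread`; there the inherited arc `ax`
    -- contains q as well, so `four` takes over.
    smaller : ∀ m rest → length ((s , as) ∷ (t , at) ∷ (p , ap) ∷ (q , aq) ∷ rest) ≡ 4 + m →
              Family ((s , as) ∷ (t , at) ∷ (p , ay) ∷ (q , ax) ∷ rest) →
              Good R (_∈ as ∷ at ∷ ay ∷ ax ∷ map proj₂ rest) s t (p ∷ q ∷ map proj₁ rest)
    smaller zero    []      _   G = four ord G xq
    smaller (suc m) rest    len G = spread m ord (suc-injective (suc-injective len)) G

take-⊆ : ∀ {A : Set} n (xs : List A) {v} → v ∈ take n xs → v ∈ xs
take-⊆ (suc n) (x ∷ xs) (here eq)  = here eq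
take-⊆ (suc n) (x ∷ xs) (there v∈) = there (take-⊆ n xs v∈)

∈⇒↭ : ∀ {A : Set} {x : A} {xs} → x ∈ xs → Σ[ ys ∈ List A ] xs ↭ x ∷ ys
∈⇒↭ x∈ with us , vs , refl ← ∈-∃++ x∈ = us ++ vs , shift _ us vs

head∉ : ∀ {A : Set} {x : A} {xs} → Unique (x ∷ xs) → ¬ x ∈ xs
head∉ (x∉ ∷ _) x∈ = All.lookup x∉ x∈ refl

-- The induction on the number of vertices

module Hyper {A V : Set} (IsArc : A → Set) (_∋_ : A → V → Set) (k : ℕ)
  (arcOn : ∀ K → Unique K → length K ≡ k →
           Σ[ a ∈ A ] (IsArc a × (∀ {v} → v ∈ K → a ∋ v) × (∀ {v} → a ∋ v → v ∈ K)))
  where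

  Mem : A → V → Set
  Mem a v = IsArc a × a ∋ v

  Within : List V → A → Set
  Within U a = IsArc a × (∀ {v} → a ∋ v → v ∈ U)

  within-⊆ : ∀ {U U′} → (∀ {v} → v ∈ U → v ∈ U′) → ∀ {a} → Within U a → Within U′ a
  within-⊆ sub (arc , stays) = arc , sub ∘ stays

  -- An arc through prescribed vertices is obtained by putting them at the front of `U`, since the
  -- first k entries are the ones used.
  arcFrom : ∀ U → Unique U → k ≤ length U →
            Σ[ a ∈ A ] (IsArc a × (∀ {v} → v ∈ take k U → a ∋ v) × (∀ {v} → a ∋ v → v ∈ U))
  arcFrom U u k≤ with a , arc , on , off ← arcOn (take k U) (Uniqueₚ.take⁺ k u)
    (trans (length-take k U) (m≤n⇒m⊓n≡m k≤)) = a , arc , on , take-⊆ k U ∘ off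

  Dominates : ℕ → Set₁
  Dominates u = ∀ {R} → Ordering Mem R → ∀ {x y L} → Unique (x ∷ y ∷ L) → 2 + length L ≡ u →
                Good R (Within (x ∷ y ∷ L)) x y L

  -- The path covers s, t and K only, but its arcs may contain z.
  Dominates⁺ : ℕ → Set₁
  Dominates⁺ u = ∀ {R} → Ordering Mem R → ∀ {z s t K} → Unique (z ∷ s ∷ t ∷ K) → 2 + length K ≡ u →
                 Good R (Within (z ∷ s ∷ t ∷ K)) s t K

  dominates⇒⁺ : ∀ {u} → Dominates u → Dominates⁺ u
  dominates⇒⁺ D ord (_ ∷ u) len = weakenGood (within-⊆ there) ↭-refl (D ord u len)

  -- For a continuation behind o and z, the other u vertices may carry a single arc, when u = k, or
  -- a copy of H₄, when k = 3 and u = 4. Arcs through o that avoid z are still unspent, and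
  -- `Dominates⁺` makes them available.
  dominates-step : ∀ {u} → 2 ≤ k → k ≤ suc u → 3 ≤ u → Dominates (suc u) → Dominates⁺ u → Dominates (2 + u)
  dominates-step {u} (s≤s (s≤s z≤n)) k≤u 3≤u D D⁺ {R} ord {x} {y} {L} uq len =
    go L (suc-injective (suc-injective len)) 3≤u uq
    where
    open Ordering ord
    half : ∀ {a o z s t r M} → length (s ∷ t ∷ r ∷ M) ≡ u → Unique (o ∷ z ∷ s ∷ t ∷ r ∷ M) →
           Within (o ∷ z ∷ s ∷ t ∷ r ∷ M) a → a ∋ o → a ∋ z → R a o z →
           Good R (Within (o ∷ z ∷ s ∷ t ∷ r ∷ M)) o z (s ∷ t ∷ r ∷ M)
    half {a} {o} {z} {s} {t} {r} {M} refl uq₁ wa ao az ra =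
      step₁ {Q₁ = Within (o ∷ s ∷ t ∷ r ∷ M)} {Q₂ = Within (o ∷ s ∷ t ∷ r ∷ M)} (_∋ z) wa az ra
        (spoke ↭-refl) (spoke (↭-sym (reorder-↭ (1 ∷ []) _))) (spoke (↭-sym (reorder-↭ (2 ∷ []) _)))
        sub (λ perm → weakenGood (within-⊆ (∈-resp-↭ perm)) ↭-refl
                        (D (flipOrdering ord) (Unique-resp-↭ (↭-sym perm) uqo) (↭-length perm)))
        sub (λ perm → weakenGood (within-⊆ (∈-resp-↭ (prep o perm))) ↭-refl
                        (D⁺ ord (Unique-resp-↭ (prep o (↭-sym perm)) uqo) (↭-length perm)))
      where
      uqz = Unique-resp-↭ (swap o z ↭-refl) uq₁
      uqo : Unique (o ∷ s ∷ t ∷ r ∷ M)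
      uqo with _ ∷ v ← uqz = v
      sub : ∀ {b} → Within (o ∷ s ∷ t ∷ r ∷ M) b → Within (o ∷ z ∷ s ∷ t ∷ r ∷ M) b × ¬ b ∋ z
      sub w = within-⊆ (∈-resp-↭ (swap z o ↭-refl) ∘ there) w , head∉ uqz ∘ proj₂ w
      spoke : ∀ {w N} → w ∷ N ↭ s ∷ t ∷ r ∷ M → Spoke {R = R} {Q = Within (o ∷ z ∷ s ∷ t ∷ r ∷ M)} a (_∋ z) z w
      spoke {w} {N} perm
        with uz ← Unique-resp-↭ (prep o (prep z (↭-sym perm))) uq₁
        with _ ∷ uzw@((z≢w ∷ _) ∷ _) ← uz
        -- The arc is drawn from the vertices other than o, which separates it from `a`; there are u
        -- + 1 of these, hence the bound on k.
        with e , arc , on , off ← arcFrom (z ∷ w ∷ N) uzw (subst (λ l → k ≤ suc l) (sym (↭-length perm)) k≤u) = record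
        { arc = e ; has = on (here refl)
        ; usable = arc , there ∘ ∈-resp-↭ (prep z perm) ∘ off
        ; other = λ { refl → head∉ uz (off ao) }
        ; compare = total (arc , on (here refl)) (arc , on (there (here refl))) z≢w }
    go : ∀ L → length L ≡ u → 3 ≤ u → Unique (x ∷ y ∷ L) → Good R (Within (x ∷ y ∷ L)) x y L
    go (s ∷ t ∷ r ∷ M) lenL _ uq@((x≢y ∷ _) ∷ _)
      with a , arc , on , off ← arcFrom _ uq (≤-trans k≤u (≤-trans (≤-reflexive (cong suc (sym lenL))) (n≤1+n _)))
      with total (arc , on (here refl)) (arc , on (there (here refl))) x≢y
    ... | inj₁ x<y = half lenL uq (arc , off) (on (here refl)) (on (there (here refl))) x<y
    ... | inj₂ y<x = swapGood {R = R} (weakenGood (within-⊆ (∈-resp-↭ (swap y x ↭-refl))) ↭-refl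
      (half lenL (Unique-resp-↭ (swap x y ↭-refl) uq) (arc , ∈-resp-↭ (swap x y ↭-refl) ∘ off)
        (on (there (here refl))) (on (here refl)) y<x))
    go []           refl ()
    go (_ ∷ [])     refl (s≤s ())
    go (_ ∷ _ ∷ []) refl (s≤s (s≤s ()))

  -- Sets of k + 1 vertices: the arcs that miss exactly one of them

  module _ (C U : List V) (uCU : Unique (C ++ U)) (lenCU : length (C ++ U) ≡ suc k) where

    -- The vertices of `C` lie on all these arcs without having to be visited. `C` is empty for
    -- `Dominates`, and consists of the skipped vertex for `Dominates⁺`.
    record Missing (ia : V × A) : Set where
      field
        arc    : IsArc (proj₂ ia)
        misses : ¬ proj₂ ia ∋ proj₁ ia
        hits   : ∀ {u} → u ∈ U → u ≢ proj₁ ia → proj₂ ia ∋ u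
        hitsC  : ∀ {c} → c ∈ C → proj₂ ia ∋ c
        stays : ∀ {v} → proj₂ ia ∋ v → v ∈ C ++ U

    open Missing

    missing : ∀ {i} → i ∈ U → Σ[ a ∈ A ] Missing (i , a)
    missing {i} i∈ with N , perm ← ∈⇒↭ i∈
      with CU↭ ← ↭-trans (++⁺ˡ C perm) (shift i C N)
      with _ ∷ v ← Unique-resp-↭ CU↭ uCU
      with a , arc , on , off ← arcOn (C ++ N) v (suc-injective (trans (sym (↭-length CU↭)) lenCU)) = a , record
      { arc = arc
      ; misses = head∉ (Unique-resp-↭ CU↭ uCU) ∘ off
      ; hits = λ u∈ u≢i → on (∈-++⁺ʳ C (tail-∈ (∈-resp-↭ perm u∈) u≢i))
      ; hitsC = on ∘ ∈-++⁺ˡ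
      ; stays = ∈-resp-↭ (↭-sym CU↭) ∘ there ∘ off }
      where
      tail-∈ : ∀ {u N} → u ∈ i ∷ N → u ≢ i → u ∈ N
      tail-∈ (here u≡i)  u≢i = ⊥-elim (u≢i u≡i)
      tail-∈ (there u∈) _    = u∈

    record Missings : Set where
      field
        pairs    : List (V × A)
        covers   : map proj₁ pairs ≡ U
        allMiss  : All Missing pairs

    missings : Missings
    missings = let (ps , eq , all) = build U id in record { pairs = ps ; covers = eq ; allMiss = all }
      where
      build : ∀ U′ → (∀ {v} → v ∈ U′ → v ∈ U) → Σ[ ps ∈ List (V × A) ] (map proj₁ ps ≡ U′ × All Missing ps)
      build []       _   = [] , refl , []
      build (i ∷ U′) sub with a , m ← missing (sub (here refl)) | ps , refl , all ← build U′ (sub ∘ there) =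
        (i , a) ∷ ps , refl , m ∷ all

    missing-distinct : ∀ {i a j b} → Missing (i , a) → Missing (j , b) → i ∈ U → i ≢ j → a ≢ b
    missing-distinct p q i∈ i≢j refl = misses p (hits q i∈ i≢j)

    missings-family : ∀ {ps} → map proj₁ ps ≡ U → All Missing ps → Family Mem ps
    missings-family {ps} refl all = record
      { uniqueV = uU
      ; uniqueA = arcs ps id uU all
      ; near = λ za∈ u∈ u≢z → arc (All.lookup all za∈) , hits (All.lookup all za∈) u∈ u≢z }
      where
      uU : Unique (map proj₁ ps)
      uU = drop-prefix C uCU
        where
        drop-prefix : ∀ C {U : List V} → Unique (C ++ U) → Unique U
        drop-prefix []      u       = u
        drop-prefix (_ ∷ C) (_ ∷ u) = drop-prefix C u
      arcs : ∀ qs → (∀ {v} → v ∈ map proj₁ qs → v ∈ map proj₁ ps) → Unique (map proj₁ qs) → All Missing qs →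
             Unique (map proj₂ qs)
      arcs []             _   _        _        = []
      arcs ((i , a) ∷ qs) sub (i∉ ∷ u) (m ∷ ms) = fresh qs i∉ ms ∷ arcs qs (sub ∘ there) u ms
        where
        fresh : ∀ qs → All (i ≢_) (map proj₁ qs) → All Missing qs → All (a ≢_) (map proj₂ qs)
        fresh []       _          _        = []
        fresh (_ ∷ qs) (i≢j ∷ ns) (m′ ∷ ms) = missing-distinct m m′ (sub (here refl)) i≢j ∷ fresh qs ns ms

    missings-within : ∀ {ps} → All Missing ps → ∀ {b} → b ∈ map proj₂ ps → Within (C ++ U) b
    missings-within (m ∷ _)  (here refl) = arc m , stays m
    missings-within (_ ∷ ms) (there b∈)  = missings-within ms b∈

  dominates-missings : ∀ m {R} → Ordering Mem R → ∀ C {s t K} (u : Unique (C ++ s ∷ t ∷ K)) →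
    length (C ++ s ∷ t ∷ K) ≡ suc k → length K ≡ 3 + m → Good R (Within (C ++ s ∷ t ∷ K)) s t K
  dominates-missings m ord C {s} {t} {K} u len lenK
    with record { pairs = _ ∷ _ ∷ ps ; covers = refl ; allMiss = all } ← missings C (s ∷ t ∷ K) u len =
    weakenGood (missings-within C _ u len all) ↭-refl
      (spread Mem m ord (trans (sym (length-map proj₁ ps)) lenK) (missings-family C _ u len refl all))

  dominates-base : ∀ m → k ≡ 4 + m → Dominates (suc k)
  dominates-base m refl ord {x} {y} {L} u len =
    dominates-missings m ord [] u len (suc-injective (suc-injective len))

  -- When k = 4 the arc on s, t, p, q itself is available as well.
  dominates⁺-base : ∀ m → k ≡ 4 + m → Dominates⁺ k
  dominates⁺-base zero refl {R} ord {z} {s} {t} {p ∷ q ∷ []} u refl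
    with record { pairs = (_ , as) ∷ (_ , at) ∷ (_ , ap) ∷ (_ , aq) ∷ [] ; covers = refl ; allMiss = ms ∷ mt ∷ mp ∷ mq ∷ [] }
         ← missings (z ∷ []) (s ∷ t ∷ p ∷ q ∷ []) u refl
    with f , arc , on , off ← arcOn (s ∷ t ∷ p ∷ q ∷ []) (AllPairs.tail u) refl =
    weakenGood within ↭-refl (four Mem ord family′ (arc , on (there (there (there (here refl))))))
    where
    F = missings-family (z ∷ []) _ u refl refl (ms ∷ mt ∷ mp ∷ mq ∷ [])
    open Family
    z∉f : ¬ f ∋ z
    z∉f = head∉ u ∘ off
    apart : ∀ {i a} → Missing (z ∷ []) (s ∷ t ∷ p ∷ q ∷ []) u refl (i , a) → a ≢ f
    apart m refl = z∉f (Missing.hitsC m (here refl))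
    family′ : Family Mem ((s , as) ∷ (t , at) ∷ (p , ap) ∷ (q , f) ∷ [])
    family′ with (a ∷ b ∷ _) ∷ (c ∷ _) ∷ _ ← uniqueA F = record
      { uniqueV = AllPairs.tail u
      ; uniqueA = (a ∷ b ∷ apart ms ∷ []) ∷ (c ∷ apart mt ∷ []) ∷ (apart mp ∷ []) ∷ [] ∷ []
      ; near = λ where
          (here refl)                 → near F (here refl)
          (there (here refl))         → near F (there (here refl))
          (there (there (here refl))) → near F (there (there (here refl)))
          (there (there (there (here refl)))) u∈ _ → arc , on u∈ }
    within : ∀ {b} → b ∈ as ∷ at ∷ ap ∷ f ∷ [] → Within (z ∷ s ∷ t ∷ p ∷ q ∷ []) b
    within (here refl)                         = Missing.arc ms , Missing.stays ms
    within (there (here refl))                 = Missing.arc mt , Missing.stays mt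
    within (there (there (here refl)))         = Missing.arc mp , Missing.stays mp
    within (there (there (there (here refl)))) = arc , there ∘ off
  dominates⁺-base (suc m) refl ord {z} u len =
    dominates-missings m ord (z ∷ []) u (cong suc len) (suc-injective (suc-injective len))

  dominates-from : ∀ {b} → 2 ≤ k → k ≤ b → 3 ≤ b → Dominates b → Dominates (suc b) → ∀ i → Dominates (i + b)
  dominates-from {b} 2≤k k≤b 3≤b D D′ zero          = D
  dominates-from {b} 2≤k k≤b 3≤b D D′ (suc zero)    = D′
  dominates-from {b} 2≤k k≤b 3≤b D D′ (suc (suc i)) =
    dominates-step 2≤k (≤-trans k≤b (m≤n+m b (suc i))) (≤-trans 3≤b (m≤n+m b i))
      (dominates-from 2≤k k≤b 3≤b D D′ (suc i)) (dominates⇒⁺ (dominates-from 2≤k k≤b 3≤b D D′ i))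

  dominates≥4 : ∀ m → k ≡ 4 + m → ∀ i → Dominates (i + suc k)
  dominates≥4 m refl = dominates-from (s≤s (s≤s z≤n)) (n≤1+n _) (s≤s (s≤s (s≤s z≤n))) D
    (dominates-step (s≤s (s≤s z≤n)) (n≤1+n _) (s≤s (s≤s (s≤s z≤n))) D (dominates⁺-base m refl))
    where D = dominates-base m refl

  -- Arcs on explicit index sets, and the induction for k = 3

  module _ (v₀ : V) (vs : List V) (uvs : Unique vs) where

    Exact : List ℕ → A → Set
    Exact js a = IsArc a × (∀ {i} → i ∈ js → a ∋ at v₀ vs i) × (∀ {v} → a ∋ v → v ∈ map (at v₀ vs) js)

    indicesᵇ : List ℕ → Bool
    indicesᵇ js = uniqueᵇ js ∧ (allᵇ (_<ᵇ length vs) js ∧ (length js ≡ᵇ k))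

    -- Equal arcs would have equal vertex sets, so refuting one inclusion for each pair of index
    -- lists is enough to tell the arcs apart.
    separatedᵇ : List (List ℕ) → Bool
    separatedᵇ []         = true
    separatedᵇ (js ∷ jss) = allᵇ (λ ks → not (allᵇ (λ i → memᵇ i ks) js)) jss ∧ separatedᵇ jss

    realise : ∀ jss → allᵇ indicesᵇ jss ≡ true → Σ[ as ∈ List A ] Pointwise Exact jss as
    realise []         eq = [] , []
    realise (js ∷ jss) eq
      with p , q ← ∧-split (indicesᵇ js) eq
      with u , p′ ← ∧-split (uniqueᵇ js) p
      with b , l ← ∧-split (allᵇ (_<ᵇ length vs) js) p′
      with a , arc , on , off ← arcOn (map (at v₀ vs) js) (at-unique v₀ uvs js u (all-sound _ js b))
                                  (trans (length-map (at v₀ vs) js) (≡ᵇ-sound (length js) k l))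
      with as , es ← realise jss q = a ∷ as , (arc , (λ i∈ → on (∈-map⁺ (at v₀ vs) i∈)) , off) ∷ es

    below : ∀ {js i} → indicesᵇ js ≡ true → i ∈ js → i < length vs
    below {js} {i} p i∈ with _ , p′ ← ∧-split (uniqueᵇ js) p
      with b , _ ← ∧-split (allᵇ (_<ᵇ length vs) js) p′ = <ᵇ-sound i _ (All.lookup (all-sound _ js b) i∈)

    exact-unique : ∀ {jss as} → allᵇ indicesᵇ jss ≡ true → separatedᵇ jss ≡ true → Pointwise Exact jss as → Unique as
    exact-unique {[]} _ _ [] = []
    exact-unique {js ∷ jss} {a ∷ as} ix sep ((_ , on , _) ∷ es)
      with i , ix′ ← ∧-split (indicesᵇ js) ix
      with s , sep′ ← ∧-split (allᵇ (λ ks → not (allᵇ (λ i → memᵇ i ks) js)) jss) sep =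
      fresh ix′ (all-sound _ jss s) es ∷ exact-unique ix′ sep′ es
      where
      contained : ∀ {ks} → indicesᵇ ks ≡ true → Exact ks a → ∀ {is} → (∀ {i} → i ∈ is → i ∈ js) →
                  allᵇ (λ i → memᵇ i ks) is ≡ true
      contained k (_ , _ , off) {[]}     sub = refl
      contained {ks} k e@(_ , _ , off) {j ∷ is} sub with ∈-map⁻ (at v₀ vs) (off (on (sub (here refl))))
      ... | l , l∈ , eq with refl ← at-injective v₀ uvs j l (below i (sub (here refl))) (below k l∈) eq
        rewrite memᵇ-complete l∈ = contained k e (sub ∘ there)
      fresh : ∀ {jss as} → allᵇ indicesᵇ jss ≡ true →
              All (λ ks → not (allᵇ (λ i → memᵇ i ks) js) ≡ true) jss → Pointwise Exact jss as → All (a ≢_) as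
      fresh _ [] [] = []
      fresh {ks ∷ _} ix (n ∷ ns) (e ∷ es) with k , ix′ ← ∧-split (indicesᵇ ks) ix =
        (λ { refl → absurd (trans (sym (cong not (contained k e id))) n) }) ∷ fresh ix′ ns es
        where
        absurd : ∀ {B : Set} → false ≡ true → B
        absurd ()

  exact-within : ∀ v₀ vs uvs {jss as} → allᵇ (indicesᵇ v₀ vs uvs) jss ≡ true → Pointwise (Exact v₀ vs uvs) jss as →
                 ∀ {b} → b ∈ as → Within vs b
  exact-within v₀ vs uvs {js ∷ jss} ix ((arc , on , off) ∷ es) b∈
    with i , ix′ ← ∧-split (indicesᵇ v₀ vs uvs js) ix | b∈
  ... | here refl = arc , stays ∘ off
    where
    stays : ∀ {v} → v ∈ map (at v₀ vs) js → v ∈ vs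
    stays v∈ with j , j∈ , refl ← ∈-map⁻ (at v₀ vs) v∈ = at-∈ v₀ vs j (below v₀ vs uvs i j∈)
  ... | there b∈′ = exact-within v₀ vs uvs ix′ es b∈′

  sort₃ : ∀ {R} → Ordering Mem R → ∀ {a p q r} → Mem a p → Mem a q → Mem a r → Unique (p ∷ q ∷ r ∷ []) →
          Σ[ p′ ∈ V ] Σ[ q′ ∈ V ] Σ[ r′ ∈ V ] (p ∷ q ∷ r ∷ [] ↭ p′ ∷ q′ ∷ r′ ∷ [] × R a p′ q′ × R a q′ r′)
  sort₃ {R} ord {a} {p} {q} {r} ap aq ar ((p≢q ∷ p≢r ∷ []) ∷ (q≢r ∷ []) ∷ _)
    with Ordering.total ord ap aq p≢q | Ordering.total ord aq ar q≢r | Ordering.total ord ap ar p≢r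
  ... | inj₁ p<q | inj₁ q<r | _        = p , q , r , ↭-refl , p<q , q<r
  ... | inj₁ p<q | inj₂ r<q | inj₁ p<r = p , r , q , reorder-↭ (0 ∷ 1 ∷ []) _ , p<r , r<q
  ... | inj₁ p<q | inj₂ r<q | inj₂ r<p = r , p , q , reorder-↭ (2 ∷ []) _ , r<p , p<q
  ... | inj₂ q<p | inj₁ q<r | inj₁ p<r = q , p , r , reorder-↭ (1 ∷ []) _ , q<p , p<r
  ... | inj₂ q<p | inj₁ q<r | inj₂ r<p = q , r , p , reorder-↭ (1 ∷ 1 ∷ []) _ , q<r , r<p
  ... | inj₂ q<p | inj₂ r<q | _        = r , q , p , reorder-↭ (2 ∷ 1 ∷ []) _ , r<q , q<p

  dominates₃-5 : k ≡ 3 → Dominates 5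
  dominates₃-5 refl ord {x} {y} {p ∷ q ∷ r ∷ []} u@(_ ∷ _ ∷ uL) refl
    with a , arc , on , off ← arcOn (p ∷ q ∷ r ∷ []) uL refl
    -- Only x and y are special in the claim, so the other three vertices may be listed in the order
    -- of their own arc.
    with p′ , q′ , r′ , perm , p<q , q<r ← sort₃ ord (arc , on (here refl)) (arc , on (there (here refl)))
           (arc , on (there (there (here refl)))) uL
    with u′ ← Unique-resp-↭ (prep x (prep y perm)) u
    with as , es ← realise x (x ∷ y ∷ p′ ∷ q′ ∷ r′ ∷ []) u′ triples₉ refl =
    weakenGood (within-⊆ (∈-resp-↭ (↭-sym (prep x (prep y perm)))) ∘ exact-within x _ u′ refl exact) (↭-sym perm)
      (goodFamily ord 5 triples refl u′ (Pointwise.Pointwise-length (Pointwise.symmetric (λ _ → tt) exact))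
        (exact-unique x _ u′ refl refl exact) (Pointwise.map incidence exact) fiveCert (p<q ∷ q<r ∷ []))
    where
    exact : Pointwise (Exact x (x ∷ y ∷ p′ ∷ q′ ∷ r′ ∷ []) u′) triples (a ∷ as)
    exact = (arc , (λ { (here refl) → on (∈-resp-↭ (↭-sym perm) (here refl))
                      ; (there (here refl)) → on (∈-resp-↭ (↭-sym perm) (there (here refl)))
                      ; (there (there (here refl))) → on (∈-resp-↭ (↭-sym perm) (there (there (here refl)))) })
            , ∈-resp-↭ perm ∘ off) ∷ es
    incidence : ∀ {js b} → Exact x (x ∷ y ∷ p′ ∷ q′ ∷ r′ ∷ []) u′ js b →
                All (λ i → Mem b (at x (x ∷ y ∷ p′ ∷ q′ ∷ r′ ∷ []) i)) js
    incidence (arc , on , _) = All.tabulate (λ i∈ → arc , on i∈)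

  dominates⁺₃-4 : k ≡ 3 → Dominates⁺ 4
  dominates⁺₃-4 refl ord {z} {s} {t} {p ∷ q ∷ []} u refl
    -- z is moved to position 4, so that cutting the triples down to indices below 4 drops precisely
    -- z.
    with u′ ← Unique-resp-↭ (reorder-↭ (1 ∷ 1 ∷ 1 ∷ 1 ∷ []) (z ∷ s ∷ t ∷ p ∷ q ∷ [])) u
    with as@(_ ∷ _) , es ← realise s (s ∷ t ∷ p ∷ q ∷ z ∷ []) u′ triples refl =
    weakenGood (within-⊆ (∈-resp-↭ (↭-sym (reorder-↭ (1 ∷ 1 ∷ 1 ∷ 1 ∷ []) _))) ∘ exact-within s _ u′ refl es) ↭-refl
      (goodFamily ord 4 (map below4 triples) refl (AllPairs.tail u)
        (Pointwise.Pointwise-length (Pointwise.symmetric (λ _ → tt) es))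
        (exact-unique s _ u′ refl refl es) (incidences es) linkCert [])
    where
    below4-All : ∀ {P : ℕ → Set} js → (∀ {i} → i ∈ js → i < 4 → P i) → All P (below4 js)
    below4-All []       h = []
    below4-All (j ∷ js) h with j <ᵇ 4 in eq
    ... | true  = h (here refl) (<ᵇ-sound j 4 eq) ∷ below4-All js (h ∘ there)
    ... | false = below4-All js (h ∘ there)
    same : ∀ i → i < 4 → at s (s ∷ t ∷ p ∷ q ∷ z ∷ []) i ≡ at s (s ∷ t ∷ p ∷ q ∷ []) i
    same 0 _ = refl
    same 1 _ = refl
    same 2 _ = refl
    same 3 _ = refl
    same (suc (suc (suc (suc _)))) (s≤s (s≤s (s≤s (s≤s ()))))
    incidences : ∀ {jss as} → Pointwise (Exact s (s ∷ t ∷ p ∷ q ∷ z ∷ []) u′) jss as →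
                 Pointwise (λ js b → All (λ i → Mem b (at s (s ∷ t ∷ p ∷ q ∷ []) i)) js) (map below4 jss) as
    incidences []                    = []
    incidences {js ∷ _} ((arc , on , _) ∷ es) =
      below4-All js (λ {i} i∈ i<4 → arc , subst (_ ∋_) (same i i<4) (on i∈)) ∷ incidences es

  dominates₃ : k ≡ 3 → ∀ i → Dominates (i + 5)
  dominates₃ refl = dominates-from (s≤s (s≤s z≤n)) (s≤s (s≤s (s≤s z≤n))) (s≤s (s≤s (s≤s z≤n))) (dominates₃-5 refl)
    (dominates-step (s≤s (s≤s z≤n)) (s≤s (s≤s (s≤s z≤n))) (s≤s (s≤s (s≤s z≤n))) (dominates₃-5 refl) (dominates⁺₃-4 refl))

  -- Tournaments: k = 2

  Edge : (A → V → V → Set) → ⊤ → V → V → Set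
  Edge R _ u v = Σ[ a ∈ A ] (IsArc a × a ∋ u × a ∋ v × (∀ {w} → a ∋ w → w ∈ u ∷ v ∷ []) × R a u v)

  edge-total : k ≡ 2 → ∀ {R} → Ordering Mem R → ∀ {u v} → u ≢ v → Edge R tt u v ⊎ Edge R tt v u
  edge-total refl ord {u} {v} u≢v
    with a , arc , on , off ← arcOn (u ∷ v ∷ []) ((u≢v ∷ []) ∷ [] ∷ []) refl
    with Ordering.total ord (arc , on (here refl)) (arc , on (there (here refl))) u≢v
  ... | inj₁ u<v = inj₁ (a , arc , on (here refl) , on (there (here refl)) , off , u<v)
  ... | inj₂ v<u = inj₂ (a , arc , on (there (here refl)) , on (here refl) , ∈-resp-↭ (swap u v ↭-refl) ∘ off , v<u)

  -- Edges hide their arcs behind the index `tt`, and distinctness of the arcs is recovered here: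
  -- the first arc contains x, while all later ones lie within the vertices after x.
  lift : ∀ t {R x} ps → Unique (x ∷ map proj₂ ps) → Alternates (orient t (Edge R)) x ps →
         Reach (orient t R) (Within (x ∷ map proj₂ ps)) x (map proj₂ ps)
  lift t     []             u alt = reach [] ↭-refl [] [] tt
  lift true  {R} {x} ((_ , w) ∷ ps) uq@(_ ∷ u) ((a , arc , ax , aw , off , r) , alt) =
    extend (arc , λ i → pair (off i)) r (λ q → within-⊆ there q , λ { refl → head∉ uq (proj₂ q ax) }) ↭-refl (lift false ps u alt)
    where
    pair : ∀ {v} → v ∈ x ∷ w ∷ [] → v ∈ x ∷ w ∷ map proj₂ ps
    pair (here e)         = here e
    pair (there (here e)) = there (here e)
  lift false {R} {x} ((_ , w) ∷ ps) uq@(_ ∷ u) ((a , arc , aw , ax , off , r) , alt) =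
    extend (arc , λ i → pair (off i)) r (λ q → within-⊆ there q , λ { refl → head∉ uq (proj₂ q ax) }) ↭-refl (lift true ps u alt)
    where
    pair : ∀ {v} → v ∈ w ∷ x ∷ [] → v ∈ x ∷ w ∷ map proj₂ ps
    pair (here e)         = there (here e)
    pair (there (here e)) = here e

  record Zig (R : A → V → V → Set) (t : Bool) (U : List V) : Set where
    constructor zig
    field
      first      : V
      steps      : List (⊤ × V)
      visits     : first ∷ map proj₂ steps ↭ U
      alternates : Alternates (orient t (Edge R)) first steps

  zigzag-known : ∀ {R} f t i x ps → Follows f i (x ∷ map proj₂ ps) → Alternates (orient t (Edge R)) x ps →
                 All (λ e → Edge R tt (f (proj₁ (proj₂ e))) (f (proj₂ (proj₂ e)))) (zigzag t i (length ps))
  zigzag-known f t     i x []             _                    _         = []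
  zigzag-known f true  i x ((_ , w) ∷ ps) (refl , fol@(refl , _)) (r , alt) = r ∷ zigzag-known f false (suc i) w ps fol alt
  zigzag-known f false i x ((_ , w) ∷ ps) (refl , fol@(refl , _)) (r , alt) = r ∷ zigzag-known f true (suc i) w ps fol alt

  EdgeLit : (A → V → V → Set) → V → List V → Lit → Set
  EdgeLit R v₀ vs (_ , u , v) = Edge R tt (at v₀ vs u) (at v₀ vs v)

  Exception : (A → V → V → Set) → List (ℕ × ℕ) → List V → Set
  Exception R L vs = Σ[ v₀ ∈ V ] Σ[ zs ∈ List V ] (zs ↭ vs × All (λ e → Edge R tt (at v₀ zs (proj₁ e)) (at v₀ zs (proj₂ e))) L)

  Start : (A → V → V → Set) → (Bool → ℕ → Bool) → V → List V → Set
  Start R st v₀ vs = Σ[ t ∈ Bool ] Σ[ i ∈ ℕ ] (st t i ≡ true ×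
    Σ[ ps ∈ List (⊤ × V) ] (at v₀ vs i ∷ map proj₂ ps ↭ vs × Alternates (orient t (Edge R)) (at v₀ vs i) ps))

  solve : k ≡ 2 → ∀ {R} → Ordering Mem R → ∀ {m st ex L} v₀ vs → length vs ≡ m → Unique vs → ∀ {K} →
          Certificate (tourney m st ex L) K → All (EdgeLit R v₀ vs) K →
          Start R st v₀ vs ⊎ (ex ≡ true × Exception R L vs)
  solve k≡2 {R} ord {m} {st} {ex} {L} v₀ vs size uvs (certify tree ok) known = Sum.map toStart toException (found tree _ ok known)
    where
    open Problem (tourney m st ex L) using (Model)
    model : Model (λ _ _ → ⊤) (Edge R)
    model = record { total = λ _ _ → edge-total k≡2 ord ; transits = inj₁ refl }
    open Model model
    open Run v₀ vs tt (tt ∷ []) size uvs refl (All.tabulate (λ _ → tt) ∷ [])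
    toStart : Found → Start R st v₀ vs
    toStart record { source = s ; first = i ; starts = eq ; steps = is ; visits = v ; alternates = alt } =
      s , i , eq , map place is , v , alt
    toException : Exceptional → ex ≡ true × Exception R L vs
    toException (π , eq , perm , edges) = eq , at v₀ vs 0 , map vertex π , map-vertex perm , go L edges
      where
      go : ∀ L → All β (map (λ e → 0 , at 0 π (proj₁ e) , at 0 π (proj₂ e)) L) →
           All (λ e → Edge R tt (at (vertex 0) (map vertex π) (proj₁ e)) (at (vertex 0) (map vertex π) (proj₂ e))) L
      go []            []       = []
      go ((u , v) ∷ L) (e ∷ es) =
        subst₂ (Edge R tt) (sym (at-map vertex 0 π u)) (sym (at-map vertex 0 π v)) e ∷ go L es

  -- A known path on `U` fills the positions behind `pre`, where `zigzag` expects it; `pre` and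
  -- `post` hold the vertices to be inserted, and `K` whatever is known about `pre`.
  solveAfter : k ≡ 2 → ∀ {R} → Ordering Mem R → ∀ {m st ex L n t U} v₀ pre post → (z : Zig R t U) →
    length (pre ++ U ++ post) ≡ m → Unique (pre ++ U ++ post) → length U ≡ suc n → ∀ K →
    Certificate (tourney m st ex L) (K ++ zigzag t (length pre) n) →
    (∀ vs → All (EdgeLit R v₀ (pre ++ vs)) K) →
    let vs = pre ++ (Zig.first z ∷ map proj₂ (Zig.steps z)) ++ post in
    vs ↭ pre ++ U ++ post × (Start R st v₀ vs ⊎ (ex ≡ true × Exception R L vs))
  solveAfter k≡2 {R} ord {n = n} {t} {U} v₀ pre post (zig x ps vis alt) len u lenU K cert known =
    perm , solve k≡2 ord v₀ _ (trans (↭-length perm) len) (Unique-resp-↭ (↭-sym perm) u) cert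
      (Allₚ.++⁺ (known _) (subst (λ l → All _ (zigzag t (length pre) l)) lenps
        (All.map id (zigzag-known (at v₀ (pre ++ (x ∷ map proj₂ ps) ++ post)) t (length pre) x ps (follows-at v₀ pre _ post) alt))))
    where
    perm : pre ++ (x ∷ map proj₂ ps) ++ post ↭ pre ++ U ++ post
    perm = ++⁺ˡ pre (++⁺ʳ post vis)
    lenps : length ps ≡ n
    lenps = suc-injective (trans (cong suc (sym (length-map proj₂ ps))) (trans (↭-length vis) lenU))

  -- In the abstract setting an arc has no entries to compare with `ws`. Its vertex set and the
  -- order of consecutive vertices take their place, and for vectors these determine it.
  record Realised (R : A → V → V → Set) (ws : List V) : Set where
    constructor realised
    field
      {arc}  : A
      isArc  : IsArc arc
      on     : ∀ {v} → v ∈ ws → arc ∋ v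
      off    : ∀ {v} → arc ∋ v → v ∈ ws
      sorted : Linked (R arc) ws

  -- A copy of the exceptional arc set L, the vertex i being placed at zs i.
  Copy : (A → V → V → Set) → List (List ℕ) → List V → Set
  Copy R L U = Σ[ v₀ ∈ V ] Σ[ zs ∈ List V ] (zs ↭ U × All (λ l → Realised R (map (at v₀ zs) l)) L)

  recopy : ∀ {R L U U′} → U ↭ U′ → Copy R L U → Copy R L U′
  recopy p (v₀ , zs , q , c) = v₀ , zs , ↭-trans q p , c

  fromException : ∀ {R U} L → Exception R L U → Copy R (asLists L) U
  fromException L (v₀ , zs , perm , es) = v₀ , zs , perm , Allₚ.map⁺ (All.map toRealised es)
    where
    toRealised : ∀ {R u v} → Edge R tt u v → Realised R (u ∷ v ∷ [])
    toRealised (a , arc , au , av , off , r) = realised arc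
      (λ { (here refl) → au ; (there (here refl)) → av }) off (r ∷ [-])

  Covered : (A → V → V → Set) → List V → Set
  Covered R U = Σ[ t ∈ Bool ] Σ[ x ∈ V ] Σ[ W ∈ List V ] (x ∷ W ↭ U × Reach (orient t R) (Within U) x W)

  zig⇒covered : ∀ {t R U} → Unique U → Zig R t U → Covered R U
  zig⇒covered {t} u (zig x ps vis alt) = t , x , map proj₂ ps , vis ,
    weaken (within-⊆ (∈-resp-↭ vis)) ↭-refl (lift t ps (Unique-resp-↭ (↭-sym vis) u) alt)

  good⇒covered : ∀ {R x y L} → Good R (Within (x ∷ y ∷ L)) x y L → Covered R (x ∷ y ∷ L)
  good⇒covered {x = x} {y} (inj₁ g) = true , x , _ , ↭-refl , g
  good⇒covered {x = x} {y} (inj₂ g) = true , y , _ , swap y x ↭-refl , g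

  dominates⇒covered : ∀ {R u} → Ordering Mem R → Dominates u → 2 ≤ u → ∀ {U} → Unique U → length U ≡ u → Covered R U
  dominates⇒covered ord D _ {x ∷ y ∷ L} u len = good⇒covered (D ord u len)
  dominates⇒covered ord D () {[]} u refl
  dominates⇒covered ord D (s≤s ()) {_ ∷ []} u refl

  module _ (k≡2 : k ≡ 2) {R : A → V → V → Set} (ord : Ordering Mem R) where

    AnyZig : List V → Set
    AnyZig U = Σ[ t ∈ Bool ] Zig R t U

    sourceZig : ∀ {v₀ vs L U} → vs ↭ U × (Start R fromSource v₀ vs ⊎ (false ≡ true × Exception R L vs)) → Zig R true U
    sourceZig (perm , inj₁ (true , i , _ , ps , vis , alt)) = zig _ ps (↭-trans vis perm) alt
    sourceZig (perm , inj₂ (() , _))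

    anyZig : ∀ {v₀ vs ex L U} → vs ↭ U × (Start R anywhere v₀ vs ⊎ (ex ≡ true × Exception R L vs)) →
             AnyZig U ⊎ (ex ≡ true × Copy R (asLists L) U)
    anyZig {L = L} (perm , o) = Sum.map
      (λ { (t , i , _ , ps , vis , alt) → t , zig _ ps (↭-trans vis perm) alt })
      (λ { (eq , e) → eq , recopy {R} perm (fromException {R} L e) }) o

    zig4 : ∀ {U} → Unique U → length U ≡ 4 → Zig R true U
    zig4 {a ∷ b ∷ c ∷ d ∷ []} u refl = sourceZig (↭-refl , solve k≡2 ord {L = []} a _ refl u cert₄ [])

    zig3 : ∀ {U} → Unique U → length U ≡ 3 → AnyZig U ⊎ (true ≡ true × Copy R (asLists T3) U)
    zig3 {a ∷ b ∷ c ∷ []} u refl = anyZig (↭-refl , solve k≡2 ord {L = T3} a _ refl u cert₃ [])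

    addTwo : ∀ {m n U a b} → length (U ++ a ∷ b ∷ []) ≡ m → length U ≡ suc n →
             Certificate (tourney m fromSource false []) (zigzag true 0 n) →
             Unique (U ++ a ∷ b ∷ []) → Zig R true U → Zig R true (U ++ a ∷ b ∷ [])
    addTwo {a = a} {b} len lenU cert u z = sourceZig (solveAfter k≡2 ord a [] (a ∷ b ∷ []) z len u lenU [] cert (λ _ → []))

    addOne : ∀ {m n ex L U a} → length (U ++ a ∷ []) ≡ m → length U ≡ suc n →
             Certificate (tourney m anywhere ex L) (zigzag true 0 n) →
             Unique (U ++ a ∷ []) → Zig R true U →
             AnyZig (U ++ a ∷ []) ⊎ (ex ≡ true × Copy R (asLists L) (U ++ a ∷ []))
    addOne {a = a} len lenU cert u z = anyZig (solveAfter k≡2 ord a [] (a ∷ []) z len u lenU [] cert (λ _ → []))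

    zig6 : ∀ {U} → Unique U → length U ≡ 6 → Zig R true U
    zig6 {a ∷ b ∷ c ∷ d ∷ e ∷ f ∷ []} u refl =
      addTwo {U = a ∷ b ∷ c ∷ d ∷ []} refl refl cert₆ u (zig4 (Uniqueₚ.take⁺ 4 u) refl)

    zig8 : ∀ {U} → Unique U → length U ≡ 8 → Zig R true U
    zig8 {a ∷ b ∷ c ∷ d ∷ e ∷ f ∷ g ∷ h ∷ []} u refl =
      addTwo {U = a ∷ b ∷ c ∷ d ∷ e ∷ f ∷ []} refl refl cert₈ u (zig6 (Uniqueₚ.take⁺ 6 u) refl)

    zig5 : ∀ {U} → Unique U → length U ≡ 5 → AnyZig U ⊎ (true ≡ true × Copy R (asLists T5) U)
    zig5 {a ∷ b ∷ c ∷ d ∷ e ∷ []} u refl =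
      addOne {L = T5} {U = a ∷ b ∷ c ∷ d ∷ []} refl refl cert₅ u (zig4 (Uniqueₚ.take⁺ 4 u) refl)

    zig7 : ∀ {U} → Unique U → length U ≡ 7 → AnyZig U ⊎ (true ≡ true × Copy R (asLists T7) U)
    zig7 {a ∷ b ∷ c ∷ d ∷ e ∷ f ∷ g ∷ []} u refl =
      addOne {L = T7} {U = a ∷ b ∷ c ∷ d ∷ e ∷ f ∷ []} refl refl cert₇ u (zig6 (Uniqueₚ.take⁺ 6 u) refl)

    zig9 : ∀ {U} → Unique U → length U ≡ 9 → AnyZig U
    zig9 {a ∷ b ∷ c ∷ d ∷ e ∷ f ∷ g ∷ h ∷ i ∷ []} u refl = [ id , (λ { (() , _) }) ]
      (addOne {L = []} {U = a ∷ b ∷ c ∷ d ∷ e ∷ f ∷ g ∷ h ∷ []} refl refl cert₉ u (zig8 (Uniqueₚ.take⁺ 8 u) refl))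

    startPair : ∀ {x y W U} → Unique U → x ∷ y ∷ W ↭ U ×
                (Start R fromPair x (x ∷ y ∷ W) ⊎ (false ≡ true × Exception R [] (x ∷ y ∷ W))) →
                ∀ {L} → U ≡ x ∷ y ∷ L → Good R (Within (x ∷ y ∷ L)) x y L
    startPair u (perm , inj₁ (true , zero , _ , ps , vis , alt)) refl =
      inj₁ (weaken (within-⊆ (∈-resp-↭ vis′)) (drop-∷ vis′) (lift true ps (Unique-resp-↭ (↭-sym vis′) u) alt))
      where vis′ = ↭-trans vis perm
    startPair {x} {y} u (perm , inj₁ (true , suc zero , _ , ps , vis , alt)) refl =
      inj₂ (weaken (within-⊆ (∈-resp-↭ vis′)) (drop-∷ (↭-trans vis′ (swap x y ↭-refl)))
        (lift true ps (Unique-resp-↭ (↭-sym vis′) u) alt))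
      where vis′ = ↭-trans vis perm
    startPair u (perm , inj₂ (() , _)) eq

    -- The claim is symmetric in x and y, so the edge between them may be taken to run from x to y,
    -- as the certificates assume.
    byEdge : ∀ {x y L} → Unique (x ∷ y ∷ L) →
             (∀ {x y} → Unique (x ∷ y ∷ L) → Edge R tt x y → Good R (Within (x ∷ y ∷ L)) x y L) →
             Good R (Within (x ∷ y ∷ L)) x y L
    byEdge {x} {y} u@((x≢y ∷ _) ∷ _) h with edge-total k≡2 ord x≢y
    ... | inj₁ e = h u e
    ... | inj₂ e = swapGood {R = R} (weakenGood (within-⊆ (∈-resp-↭ (swap y x ↭-refl))) ↭-refl
                     (h (Unique-resp-↭ (swap x y ↭-refl) u) e))

    pairUnder : ∀ {m n t x y L} → 2 + length L ≡ m → length L ≡ suc n →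
                Certificate (tourney m fromPair false []) ((0 , 0 , 1) ∷ zigzag t 2 n) →
                Zig R t L → Unique (x ∷ y ∷ L) → Edge R tt x y → Good R (Within (x ∷ y ∷ L)) x y L
    pairUnder {x = x} {y} {L} len lenL cert z u e = startPair u
      (subst (λ U → _ ↭ x ∷ y ∷ U × _) (++-identityʳ L)
        (solveAfter k≡2 ord x (x ∷ y ∷ []) [] z (trans (cong (λ U → 2 + length U) (++-identityʳ L)) len)
          (subst (λ U → Unique (x ∷ y ∷ U)) (sym (++-identityʳ L)) u) lenL ((0 , 0 , 1) ∷ []) cert (λ _ → e ∷ []))) refl

  dominates₂-10 : k ≡ 2 → Dominates 10
  dominates₂-10 k≡2 ord u len = byEdge k≡2 ord u
    (pairUnder k≡2 ord len len′ pairCert₁₀ (zig8 k≡2 ord (AllPairs.tail (AllPairs.tail u)) len′))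
    where len′ = suc-injective (suc-injective len)

  dominates₂-11 : k ≡ 2 → Dominates 11
  dominates₂-11 k≡2 {R} ord {L = L} u len = byEdge k≡2 ord u (under (zig9 k≡2 ord (AllPairs.tail (AllPairs.tail u)) len′))
    where
    len′ = suc-injective (suc-injective len)
    under : AnyZig k≡2 ord L → ∀ {x y} → Unique (x ∷ y ∷ L) → Edge R tt x y → Good R (Within (x ∷ y ∷ L)) x y L
    under (true  , z) = pairUnder k≡2 ord len len′ pairCert₁₁⁺ z
    under (false , z) = pairUnder k≡2 ord len len′ pairCert₁₁⁻ z

  dominates₂ : k ≡ 2 → ∀ i → Dominates (i + 10)
  dominates₂ k≡2 = dominates-from (≤-reflexive (sym k≡2)) (≤-trans (≤-reflexive k≡2) (s≤s (s≤s z≤n)))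
    (s≤s (s≤s (s≤s z≤n))) (dominates₂-10 k≡2) (dominates₂-11 k≡2)

  -- Four vertices with k = 3, and the classification

  module _ {R : A → V → V → Set} (ord : Ordering Mem R) where

    sorted₄ : k ≡ 3 → ∀ {a u p q r} → Unique (u ∷ p ∷ q ∷ r ∷ []) → IsArc a →
      (∀ {v} → v ∈ p ∷ q ∷ r ∷ [] → a ∋ v) → (∀ {v} → a ∋ v → v ∈ p ∷ q ∷ r ∷ []) → R a p q → R a q r →
      Covered R (u ∷ p ∷ q ∷ r ∷ []) ⊎ Copy R H4list (u ∷ p ∷ q ∷ r ∷ [])
    sorted₄ refl {a} {u} {p} {q} {r} uq arc on off p<q q<r
      with a₁ , m₁ ← missing [] _ uq refl {p} (there (here refl))
      with a₂ , m₂ ← missing [] _ uq refl {q} (there (there (here refl)))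
      with a₃ , m₃ ← missing [] _ uq refl {r} (there (there (there (here refl)))) =
      Sum.map toCovered toCopy (solveFamily ord 4 quads refl uq refl (Family.uniqueA F)
        ( (near F (here refl) (there (here refl)) (n₁ ∘ sym)
           ∷ near F (here refl) (there (there (here refl))) (n₂ ∘ sym)
           ∷ near F (here refl) (there (there (there (here refl)))) (n₃ ∘ sym) ∷ [])
        ∷ (near F (there (here refl)) (here refl) n₁
           ∷ near F (there (here refl)) (there (there (here refl))) (n₄ ∘ sym)
           ∷ near F (there (here refl)) (there (there (there (here refl)))) (n₅ ∘ sym) ∷ [])
        ∷ (near F (there (there (here refl))) (here refl) n₂
           ∷ near F (there (there (here refl))) (there (here refl)) n₄
           ∷ near F (there (there (here refl))) (there (there (there (here refl)))) (n₆ ∘ sym) ∷ [])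
        ∷ (near F (there (there (there (here refl)))) (here refl) n₃
           ∷ near F (there (there (there (here refl)))) (there (here refl)) n₅
           ∷ near F (there (there (there (here refl)))) (there (there (here refl))) n₆ ∷ [])
        ∷ [])
        quadCert (p<q ∷ q<r ∷ []))
      where
      open Family
      vs = u ∷ p ∷ q ∷ r ∷ []
      as = a ∷ a₁ ∷ a₂ ∷ a₃ ∷ []
      Miss = Missing [] vs uq refl
      -- The arc already sorted is itself the one missing u; with it in place 0 the two known
      -- comparisons become the hypotheses of `quadCert`.
      m₀ : Miss (u , a)
      m₀ = record { arc = arc ; misses = head∉ uq ∘ off
                  ; hits = λ { (here refl) n → ⊥-elim (n refl) ; (there v∈) _ → on v∈ }
                  ; hitsC = λ () ; stays = there ∘ off }
      allM : All Miss ((u , a) ∷ (p , a₁) ∷ (q , a₂) ∷ (r , a₃) ∷ [])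
      allM = m₀ ∷ m₁ ∷ m₂ ∷ m₃ ∷ []
      F : Family Mem ((u , a) ∷ (p , a₁) ∷ (q , a₂) ∷ (r , a₃) ∷ [])
      F = missings-family [] vs uq refl refl allM
      dist : u ≢ p × u ≢ q × u ≢ r × p ≢ q × p ≢ r × q ≢ r
      dist = distinct₄ uq
      n₁ = proj₁ dist
      n₂ = proj₁ (proj₂ dist)
      n₃ = proj₁ (proj₂ (proj₂ dist))
      n₄ = proj₁ (proj₂ (proj₂ (proj₂ dist)))
      n₅ = proj₁ (proj₂ (proj₂ (proj₂ (proj₂ dist))))
      n₆ = proj₂ (proj₂ (proj₂ (proj₂ (proj₂ dist))))
      vertex : ℕ → V
      vertex = at u vs
      missAt : ∀ c → c < 4 → Miss (vertex c , at a as c)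
      missAt 0 _ = m₀
      missAt 1 _ = m₁
      missAt 2 _ = m₂
      missAt 3 _ = m₃
      missAt (suc (suc (suc (suc _)))) (s≤s (s≤s (s≤s (s≤s ()))))
      toCovered : _ → Covered R vs
      toCovered (t , i , W , _ , vis , r) = t , _ , W , vis , weaken (missings-within [] vs uq refl allM) ↭-refl r
      row : ∀ {m i j l} → m ∷ i ∷ j ∷ l ∷ [] ↭ upTo 4 → LitHolds R u vs a as (m , i , j) →
            LitHolds R u vs a as (m , j , l) → Realised R (vertex i ∷ vertex j ∷ vertex l ∷ [])
      row {m} {i} {j} {l} perm i<j j<l = realised (Missing.arc M) hit miss (i<j ∷ j<l ∷ [-])
        where
        M = missAt m (∈-upTo⁻ (∈-resp-↭ perm (here refl)))
        perm′ : vertex m ∷ vertex i ∷ vertex j ∷ vertex l ∷ [] ↭ vs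
        perm′ = map⁺ vertex perm
        uq′ = Unique-resp-↭ (↭-sym perm′) uq
        hit : ∀ {v} → v ∈ vertex i ∷ vertex j ∷ vertex l ∷ [] → at a as m ∋ v
        hit v∈ = Missing.hits M (∈-resp-↭ perm′ (there v∈)) (λ { refl → head∉ uq′ v∈ })
        miss : ∀ {v} → at a as m ∋ v → v ∈ vertex i ∷ vertex j ∷ vertex l ∷ []
        miss av with ∈-resp-↭ (↭-sym perm′) (Missing.stays M av)
        ... | here refl = ⊥-elim (Missing.misses M av)
        ... | there v∈  = v∈
      toCopy : Σ[ π ∈ List ℕ ] (true ≡ true × π ↭ upTo 4 × All (LitHolds R u vs a as) (H4lits π)) → Copy R H4list vs
      toCopy (π , _ , perm , lits) = go π (↭-length perm) perm lits
        where
        go : ∀ π → length π ≡ 4 → π ↭ upTo 4 → All (LitHolds R u vs a as) (H4lits π) → Copy R H4list vs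
        go (π₀ ∷ π₁ ∷ π₂ ∷ π₃ ∷ []) refl perm (l₁ ∷ l₂ ∷ l₃ ∷ l₄ ∷ l₅ ∷ l₆ ∷ l₇ ∷ l₈ ∷ []) =
          u , map vertex (π₀ ∷ π₁ ∷ π₂ ∷ π₃ ∷ []) , map⁺ vertex perm ,
          row perm l₁ l₂
          ∷ row (↭-trans (↭-sym (reorder-↭ (2 ∷ 2 ∷ []) _)) perm) l₃ l₄
          ∷ row (↭-trans (↭-sym (reorder-↭ (1 ∷ 1 ∷ 1 ∷ []) _)) perm) l₅ l₆
          ∷ row (↭-trans (↭-sym (reorder-↭ (3 ∷ []) _)) perm) l₇ l₈
          ∷ []

    quad : k ≡ 3 → ∀ {U} → Unique U → length U ≡ 4 → Covered R U ⊎ Copy R H4list U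
    quad refl {u ∷ p ∷ q ∷ r ∷ []} uq@(_ ∷ uL) refl
      with a , arc , on , off ← arcOn (p ∷ q ∷ r ∷ []) uL refl
      with p′ , q′ , r′ , perm , p<q , q<r ← sort₃ ord (arc , on (here refl)) (arc , on (there (here refl)))
             (arc , on (there (there (here refl)))) uL =
      Sum.map recover (recopy {R} (prep u (↭-sym perm)))
        (sorted₄ refl (Unique-resp-↭ (prep u perm) uq) arc (on ∘ ∈-resp-↭ (↭-sym perm)) (∈-resp-↭ perm ∘ off) p<q q<r)
      where
      recover : Covered R (u ∷ p′ ∷ q′ ∷ r′ ∷ []) → Covered R (u ∷ p ∷ q ∷ r ∷ [])
      recover (t , x , W , vis , g) = t , x , W , ↭-trans vis (prep u (↭-sym perm)) ,
        weaken (within-⊆ (∈-resp-↭ (prep u (↭-sym perm)))) ↭-refl g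

    data Outcome (U : List V) : Set where
      covered : Covered R U → Outcome U
      isH4    : k ≡ 3 → length U ≡ 4 → Copy R H4list U → Outcome U
      isT3    : k ≡ 2 → length U ≡ 3 → Copy R (asLists T3) U → Outcome U
      isT5    : k ≡ 2 → length U ≡ 5 → Copy R (asLists T5) U → Outcome U
      isT7    : k ≡ 2 → length U ≡ 7 → Copy R (asLists T7) U → Outcome U

    fromDominates : ∀ {b} → (∀ i → Dominates (i + b)) → 2 ≤ b → ∀ {U} → Unique U → b ≤ length U → Outcome U
    fromDominates {b} D 2≤b {U} u b≤ = covered (dominates⇒covered ord (D (length U ∸ b)) (≤-trans 2≤b (m≤n+m b _)) u
      (sym (m∸n+n≡m b≤)))

    classify₂ : k ≡ 2 → ∀ {U} → Unique U → 3 ≤ length U → Outcome U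
    classify₂ k≡2 {U} u 3≤ with length U in len
    ... | 0 with () ← 3≤
    ... | 1 with s≤s () ← 3≤
    ... | 2 with s≤s (s≤s ()) ← 3≤
    ... | 3 = [ covered ∘ zig⇒covered u ∘ proj₂ , isT3 k≡2 len ∘ proj₂ ] (zig3 k≡2 ord u len)
    ... | 4 = covered (zig⇒covered u (zig4 k≡2 ord u len))
    ... | 5 = [ covered ∘ zig⇒covered u ∘ proj₂ , isT5 k≡2 len ∘ proj₂ ] (zig5 k≡2 ord u len)
    ... | 6 = covered (zig⇒covered u (zig6 k≡2 ord u len))
    ... | 7 = [ covered ∘ zig⇒covered u ∘ proj₂ , isT7 k≡2 len ∘ proj₂ ] (zig7 k≡2 ord u len)
    ... | 8 = covered (zig⇒covered u (zig8 k≡2 ord u len))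
    ... | 9 = covered (zig⇒covered u (proj₂ (zig9 k≡2 ord u len)))
    ... | suc (suc (suc (suc (suc (suc (suc (suc (suc (suc n))))))))) =
      fromDominates (dominates₂ k≡2) (s≤s (s≤s z≤n)) u (subst (10 ≤_) (sym len) (m≤m+n 10 n))

    classify₃ : k ≡ 3 → ∀ {U} → Unique U → 4 ≤ length U → Outcome U
    classify₃ k≡3 {U} u 4≤ with m≤n⇒m<n∨m≡n 4≤
    ... | inj₁ 5≤  = fromDominates (dominates₃ k≡3) (s≤s (s≤s z≤n)) u 5≤
    ... | inj₂ 4≡  = [ covered , isH4 k≡3 (sym 4≡) ] (quad k≡3 u (sym 4≡))

    classify : 2 ≤ k → ∀ {U} → Unique U → suc k ≤ length U → Outcome U
    classify 2≤k {U} u k< = go k refl 2≤k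
      where
      go : ∀ j → k ≡ j → 2 ≤ j → Outcome U
      go (suc zero)                   _  (s≤s ())
      go (suc (suc zero))             eq _ = classify₂ eq u (subst (λ j → suc j ≤ length U) eq k<)
      go (suc (suc (suc zero)))       eq _ = classify₃ eq u (subst (λ j → suc j ≤ length U) eq k<)
      go (suc (suc (suc (suc m))))    eq _ = fromDominates (dominates≥4 m eq) (s≤s (≤-trans (s≤s z≤n) 2≤k)) u k<

-- Passage from subsets and vectors to lists and abstract arcs

∈⇒at : ∀ {A : Set} d {xs : List A} {v} → v ∈ xs → Σ[ i ∈ ℕ ] (i < length xs × at d xs i ≡ v)
∈⇒at d (here refl) = 0 , s≤s z≤n , refl
∈⇒at d (there v∈) with i , i< , eq ← ∈⇒at d v∈ = suc i , s≤s i< , eq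

insert-size : ∀ {n} (S : Subset n) v → lookup S v ≡ outside → ∣ S [ v ]≔ inside ∣ ≡ suc ∣ S ∣
insert-size (outside ∷ S) zero    _  = refl
insert-size (outside ∷ S) (suc v) eq = insert-size S v eq
insert-size (inside  ∷ S) (suc v) eq = cong suc (insert-size S v eq)

subsetOf : ∀ {n} → List (Fin n) → Subset n
subsetOf []      = Subset.⊥
subsetOf (v ∷ K) = subsetOf K [ v ]≔ inside

subsetOf-⊆ : ∀ {n} (K : List (Fin n)) {v} → lookup (subsetOf K) v ≡ inside → v ∈ K
subsetOf-⊆ [] {v} eq with () ← trans (sym eq) (Vecₚ.lookup-replicate v outside)
subsetOf-⊆ (w ∷ K) {v} eq with v Fin.≟ w
... | yes v≡w = here v≡w
... | no  v≢w = there (subsetOf-⊆ K (trans (sym (Vecₚ.lookup∘update′ v≢w (subsetOf K) inside)) eq))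

subsetOf-⊇ : ∀ {n} (K : List (Fin n)) {v} → v ∈ K → lookup (subsetOf K) v ≡ inside
subsetOf-⊇ (w ∷ K) (here refl) = Vecₚ.lookup∘update w (subsetOf K) inside
subsetOf-⊇ (w ∷ K) {v} (there v∈) with v Fin.≟ w
... | yes refl = Vecₚ.lookup∘update w (subsetOf K) inside
... | no  v≢w  = trans (Vecₚ.lookup∘update′ v≢w (subsetOf K) inside) (subsetOf-⊇ K v∈)

subsetOf-size : ∀ {n} {K : List (Fin n)} → Unique K → ∣ subsetOf K ∣ ≡ length K
subsetOf-size {n} {[]} [] = Subsetₚ.∣⊥∣≡0 n
subsetOf-size {K = v ∷ K} uq@(_ ∷ u) = trans (insert-size (subsetOf K) v v-outside) (cong suc (subsetOf-size u))
  where
  v-outside : lookup (subsetOf K) v ≡ outside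
  v-outside with lookup (subsetOf K) v in eq
  ... | outside = refl
  ... | inside  = ⊥-elim (head∉ uq (subsetOf-⊆ K eq))

module Concrete {n k : ℕ} (H : Hypertournament n k) where

  arcOn : ∀ K → Unique K → length K ≡ k →
          Σ[ a ∈ Vec (Fin n) k ] (Arc H a × (∀ {v} → v ∈ K → v ∈ᵥ a) × (∀ {v} → v ∈ᵥ a → v ∈ K))
  arcOn K u len with a , arc , _ , same ← arc-exists H (subsetOf K) (trans (subsetOf-size u) len) =
    a , arc , (λ {v} v∈ → Equivalence.from (same v) (Vecₚ.lookup⇒[]= v _ (subsetOf-⊇ K v∈)))
      , (λ {v} v∈ → subsetOf-⊆ K (Vecₚ.[]=⇒lookup (Equivalence.to (same v) v∈)))

  -- `Arc H a` is built in because transitivity needs the entries of `a` to be distinct: the two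
  -- places of the middle vertex must coincide.
  R : Vec (Fin n) k → Fin n → Fin n → Set
  R a u v = Arc H a × Precedes a u v

  open Hyper (Arc H) (λ a v → v ∈ᵥ a) k arcOn public

  ordering : Ordering Mem R
  ordering = record
    { total = λ {a} {u} {v} (arc , u∈) (_ , v∈) u≢v →
        Sum.map (arc ,_) (arc ,_) (compare a u∈ v∈ u≢v)
    ; transitive = λ { a (arc , i , j , i<j , iu , jv) (_ , j′ , l , j′<l , j′v , lw) →
        arc , i , l , Finₚ.<-trans i<j (subst (Fin._< l) (arc-distinct H a arc j′ j (trans j′v (sym jv))) j′<l) , iu , lw } }
    where
    compare : ∀ a {u v} → u ∈ᵥ a → v ∈ᵥ a → u ≢ v → Precedes a u v ⊎ Precedes a v u
    compare a u∈ v∈ u≢v with Finₚ.<-cmp (VAny.index u∈) (VAny.index v∈)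
    ... | tri< i<j _ _ = inj₁ (_ , _ , i<j , sym (VAnyₚ.lookup-index u∈) , sym (VAnyₚ.lookup-index v∈))
    ... | tri> _ _ j<i = inj₂ (_ , _ , j<i , sym (VAnyₚ.lookup-index v∈) , sym (VAnyₚ.lookup-index u∈))
    ... | tri≈ _ i≡j _ = ⊥-elim (u≢v (trans (VAnyₚ.lookup-index u∈)
                           (trans (cong (lookup a) i≡j) (sym (VAnyₚ.lookup-index v∈)))))

  Anti : Vec (Fin n) k → Vec (Fin n) k → Fin n → Fin n → Fin n → Set
  Anti a b u v w = (Precedes a u v × Precedes b w v) ⊎ (Precedes a v u × Precedes b v w)

  module _ (a₀ : Vec (Fin n) k) (x₀ : Fin n) where

    incident : ∀ t x ps → Alternates (orient t R) x ps → ∀ i → i < length ps →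
               at x₀ (x ∷ map proj₂ ps) i ∈ᵥ at a₀ (map proj₁ ps) i × at x₀ (map proj₂ ps) i ∈ᵥ at a₀ (map proj₁ ps) i
    incident true  x ((a , w) ∷ ps) ((_ , i , j , _ , refl , refl) , _) zero _ = ∈-lookup i a , ∈-lookup j a
    incident false x ((a , w) ∷ ps) ((_ , i , j , _ , refl , refl) , _) zero _ = ∈-lookup j a , ∈-lookup i a
    incident true  x ((a , w) ∷ ps) (_ , alt) (suc i) (s≤s i<) = incident false w ps alt i i<
    incident false x ((a , w) ∷ ps) (_ , alt) (suc i) (s≤s i<) = incident true w ps alt i i<

    antidirected : ∀ t x ps → Alternates (orient t R) x ps → ∀ i → suc i < length ps →
      Anti (at a₀ (map proj₁ ps) i) (at a₀ (map proj₁ ps) (suc i))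
           (at x₀ (x ∷ map proj₂ ps) i) (at x₀ (map proj₂ ps) i) (at x₀ (map proj₂ ps) (suc i))
    antidirected true  x ((a , w) ∷ (b , v) ∷ ps) ((_ , p) , (_ , q) , _) zero _ = inj₁ (p , q)
    antidirected false x ((a , w) ∷ (b , v) ∷ ps) ((_ , p) , (_ , q) , _) zero _ = inj₂ (p , q)
    antidirected true  x ((a , w) ∷ ps) (_ , alt) (suc i) (s≤s i<) = antidirected false w ps alt i i<
    antidirected false x ((a , w) ∷ ps) (_ , alt) (suc i) (s≤s i<) = antidirected true w ps alt i i<
    antidirected true  x (_ ∷ []) _ zero (s≤s ())
    antidirected false x (_ ∷ []) _ zero (s≤s ())

  hamiltonian : 2 ≤ n → Covered R (allFin n) → HasAntidirectedHamiltonianPath H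
  hamiltonian 2≤n (t , x , W , perm , reach ps vis al dis alt) = n , record
    { two≤t = 2≤n
    ; x = at x xs
    ; a = at a₀ arcs
    ; x-inj = λ i j i<n j<n → at-injective x uxs i j (subst (i <_) (sym len) i<n) (subst (j <_) (sym len) j<n)
    ; a-inj = λ i j i<n j<n → at-injective a₀ dis i j (edge i i<n) (edge j j<n)
    ; a-arc = λ i i<n → proj₁ (All.lookup al (at-∈ a₀ arcs i (edge i i<n)))
    ; a-left = λ i i<n → proj₁ (incident a₀ x t x ps alt i (step i i<n))
    ; a-right = λ i i<n → proj₂ (incident a₀ x t x ps alt i (step i i<n))
    ; anti = λ i i<n → antidirected a₀ x t x ps alt i (step (suc i) i<n)
    } , λ v → let (i , i< , eq) = ∈⇒at x (∈-resp-↭ (↭-sym perm′) (∈-allFin v)) in i , subst (i <_) len i< , eq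
    where
    xs = x ∷ map proj₂ ps
    arcs = map proj₁ ps
    -- A filler that makes the arc sequence a total function; every index below the path length
    -- stays within `arcs`.
    a₀ = replicate k x
    perm′ : xs ↭ allFin n
    perm′ = ↭-trans (prep x vis) perm
    uxs : Unique xs
    uxs = Unique-resp-↭ (↭-sym perm′) (Uniqueₚ.allFin⁺ n)
    len : length xs ≡ n
    len = trans (↭-length perm′) (length-tabulate id)
    step : ∀ i → suc i < n → i < length ps
    step i i<n = ≤-pred (subst (suc i <_) (trans (sym len) (cong suc (length-map proj₂ ps))) i<n)
    edge : ∀ i → suc i < n → i < length arcs
    edge i i<n = subst (i <_) (sym (length-map proj₁ ps)) (step i i<n)

-- Exhaustive search in the exceptional hypertournaments

code : ∀ {m k} → Vec (Fin m) k → List ℕ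
code t = map toℕ (toList t)

toList-injective : ∀ {A : Set} {k} (s t : Vec A k) → toList s ≡ toList t → s ≡ t
toList-injective []      []      _  = refl
toList-injective (x ∷ s) (y ∷ t) eq with refl , eq′ ← ∷-injective eq = cong (x ∷_) (toList-injective s t eq′)

code-injective : ∀ {m k} (s t : Vec (Fin m) k) → code s ≡ code t → s ≡ t
code-injective s t eq = toList-injective s t (map-injective Finₚ.toℕ-injective eq)

vec-map-injective : ∀ {A B : Set} {k} {f : A → B} → (∀ {x y} → f x ≡ f y → x ≡ y) →
                    ∀ (s t : Vec A k) → Vec.map f s ≡ Vec.map f t → s ≡ t
vec-map-injective inj []      []      _  = refl
vec-map-injective inj (x ∷ s) (y ∷ t) eq with e , es ← Vecₚ.∷-injective eq =
  cong₂ _∷_ (inj e) (vec-map-injective inj s t es)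

tuples : ℕ → ℕ → List (List ℕ)
tuples m zero    = [] ∷ []
tuples m (suc k) = concatMap (λ i → map (i ∷_) (tuples m k)) (upTo m)

anyᵇ : {A : Set} → (A → Bool) → List A → Bool
anyᵇ p []       = false
anyᵇ p (x ∷ xs) = if p x then true else anyᵇ p xs

any-sound : ∀ {A : Set} (p : A → Bool) xs → anyᵇ p xs ≡ true → Σ[ x ∈ A ] (x ∈ xs × p x ≡ true)
any-sound p (x ∷ xs) eq with p x in e
... | true  = x , here refl , e
... | false with y , y∈ , q ← any-sound p xs eq = y , there y∈ , q

any-complete : ∀ {A : Set} (p : A → Bool) {x xs} → x ∈ xs → p x ≡ true → anyᵇ p xs ≡ true
any-complete p {xs = x ∷ _} (here refl) e rewrite e = refl
any-complete p {xs = x ∷ _} (there x∈)  e with p x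
... | true  = refl
... | false = any-complete p x∈ e

coversᵇ : ℕ → ℕ → List (List ℕ) → Bool
coversᵇ m k L = allᵇ (λ s → not (uniqueᵇ s) ∨ anyᵇ (permᵇ s) L) (tuples m k)

picks : {A : Set} → List A → List (A × List A)
picks []       = []
picks (x ∷ xs) = (x , xs) ∷ map (λ p → proj₁ p , x ∷ proj₂ p) (picks xs)

precedesᵇ : List ℕ → ℕ → ℕ → Bool
precedesᵇ []      u v = false
precedesᵇ (x ∷ l) u v = if x ≡ᵇ u then memᵇ v l else precedesᵇ l u v

-- The number counts the steps still to be made; `picks` hands on only the arcs not yet used and the
-- vertices not yet visited.
searchᵇ : ℕ → Bool → List (List ℕ) → List ℕ → ℕ → Bool
searchᵇ zero    t as vs x = true
searchᵇ (suc n) t as vs x = anyᵇ (λ a → anyᵇ (λ w →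
  (if t then precedesᵇ (proj₁ a) x (proj₁ w) else precedesᵇ (proj₁ a) (proj₁ w) x)
  ∧ searchᵇ n (not t) (proj₂ a) (proj₂ w) (proj₁ w)) (picks vs)) (picks as)

startsᵇ : ℕ → List (List ℕ) → ℕ × List ℕ → Bool
startsᵇ n L (x , vs) = searchᵇ n true L vs x ∨ searchᵇ n false L vs x

hasPathᵇ : ℕ → List (List ℕ) → Bool
hasPathᵇ m L = anyᵇ (startsᵇ (m ∸ 1) L) (picks (upTo m))

pick : ∀ {A : Set} {x : A} {xs} → x ∈ xs → Σ[ ys ∈ List A ] ((x , ys) ∈ picks xs × xs ↭ x ∷ ys)
pick {xs = x ∷ xs} (here refl) = xs , here refl , ↭-refl
pick {xs = y ∷ xs} (there x∈) with ys , p∈ , perm ← pick x∈ =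
  y ∷ ys , there (∈-map⁺ _ p∈) , ↭-trans (prep y perm) (swap y _ ↭-refl)

PrecedesIn : List ℕ → ℕ → ℕ → Set
PrecedesIn l u v = precedesᵇ l u v ≡ true

-- A negative answer of the search is what gets used, so it is completeness that has to be shown.
search-complete : ∀ t as vs x ps → Alternates (orient t PrecedesIn) x ps → map proj₂ ps ↭ vs →
                  All (_∈ as) (map proj₁ ps) → Unique (map proj₁ ps) → searchᵇ (length ps) t as vs x ≡ true
search-complete t as vs x [] _ _ _ _ = refl
search-complete t as vs x ((a , w) ∷ ps) (r , alt) perm (a∈ ∷ as∈) (a∉ ∷ u)
  with as′ , pa , aperm ← pick a∈
  with vs′ , pw , wperm ← pick (∈-resp-↭ perm (here refl)) =
  any-complete _ pa (any-complete _ pw (step t r alt))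
  where
  remaining : All (_∈ as′) (map proj₁ ps)
  remaining = All.tabulate (λ b∈ → tail-∈ (∈-resp-↭ aperm (All.lookup as∈ b∈)) (λ b≡a → All.lookup a∉ b∈ (sym b≡a)))
    where
    tail-∈ : ∀ {b} → b ∈ a ∷ as′ → b ≢ a → b ∈ as′
    tail-∈ (here e)   b≢a = ⊥-elim (b≢a e)
    tail-∈ (there b∈) _   = b∈
  step : ∀ t → orient t PrecedesIn a x w → Alternates (flip₃ (orient t PrecedesIn)) w ps →
         (if t then precedesᵇ a x w else precedesᵇ a w x) ∧ searchᵇ (length ps) (not t) as′ vs′ w ≡ true
  step true  r alt rewrite r = search-complete false as′ vs′ w ps alt (drop-∷ (↭-trans perm wperm)) remaining u
  step false r alt rewrite r = search-complete true as′ vs′ w ps alt (drop-∷ (↭-trans perm wperm)) remaining u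

-- Matching the arc predicate with a list of numerals turns the absence of a path, and the presence
-- of an arc on every k-set, into closed Boolean computations.
record Excluded {m k : ℕ} (S : Vec (Fin m) k → Set) (L : List (List ℕ)) : Set where
  field
    encode  : ∀ t → S t → code t ∈ L
    decode  : ∀ t → code t ∈ L → S t
    covers  : coversᵇ m k L ≡ true
    blocked : hasPathᵇ m L ≡ false

circulant-⊆ : ∀ m D {i d} → i < suc m → d ∈ D → (i , (i + d) % suc m) ∈ circulant m D
circulant-⊆ m D {i} {d} i< d∈ = ∈-concatMap⁺ (λ i → map (λ d → i , (i + d) % suc m) D)
  (Any.map (λ { refl → ∈-map⁺ (λ d → i , (i + d) % suc m) d∈ }) (∈-upTo⁺ i<))

circulant-⊇ : ∀ m D {e} → e ∈ circulant m D → Σ[ d ∈ ℕ ] (d ∈ D × proj₂ e ≡ (proj₁ e + d) % suc m)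
circulant-⊇ m D e∈ = go (∈-concatMap⁻ (λ i → map (λ d → i , (i + d) % suc m) D) {xs = upTo (suc m)} e∈)
  where
  go : ∀ {e is} → Any (λ i → e ∈ map (λ d → i , (i + d) % suc m) D) is → Σ[ d ∈ ℕ ] (d ∈ D × proj₂ e ≡ (proj₁ e + d) % suc m)
  go (here e∈) with d , d∈ , refl ← ∈-map⁻ _ e∈ = d , d∈ , refl
  go (there p) = go p

circulant-excluded : ∀ m D → let L = asLists (circulant m D) in
  coversᵇ (suc m) 2 L ≡ true → hasPathᵇ (suc m) L ≡ false → Excluded (Arcs (Circulant m D)) L
circulant-excluded m D cov blk = record
  { encode = λ { (u ∷ v ∷ []) (d , d∈ , eq) →
      subst (λ j → (toℕ u ∷ j ∷ []) ∈ _) (sym eq) (∈-map⁺ _ (circulant-⊆ m D (Finₚ.toℕ<n u) d∈)) }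
  ; decode = λ { (u ∷ v ∷ []) l∈ → dec u v l∈ }
  ; covers = cov ; blocked = blk }
  where
  dec : ∀ u v → (toℕ u ∷ toℕ v ∷ []) ∈ asLists (circulant m D) → Arcs (Circulant m D) (u ∷ v ∷ [])
  dec u v l∈ with (i , j) , e∈ , eq ← ∈-map⁻ (λ e → proj₁ e ∷ proj₂ e ∷ []) l∈
    with refl ← eq = circulant-⊇ m D e∈

T3-excluded : Excluded (Arcs T3c) (asLists T3)
T3-excluded = circulant-excluded 2 (1 ∷ []) refl refl

T5-excluded : Excluded (Arcs T5c) (asLists T5)
T5-excluded = circulant-excluded 4 (1 ∷ 2 ∷ []) refl refl

T7-excluded : Excluded (Arcs T7c) (asLists T7)
T7-excluded = circulant-excluded 6 (1 ∷ 2 ∷ 4 ∷ []) refl refl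

H4-excluded : Excluded (Arcs H4) H4list
H4-excluded = record
  { encode = λ { t (here refl) → here refl
               ; t (there (here refl)) → there (here refl)
               ; t (there (there (here refl))) → there (there (here refl))
               ; t (there (there (there (here refl)))) → there (there (there (here refl))) }
  ; decode = λ t l∈ → dec t (∈-map⁻ code l∈)
  ; covers = refl ; blocked = refl }
  where
  dec : ∀ t → Σ[ s ∈ Vec (Fin 4) 3 ] (s ∈ H4arcs × code t ≡ code s) → t ∈ H4arcs
  dec t (s , s∈ , eq) = subst (_∈ H4arcs) (sym (code-injective t s eq)) s∈

map-at-injective : ∀ {A : Set} d {vs : List A} → Unique vs → ∀ {xs ys} → All (_< length vs) xs → All (_< length vs) ys →
                   map (at d vs) xs ≡ map (at d vs) ys → xs ≡ ys
map-at-injective d u {[]}    {[]}    _        _        _  = refl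
map-at-injective d u {x ∷ _} {y ∷ _} (b ∷ bs) (c ∷ cs) eq with e , es ← ∷-injective eq =
  cong₂ _∷_ (at-injective d u x y b c e) (map-at-injective d u bs cs es)

toList-unique : ∀ {n k} (t : Vec (Fin n) k) → Distinct t → Unique (toList t)
toList-unique []      _ = []
toList-unique (x ∷ t) d = All.tabulate fresh ∷ toList-unique t (λ i j eq → Finₚ.suc-injective (d (suc i) (suc j) eq))
  where
  fresh : ∀ {y} → y ∈ toList t → x ≢ y
  fresh y∈ refl with () ← d zero (suc (VAny.index (VAnyₚ.toList⁻ y∈))) (VAnyₚ.lookup-index (VAnyₚ.toList⁻ y∈))

∈-tuples : ∀ {m} k (l : List ℕ) → length l ≡ k → All (_< m) l → l ∈ tuples m k
∈-tuples zero    []      refl []       = here refl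
∈-tuples {m} (suc k) (i ∷ l) refl (b ∷ bs) = ∈-concatMap⁺ (λ i → map (i ∷_) (tuples m k))
  (Any.map (λ { refl → ∈-map⁺ (i ∷_) (∈-tuples k l refl bs) }) (∈-upTo⁺ b))

unique-complete : ∀ {xs} → Unique xs → uniqueᵇ xs ≡ true
unique-complete []                  = refl
unique-complete {x ∷ xs} (x∉ ∷ u) with memᵇ x xs in e
... | true  = ⊥-elim (All.lookup x∉ (memᵇ-sound x xs e) refl)
... | false = unique-complete u

covers-sound : ∀ {m} k L → coversᵇ m k L ≡ true → ∀ l → length l ≡ k → All (_< m) l → Unique l →
               Σ[ l′ ∈ List ℕ ] (l′ ∈ L × l ↭ l′)
covers-sound k L cov l len below u = go (All.lookup (all-sound _ _ cov) (∈-tuples k l len below))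
  where
  go : not (uniqueᵇ l) ∨ anyᵇ (permᵇ l) L ≡ true → Σ[ l′ ∈ List ℕ ] (l′ ∈ L × l ↭ l′)
  go eq rewrite unique-complete u with l′ , l∈ , p ← any-sound (permᵇ l) L eq = l′ , l∈ , perm-sound l l′ p

toList-map : ∀ {A B : Set} {k} (f : A → B) (t : Vec A k) → toList (Vec.map f t) ≡ map f (toList t)
toList-map f []      = refl
toList-map f (x ∷ t) = cong (f x ∷_) (toList-map f t)

length-toList : ∀ {A : Set} {k} (t : Vec A k) → length (toList t) ≡ k
length-toList []      = refl
length-toList (_ ∷ t) = cong suc (length-toList t)

-- A copy of an exceptional arc list yields an isomorphism

module _ {m k : ℕ} (H : Hypertournament m k) where
  open Concrete H

  same-arc : ∀ {s t} → Arc H s → Arc H t → (∀ {v} → v ∈ᵥ s → v ∈ᵥ t) → (∀ {v} → v ∈ᵥ t → v ∈ᵥ s) → s ≡ t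
  same-arc {s} {t} as at s⊆t t⊆s =
    arc-unique H (subsetOf (toList s)) (trans (subsetOf-size (toList-unique s (arc-distinct H s as))) (length-toList s))
      s t as (λ v → mk⇔ to from) at (λ v → mk⇔ (to ∘ t⊆s) (s⊆t ∘ from))
    where
    to : ∀ {v} → v ∈ᵥ s → v Subset.∈ subsetOf (toList s)
    to {v} v∈ = Vecₚ.lookup⇒[]= v _ (subsetOf-⊇ (toList s) (VAnyₚ.toList⁺ v∈))
    from : ∀ {v} → v Subset.∈ subsetOf (toList s) → v ∈ᵥ s
    from v∈ = VAnyₚ.toList⁻ (subsetOf-⊆ (toList s) (Vecₚ.[]=⇒lookup v∈))

  -- A chain of k vertices in an arc with k distinct entries has to use every place in turn. The
  -- arities 2 and 3 of the exceptional hypertournaments are treated by `rigid₂` and `rigid₃`.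
  Rigid : Set
  Rigid = ∀ {a} ws → length ws ≡ k → Linked (R a) ws → toList a ≡ ws

  -- By `covers`, the image of an arc t of `H` has the same vertices as some listed tuple. The arc
  -- realising that tuple lies on the vertex set of t, so uniqueness identifies it with t, and the
  -- image is the listed tuple. Conversely every listed tuple is realised by an arc.
  copy⇒≅ : Rigid → ∀ {S L} → Excluded S L → Copy R L (allFin m) →
           toSystem H ≅ record { size = m ; arity = k ; Arcs = S }
  copy⇒≅ rigid {S} {L} E (v₀ , zs , perm , copies) = refl , mk↔ₛ′ f g f∘g g∘f , λ t → mk⇔ (forth t) (back t)
    where
    open Excluded E
    open Realised
    uzs : Unique zs
    uzs = Unique-resp-↭ (↭-sym perm) (Uniqueₚ.allFin⁺ m)
    len : length zs ≡ m
    len = trans (↭-length perm) (length-tabulate id)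
    find : ∀ v → Σ[ i ∈ ℕ ] (i < length zs × at v₀ zs i ≡ v)
    find v = ∈⇒at v₀ (∈-resp-↭ (↭-sym perm) (∈-allFin v))
    g : Fin m → Fin m
    g i = at v₀ zs (toℕ i)
    f : Fin m → Fin m
    f v = fromℕ< (subst (proj₁ (find v) <_) len (proj₁ (proj₂ (find v))))
    g∘f : ∀ v → g (f v) ≡ v
    g∘f v = trans (cong (at v₀ zs) (Finₚ.toℕ-fromℕ< _)) (proj₂ (proj₂ (find v)))
    f∘g : ∀ i → f (g i) ≡ i
    f∘g i = Finₚ.toℕ-injective (at-injective v₀ uzs _ _ (bound (f (g i))) (bound i) (g∘f (g i)))
      where
      bound : ∀ j → toℕ j < length zs
      bound j = subst (toℕ j <_) (sym len) (Finₚ.toℕ<n j)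
    place-code : ∀ {j} (s : Vec (Fin m) j) → map (at v₀ zs) (code s) ≡ toList (Vec.map g s)
    place-code s = trans (sym (map-∘ (toList s))) (sym (toList-map g s))
    map-g∘f : ∀ {j} (t : Vec (Fin m) j) → Vec.map g (Vec.map f t) ≡ t
    map-g∘f t = trans (sym (Vecₚ.map-∘ g f t)) (trans (Vecₚ.map-cong g∘f t) (Vecₚ.map-id t))
    placed : ∀ t → map (at v₀ zs) (code (Vec.map f t)) ≡ toList t
    placed t = trans (place-code (Vec.map f t)) (cong toList (map-g∘f t))
    bounded : ∀ (t : Vec (Fin m) k) → All (_< m) (code t)
    bounded t = Allₚ.map⁺ (All.universal Finₚ.toℕ<n (toList t))
    length-code : ∀ (t : Vec (Fin m) k) → length (code t) ≡ k
    length-code t = trans (length-map toℕ (toList t)) (length-toList t)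
    forth : ∀ t → Arc H t → S (Vec.map f t)
    forth t arc-t
      with l , l∈ , l↭ ← covers-sound k L covers (code (Vec.map f t)) (length-code (Vec.map f t)) (bounded (Vec.map f t))
             (Uniqueₚ.map⁻ (subst Unique (sym (placed t)) (toList-unique t (arc-distinct H t arc-t)))) =
      decode (Vec.map f t) (subst (_∈ L) (sym code≡l) l∈)
      where
      C = All.lookup copies l∈
      t↭ : toList t ↭ map (at v₀ zs) l
      t↭ = subst (_↭ _) (placed t) (map⁺ (at v₀ zs) l↭)
      arc≡ : toList (arc C) ≡ map (at v₀ zs) l
      arc≡ = rigid _ (trans (length-map _ l) (trans (sym (↭-length l↭)) (length-code (Vec.map f t)))) (sorted C)
      t≡arc : t ≡ arc C
      t≡arc = same-arc arc-t (isArc C) (λ v∈ → on C (∈-resp-↭ t↭ (VAnyₚ.toList⁺ v∈)))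
        (λ v∈ → VAnyₚ.toList⁻ (∈-resp-↭ (↭-sym t↭) (off C v∈)))
      bounded-l : All (_< m) l
      bounded-l = All.tabulate (λ i∈ → All.lookup (bounded (Vec.map f t)) (∈-resp-↭ (↭-sym l↭) i∈))
      code≡l : code (Vec.map f t) ≡ l
      code≡l = map-at-injective v₀ uzs (subst (λ n → All (_< n) (code (Vec.map f t))) (sym len) (bounded (Vec.map f t)))
        (subst (λ n → All (_< n) l) (sym len) bounded-l) (trans (placed t) (trans (cong toList t≡arc) arc≡))
    back : ∀ t → S (Vec.map f t) → Arc H t
    back t s = subst (Arc H) (toList-injective _ _ (trans arc≡ (placed t))) (isArc C)
      where
      C = All.lookup copies (encode (Vec.map f t) s)
      arc≡ : toList (arc C) ≡ map (at v₀ zs) (code (Vec.map f t))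
      arc≡ = rigid _ (trans (length-map _ (code (Vec.map f t))) (length-code (Vec.map f t))) (sorted C)

rigid₂ : ∀ {n} (H : Hypertournament n 2) → Rigid H
rigid₂ H {a₀ ∷ a₁ ∷ []} (u ∷ v ∷ []) refl ((_ , zero , suc zero , _ , refl , refl) ∷ [-]) = refl
rigid₂ H {a₀ ∷ a₁ ∷ []} (u ∷ v ∷ []) refl ((_ , suc zero , suc zero , s≤s () , _) ∷ [-])

rigid₃ : ∀ {n} (H : Hypertournament n 3) → Rigid H
rigid₃ H {a} (u ∷ v ∷ w ∷ []) refl ((arc , i , j , i<j , iu , jv) ∷ (_ , j′ , l , j′<l , j′v , lw) ∷ [-])
  with refl ← arc-distinct H a arc j j′ (trans jv (sym j′v)) = go a i j l i<j j′<l iu jv lw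
  where
  go : ∀ (a : Vec _ 3) i j l → i Fin.< j → j Fin.< l → lookup a i ≡ u → lookup a j ≡ v → lookup a l ≡ w →
       toList a ≡ u ∷ v ∷ w ∷ []
  go (_ ∷ _ ∷ _ ∷ []) zero (suc zero) (suc (suc zero)) _ _ refl refl refl = refl
  go _ _ (suc zero) (suc zero) _ (s≤s ())
  go _ _ (suc (suc zero)) (suc zero) _ (s≤s ())
  go _ _ (suc (suc zero)) (suc (suc zero)) _ (s≤s (s≤s ()))
  go _ (suc _) (suc zero) _ (s≤s ())

-- Exceptional hypertournaments have no antidirected hamiltonian path

precedes⇒precedesᵇ : ∀ {k} (a : Vec ℕ k) i j → i Fin.< j → PrecedesIn (toList a) (lookup a i) (lookup a j)
precedes⇒precedesᵇ (x ∷ a) zero (suc j) _ rewrite ≡ᵇ-refl x = memᵇ-complete (VAnyₚ.toList⁺ (∈-lookup j a))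
precedes⇒precedesᵇ (x ∷ a) (suc i) (suc j) (s≤s i<j) with x ≡ᵇ lookup a i
... | true  = memᵇ-complete (VAnyₚ.toList⁺ (∈-lookup j a))
... | false = precedes⇒precedesᵇ a i j i<j

steps : {A V : Set} → (ℕ → A) → (ℕ → V) → ℕ → List (A × V)
steps a x zero    = []
steps a x (suc r) = (a 0 , x 1) ∷ steps (a ∘ suc) (x ∘ suc) r

steps-vertices : ∀ {A V : Set} (a : ℕ → A) (x : ℕ → V) r → map proj₂ (steps a x r) ≡ applyUpTo (x ∘ suc) r
steps-vertices a x zero    = refl
steps-vertices a x (suc r) = cong (x 1 ∷_) (steps-vertices (a ∘ suc) (x ∘ suc) r)

steps-arcs : ∀ {A V : Set} (a : ℕ → A) (x : ℕ → V) r → map proj₁ (steps a x r) ≡ applyUpTo a r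
steps-arcs a x zero    = refl
steps-arcs a x (suc r) = cong (a 0 ∷_) (steps-arcs (a ∘ suc) (x ∘ suc) r)

steps-length : ∀ {A V : Set} (a : ℕ → A) (x : ℕ → V) r → length (steps a x r) ≡ r
steps-length a x zero    = refl
steps-length a x (suc r) = cong suc (steps-length (a ∘ suc) (x ∘ suc) r)

-- Antisymmetry makes the orientations given at consecutive inner vertices agree.
steps-alternate : ∀ {A V : Set} {R : A → V → V → Set} (a : ℕ → A) (x : ℕ → V) r →
  (∀ i {u v} → i < suc r → R (a i) u v → R (a i) v u → ⊥) →
  (∀ i → suc i < suc r → (R (a i) (x i) (x (suc i)) × R (a (suc i)) (x (suc (suc i))) (x (suc i)))
                       ⊎ (R (a i) (x (suc i)) (x i) × R (a (suc i)) (x (suc i)) (x (suc (suc i))))) →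
  ∀ t → orient t R (a 0) (x 0) (x 1) → Alternates (orient t R) (x 0) (steps a x (suc r))
steps-alternate a x zero    asym alt true  e = e , tt
steps-alternate a x zero    asym alt false e = e , tt
steps-alternate {R = R} a x (suc r) asym alt t e = go t e (alt 0 (s≤s (s≤s z≤n)))
  where
  next : ∀ t → orient t R (a 1) (x 1) (x 2) → Alternates (orient t R) (x 1) (steps (a ∘ suc) (x ∘ suc) (suc r))
  next = steps-alternate (a ∘ suc) (x ∘ suc) r (λ i i< → asym (suc i) (s≤s i<)) (λ i i< → alt (suc i) (s≤s i<))
  go : ∀ t → orient t R (a 0) (x 0) (x 1) →
       (R (a 0) (x 0) (x 1) × R (a 1) (x 2) (x 1)) ⊎ (R (a 0) (x 1) (x 0) × R (a 1) (x 1) (x 2)) →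
       Alternates (orient t R) (x 0) (steps a x (suc (suc r)))
  go true  e (inj₁ (_ , q)) = e , next false q
  go true  e (inj₂ (p , _)) = ⊥-elim (asym 0 (s≤s z≤n) e p)
  go false e (inj₁ (p , _)) = ⊥-elim (asym 0 (s≤s z≤n) e p)
  go false e (inj₂ (_ , q)) = e , next true q

precedes-asym : ∀ {n k} {a : Vec (Fin n) k} → Distinct a → ∀ {u v} → Precedes a u v → Precedes a v u → ⊥
precedes-asym d (i , j , i<j , iu , jv) (j′ , i′ , j′<i′ , j′v , i′u)
  with refl ← d j j′ (trans jv (sym j′v)) | refl ← d i i′ (trans iu (sym i′u)) = Finₚ.<-asym i<j j′<i′

-- Carried along the bijection and written in numerals, a path would be found by the search recorded
-- in `blocked`. For this it is enough that arcs of `H` go to arcs.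
no-path : ∀ {m k L n} {S : Vec (Fin (3 + m)) k → Set} → Excluded S L → (H : Hypertournament n k) →
          (f : Fin n ↔ Fin (3 + m)) → (∀ t → Arc H t → S (Vec.map (Inverse.to f) t)) →
          ¬ HasAntidirectedHamiltonianPath H
no-path {m} {k} {L} {n} E H f arcs (t , P , onto) = true≢false (trans (sym found) blocked)
  where
  open Excluded E
  to = Inverse.to f
  X : ℕ → ℕ
  X i = toℕ (to (x P i))
  to-injective : ∀ {u v} → to u ≡ to v → u ≡ v
  to-injective {u} {v} eq = trans (sym (Inverse.strictlyInverseʳ f u)) (trans (cong (Inverse.from f) eq) (Inverse.strictlyInverseʳ f v))
  X-injective : ∀ {i j} → i < t → j < t → X i ≡ X j → i ≡ j
  X-injective i< j< eq = x-inj P _ _ i< j< (to-injective (Finₚ.toℕ-injective eq))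
  B : ℕ → List ℕ
  B i = code (Vec.map to (a P i))
  B-injective : ∀ {i j} → suc i < t → suc j < t → B i ≡ B j → i ≡ j
  B-injective {i} {j} i< j< eq = a-inj P i j i< j<
    (vec-map-injective to-injective _ _ (code-injective (Vec.map to (a P i)) (Vec.map to (a P j)) eq))
  perm : applyUpTo X t ↭ upTo (3 + m)
  perm = ∼bag⇒↭ (unique∧set⇒bag
    (Uniqueₚ.applyUpTo⁺₁ X t (λ i<j j<t eq → <⇒≢ i<j (X-injective (<-trans i<j j<t) j<t eq)))
    (Uniqueₚ.upTo⁺ (3 + m)) (mk⇔ into from))
    where
    into : ∀ {v} → v ∈ applyUpTo X t → v ∈ upTo (3 + m)
    into v∈ with i , _ , refl ← ∈-applyUpTo⁻ X v∈ = ∈-upTo⁺ (Finₚ.toℕ<n (to (x P i)))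
    from : ∀ {v} → v ∈ upTo (3 + m) → v ∈ applyUpTo X t
    from {v} v∈ with i , i< , eq ← onto (Inverse.from f (fromℕ< (∈-upTo⁻ v∈))) =
      subst (_∈ applyUpTo X t) (trans (cong (toℕ ∘ to) eq) (trans (cong toℕ (Inverse.strictlyInverseˡ f _)) (Finₚ.toℕ-fromℕ< _)))
        (∈-applyUpTo⁺ X i<)
  coded : ∀ b {u v} → Precedes b u v → PrecedesIn (code (Vec.map to b)) (toℕ (to u)) (toℕ (to v))
  coded b (p , q , p<q , refl , refl) = subst₂ (PrecedesIn (code (Vec.map to b))) (image p) (image q)
    (subst (λ l → PrecedesIn l (lookup W p) (lookup W q)) (toList-map toℕ (Vec.map to b)) (precedes⇒precedesᵇ W p q p<q))
    where
    W = Vec.map toℕ (Vec.map to b)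
    image : ∀ p → lookup W p ≡ toℕ (to (lookup b p))
    image p = trans (Vecₚ.lookup-map p toℕ (Vec.map to b)) (cong toℕ (Vecₚ.lookup-map p to b))
  t≡ : t ≡ 3 + m
  t≡ = trans (sym (length-applyUpTo X t)) (trans (↭-length perm) (length-applyUpTo id (3 + m)))
  <t : ∀ {i} → i < 3 + m → i < t
  <t {i} = subst (i <_) (sym t≡)
  ps = steps B X (2 + m)
  visits : X 0 ∷ map proj₂ ps ↭ upTo (3 + m)
  visits = ↭-trans (↭-reflexive (trans (cong (X 0 ∷_) (steps-vertices B X (2 + m))) (cong (applyUpTo X) (sym t≡)))) perm
  inL : All (_∈ L) (map proj₁ ps)
  inL = subst (All (_∈ L)) (sym (steps-arcs B X (2 + m)))
    (All.tabulate (λ l∈ → let (i , i< , eq) = ∈-applyUpTo⁻ B l∈ in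
      subst (_∈ L) (sym eq) (encode _ (arcs (a P i) (a-arc P i (<t (s≤s i<)))))))
  uniqueB : Unique (map proj₁ ps)
  uniqueB = subst Unique (sym (steps-arcs B X (2 + m)))
    (Uniqueₚ.applyUpTo⁺₁ B (2 + m) (λ i<j j< eq → <⇒≢ i<j (B-injective (<t (s≤s (<-trans i<j j<))) (<t (s≤s j<)) eq)))
  alternating : Σ[ s ∈ Bool ] Alternates (orient s PrecedesIn) (X 0) ps
  -- With at least three vertices there is a first inner vertex, and its condition decides the
  -- orientation with which the alternation begins.
  alternating = begin (anti P 0 (<t (s≤s (s≤s (s≤s z≤n)))))
    where
    walk : ∀ s → orient s Precedes (a P 0) (x P 0) (x P 1) → Alternates (orient s Precedes) (x P 0) (steps (a P) (x P) (2 + m))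
    walk = steps-alternate (a P) (x P) (1 + m)
      (λ i i< → precedes-asym {a = a P i} (arc-distinct H _ (a-arc P i (<t (s≤s i<)))))
      (λ i i< → anti P i (<t (s≤s i<)))
    codeStep : Vec (Fin n) k × Fin n → List ℕ × ℕ
    codeStep (b , v) = code (Vec.map to b) , toℕ (to v)
    recode′ : ∀ s v qs → Alternates (orient s Precedes) v qs → Alternates (orient s PrecedesIn) (toℕ (to v)) (map codeStep qs)
    recode′ s     v []             _       = tt
    recode′ true  v ((b , w) ∷ qs) (p , r) = coded b p , recode′ false w qs r
    recode′ false v ((b , w) ∷ qs) (p , r) = coded b p , recode′ true w qs r
    map-steps : ∀ b y r → map codeStep (steps b y r) ≡ steps (code ∘ Vec.map to ∘ b) (toℕ ∘ to ∘ y) r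
    map-steps b y zero    = refl
    map-steps b y (suc r) = cong (_ ∷_) (map-steps (b ∘ suc) (y ∘ suc) r)
    recode : ∀ s → Alternates (orient s Precedes) (x P 0) (steps (a P) (x P) (2 + m)) → Alternates (orient s PrecedesIn) (X 0) ps
    recode s alt = subst (Alternates (orient s PrecedesIn) (X 0)) (map-steps (a P) (x P) (2 + m)) (recode′ s (x P 0) _ alt)
    begin : ∀ {C D : Set} → (Precedes (a P 0) (x P 0) (x P 1) × C) ⊎ (Precedes (a P 0) (x P 1) (x P 0) × D) →
            Σ[ s ∈ Bool ] Alternates (orient s PrecedesIn) (X 0) ps
    begin (inj₁ (p , _)) = true  , recode true (walk true p)
    begin (inj₂ (p , _)) = false , recode false (walk false p)
  found : hasPathᵇ (3 + m) L ≡ true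
  found with vs , p∈ , perm₀ ← pick (∈-resp-↭ visits (here refl)) =
    any-complete (startsᵇ (2 + m) L) p∈
      (go (proj₁ alternating) {vs} (searched (proj₁ alternating) (proj₂ alternating) (drop-∷ (↭-trans visits perm₀))))
    where
    searched : ∀ s {vs} → Alternates (orient s PrecedesIn) (X 0) ps → map proj₂ ps ↭ vs → searchᵇ (2 + m) s L vs (X 0) ≡ true
    searched s {vs} alt v = subst (λ r → searchᵇ r s L vs (X 0) ≡ true) (steps-length B X (2 + m))
      (search-complete s L vs (X 0) ps alt v inL uniqueB)
    go : ∀ s {vs} → searchᵇ (2 + m) s L vs (X 0) ≡ true → startsᵇ (2 + m) L (X 0 , vs) ≡ true
    go true  {vs} eq = cong (_∨ searchᵇ (2 + m) false L vs (X 0)) eq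
    go false {vs} eq = trans (cong (searchᵇ (2 + m) true L vs (X 0) ∨_) eq) (∨-zeroʳ _)
  true≢false : true ≡ false → ⊥
  true≢false ()

excluded : ∀ {n k m j} (H : Hypertournament n k) → k ≡ j → n ≡ m → (∀ (H : Hypertournament m j) → Rigid H) →
           ∀ {S L} → Excluded S L → Concrete.Copy H (Concrete.R H) L (allFin n) →
           toSystem H ≅ record { size = m ; arity = j ; Arcs = S }
excluded H refl refl rigid E = copy⇒≅ H (rigid H) E

theorem2p2 : ∀ (n k : ℕ) (H : Hypertournament n k) → 2 ≤ k → k ≤ n ∸ 1 →
    HasAntidirectedHamiltonianPath H
    ⇔ (¬ ((toSystem H ≅ H4) ⊎ (toSystem H ≅ T3c) ⊎ (toSystem H ≅ T5c) ⊎ (toSystem H ≅ T7c)))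
theorem2p2 n k H 2≤k k≤n∸1 = mk⇔ necessary sufficient
  where
  open Concrete H
  k<n : suc k ≤ n
  k<n = go n k≤n∸1
    where
    go : ∀ n → k ≤ n ∸ 1 → suc k ≤ n
    -- Subtraction is truncated, so n = 0 would leave k ≤ 0, against 2 ≤ k.
    go zero    k≤ with () ← ≤-trans 2≤k k≤
    go (suc n) k≤ = s≤s k≤
  necessary : HasAntidirectedHamiltonianPath H →
              ¬ ((toSystem H ≅ H4) ⊎ (toSystem H ≅ T3c) ⊎ (toSystem H ≅ T5c) ⊎ (toSystem H ≅ T7c))
  necessary path (inj₁ (refl , f , iso)) = no-path H4-excluded H f (λ t → Equivalence.to (iso t)) path
  necessary path (inj₂ (inj₁ (refl , f , iso))) = no-path T3-excluded H f (λ t → Equivalence.to (iso t)) path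
  necessary path (inj₂ (inj₂ (inj₁ (refl , f , iso)))) = no-path T5-excluded H f (λ t → Equivalence.to (iso t)) path
  necessary path (inj₂ (inj₂ (inj₂ (refl , f , iso)))) = no-path T7-excluded H f (λ t → Equivalence.to (iso t)) path
  order : ∀ {m} → length (allFin n) ≡ m → n ≡ m
  order eq = trans (sym (length-tabulate id)) eq
  sufficient : ¬ ((toSystem H ≅ H4) ⊎ (toSystem H ≅ T3c) ⊎ (toSystem H ≅ T5c) ⊎ (toSystem H ≅ T7c)) →
               HasAntidirectedHamiltonianPath H
  sufficient none with classify ordering 2≤k (Uniqueₚ.allFin⁺ n) (subst (suc k ≤_) (sym (length-tabulate id)) k<n)
  ... | covered c     = hamiltonian (≤-trans 2≤k (≤-trans (n≤1+n k) k<n)) c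
  ... | isH4 eq len c = ⊥-elim (none (inj₁ (excluded H eq (order len) rigid₃ H4-excluded c)))
  ... | isT3 eq len c = ⊥-elim (none (inj₂ (inj₁ (excluded H eq (order len) rigid₂ T3-excluded c))))
  ... | isT5 eq len c = ⊥-elim (none (inj₂ (inj₂ (inj₁ (excluded H eq (order len) rigid₂ T5-excluded c)))))
  ... | isT7 eq len c = ⊥-elim (none (inj₂ (inj₂ (inj₂ (excluded H eq (order len) rigid₂ T7-excluded c)))))
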